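{- Let $(\lambda_n)_{n\ge 3}$ be a sequence of positive real numbers, and for $n\ge 3$ let $F_n^{(\lambda_n)}$ be the event, defined in the context, that the random majority graph $\widehat G_n$ differs from $G_n$. If $$\liminf_{n\to\infty}\frac{\lambda_n}{n^3} > 16\ln 2 ,$$ then there exist $K>0$ and $\beta>0$ such that, for every integer $n\ge 3$, $$\mathbb{P}\big(F_n^{(\lambda_n)}\big) < K e^{ -\beta n}.$$ Therefore, $\lim_{n\to\infty}\mathbb{P}\big(F_n^{(\lambda_n)}\big)=0$.
   Context: For a positive integer $m$, $[m]=\{1,\dots,m\}$. A voting profile on a finite set $V$ of candidates is a matrix each of whose rows (preference lists, one per voter) is a permutation of the elements of $V$; its size $\#R$ is its number of rows. The majority graph of $R$ is the directed graph with vertex set $V$ in which $(a,b)$, $a\neq b$, is an arrow if and only if $a$ precedes $b$ in more than half of the rows of $R$; $R$ generates $G$ if $G$ is the majority graph of $R$. Graph $G_3=([8],E_3)$: $E_3$ consists of the 28 arrows $(1,2),(1,3),(1,5),(2,3),(2,4),(2,6),(2,7),$ $(3,4),(3,5),(3,6),(3,8),(4,1),(4,5),(4,8),$ $(5,2),(5,6),(5,7),(6,1),(6,4),(6,7),(6,8),$ $(7,1),(7,3),(7,4),(7,8),(8,1),(8,2),(8,5).$ Graph $G_n=([2^n],E_n)$ for $n\ge 4$: for $q\in[2^{n-3}]$ let $C_q=[8q]\setminus[8(q-1)]$; these classes partition $[2^n]$. For $i,j$ in the same class $C_q$, $(i,j)\in E_n$ if and only if $(i-8(q-1),j-8(q-1))\in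 E_3$. For $i<j$ in different classes, $(i,j)\in E_n$ if $i+j$ is even, and $(j,i)\in E_n$ if $i+j$ is odd. Profile $R_3$ on $[8]$ has the ten rows, in order: $(8,1,5,2,3,4,6,7)$, $(2,7,6,4,1,3,5,8)$, $(2,7,3,6,4,5,8,1)$, $(4,1,3,8,5,6,7,2)$, $(3,5,2,6,7,1,4,8)$, $(6,8,4,1,5,7,2,3)$, $(6,7,3,4,8,1,2,5)$, $(8,5,2,7,1,4,3,6)$, $(7,8,5,6,3,4,1,2)$, $(1,2,3,4,5,6,7,8)$. Operations: for row vectors, $(u_1,\dots,u_N)$ denotes concatenation, and $\bar u$ is $u$ in reverse order. For matrices with the same number of columns, $(M_1,\dots,M_N)_V$ is the matrix obtained by stacking all the rows of $M_1,\dots,M_N$ vertically in this order. $R+a\cdot\boldsymbol{1}$ is $R$ with $a$ added to every entry. For profiles $R^{(1)},R^{(2)}$ on disjoint candidate sets with the same even size $2r$, $R^{(1)}\bowtie R^{(2)}$ is the profile of size $2r$ on the union of the candidate sets whose $s$-th row is $(R^{(1)}_{s,\cdot},R^{(2)}_{s,\cdot})$ for $s$ odd and $(R^{(2)}_{s,\cdot},R^{(1)}_{s,\cdot})$ for $s$ even. For $n\ge 4$ define the vectors (entries in increasing order) $A^{(n)}_1=(1,3,\dots,2^{n-1}-1)$, $B^{(n)}_1=(2^{n-1}+1,2^{n-1}+3,\dots,2^n-1)$, $A^{(n)}_2=(2,4,\dots,2^{n-1})$, $B^{(n)}_2=(2^{n-1}+2,2^{n-1}+4,\dots,2^n)$,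 and the preference lists $v^{(n)}_1=(A^{(n)}_1,B^{(n)}_1,A^{(n)}_2,B^{(n)}_2)$, $v^{(n)}_2=(\bar A^{(n)}_2,\bar B^{(n)}_2,\bar A^{(n)}_1,\bar B^{(n)}_1)$, $v^{(n)}_3=(B^{(n)}_1,A^{(n)}_2,B^{(n)}_2,A^{(n)}_1)$, $v^{(n)}_4=(\bar B^{(n)}_2,\bar A^{(n)}_1,\bar B^{(n)}_1,\bar A^{(n)}_2)$. Recursively, for $n\ge 4$, $$R_n=\Big(v^{(n)}_1,v^{(n)}_2,v^{(n)}_3,v^{(n)}_4,\big[R_{n-1}\bowtie(R_{n-1}+2^{n-1}\cdot\boldsymbol{1})\big]\Big)_V ,$$ a voting profile on $[2^n]$ with $4n-2$ rows. Random profile: for $n\ge3$ the number of voters is a Poisson random variable with parameter $\lambda_n$, and each voter selects, independently and uniformly at random, one of the $4n-2$ rows of $R_n$. Let $W^{(n)}_\ell$ be the number of voters who selected the $\ell$-th row, $\ell\in[4n-2]$; equivalently (by Poisson thinning), $W^{(n)}_1,\dots,W^{(n)}_{4n-2}$ are independent Poisson random variables with parameter $\lambda_n/(4n-2)$. The random voting profile $\hat R_n$ has, for each $\ell\in[4n-2]$, exactly $W^{(n)}_\ell$ rows equal to the $\ell$-th row of $R_n$. $\widehat G_n=\widehat G_n(W^{(n)}_1,\dots,W^{(n)}_{4n-2})$ is the majority graph of $\hat R_n$ on $[2^n]$, and $F_n^{(\lambda_n)}=\{\widehat G_n\neq G_n\}$. -}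

module Defs where

open import Data.Bool.Base using (Bool; true; false; if_then_else_; not; _∧_)
import Data.Bool.Properties as Bool
import Data.Integer.Base as ℤ
open import Data.Bool.ListAction using (any)
open import Data.List.Base using (List; []; _∷_; _++_; map; reverse; length; filterᵇ;
  applyUpTo; upTo; concat; replicate)
open import Data.List.Relation.Unary.All using (All; all?)
open import Data.Nat.Base as ℕ using (ℕ; zero; suc; _≡ᵇ_; _<ᵇ_; _!)
open import Data.Nat.DivMod using () renaming (_/_ to _div_; _%_ to _mod_)
import Data.Nat.Properties as ℕ
open import Data.Product.Base using (_×_; _,_; ∃; proj₁; proj₂)
open import Data.Rational.Base as ℚ using (ℚ; 0ℚ; 1ℚ; ½)
import Data.Rational.Properties as ℚ
import Data.Rational.Unnormalised.Base as ℚᵘ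
import Data.Rational.Unnormalised.Properties as ℚᵘ
import Data.Integer.Properties as ℤ
open import Data.Sum.Base using (inj₁; inj₂)
open import Data.Vec.Base as Vec using (Vec; []; _∷_)
open import Level using (0ℓ)
open import Relation.Binary.PropositionalEquality.Core using (_≡_; refl; sym; trans; cong; cong₂; subst)
open import Relation.Nullary using (¬_; Dec; does; ¬?)
open import Relation.Unary using (Pred; Decidable)
open import Relation.Nullary.Decidable.Core using (dec⇒maybe)
open import Tactic.RingSolver using (solve-∀)
open import Tactic.RingSolver.Core.AlmostCommutativeRing using (AlmostCommutativeRing; fromCommutativeRing)

module Voting where

  open import Data.Nat.Base using (_+_; _*_; _∸_; _^_)

  -- Rows are meant to list each candidate once; `a precedes b` is only used on such rows.
  Row Profile : Set
  Row     = List ℕ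
  Profile = List Row

  -- Arrow relation of a digraph; a vertex set of positive integers is given separately.
  Digraph : Set
  Digraph = ℕ → ℕ → Bool

  candidates : ℕ → List ℕ
  candidates m = map suc (upTo m)

  _≡[_]_ : Digraph → List ℕ → Digraph → Set
  G ≡[ V ] H = All (λ a → All (λ b → G a b ≡ H a b) V) V

  _≡[_]?_ : ∀ G V H → Dec (G ≡[ V ] H)
  G ≡[ V ]? H = all? (λ a → all? (λ b → G a b Bool.≟ H a b) V) V

  _precedes_ : ℕ → ℕ → Row → Bool
  (a precedes b) []      = false
  (a precedes b) (x ∷ r) = if x ≡ᵇ a then any (b ≡ᵇ_) r else (a precedes b) r

  majorityGraph : Profile → Digraph
  majorityGraph R a b = not (a ≡ᵇ b) ∧ (length R <ᵇ 2 * length (filterᵇ (a precedes b) R))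

  E₃ : List (ℕ × ℕ)
  E₃ = (1 , 2) ∷ (1 , 3) ∷ (1 , 5) ∷ (2 , 3) ∷ (2 , 4) ∷ (2 , 6) ∷ (2 , 7) ∷
       (3 , 4) ∷ (3 , 5) ∷ (3 , 6) ∷ (3 , 8) ∷ (4 , 1) ∷ (4 , 5) ∷ (4 , 8) ∷
       (5 , 2) ∷ (5 , 6) ∷ (5 , 7) ∷ (6 , 1) ∷ (6 , 4) ∷ (6 , 7) ∷ (6 , 8) ∷
       (7 , 1) ∷ (7 , 3) ∷ (7 , 4) ∷ (7 , 8) ∷ (8 , 1) ∷ (8 , 2) ∷ (8 , 5) ∷ []

  G₃ : Digraph
  G₃ i j = any (λ (a , b) → (i ≡ᵇ a) ∧ (j ≡ᵇ b)) E₃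

  even : ℕ → Bool
  even i = i mod 2 ≡ᵇ 0

  -- i lies in C_q for q = class i + 1.
  class position : ℕ → ℕ
  class i    = (i ∸ 1) div 8
  position i = i ∸ 8 * class i

  -- The argument k of graph, size, rows and F stands for n = 3 + k; the lists A₁, …, v₄ take n itself.

  graph : ℕ → Digraph
  graph zero    i j = G₃ i j
  graph (suc _) i j =
    if class i ≡ᵇ class j then G₃ (position i) (position j)
    else if i <ᵇ j then even (i + j)
    else not (even (i + j))

  size : ℕ → ℕ
  size k = 10 + k * 4

  size≡4n-2 : ∀ k → size k ≡ 4 * (3 + k) ∸ 2
  size≡4n-2 k = trans (cong (10 +_) (ℕ.*-comm k 4)) (cong (_∸ 2) (sym (ℕ.*-distribˡ-+ 4 3 k)))

  R₃ : Vec Row 10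
  R₃ = (8 ∷ 1 ∷ 5 ∷ 2 ∷ 3 ∷ 4 ∷ 6 ∷ 7 ∷ []) ∷
       (2 ∷ 7 ∷ 6 ∷ 4 ∷ 1 ∷ 3 ∷ 5 ∷ 8 ∷ []) ∷
       (2 ∷ 7 ∷ 3 ∷ 6 ∷ 4 ∷ 5 ∷ 8 ∷ 1 ∷ []) ∷
       (4 ∷ 1 ∷ 3 ∷ 8 ∷ 5 ∷ 6 ∷ 7 ∷ 2 ∷ []) ∷
       (3 ∷ 5 ∷ 2 ∷ 6 ∷ 7 ∷ 1 ∷ 4 ∷ 8 ∷ []) ∷
       (6 ∷ 8 ∷ 4 ∷ 1 ∷ 5 ∷ 7 ∷ 2 ∷ 3 ∷ []) ∷
       (6 ∷ 7 ∷ 3 ∷ 4 ∷ 8 ∷ 1 ∷ 2 ∷ 5 ∷ []) ∷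
       (8 ∷ 5 ∷ 2 ∷ 7 ∷ 1 ∷ 4 ∷ 3 ∷ 6 ∷ []) ∷
       (7 ∷ 8 ∷ 5 ∷ 6 ∷ 3 ∷ 4 ∷ 1 ∷ 2 ∷ []) ∷
       (1 ∷ 2 ∷ 3 ∷ 4 ∷ 5 ∷ 6 ∷ 7 ∷ 8 ∷ []) ∷ []

  -- The first row is r ++ s, and the order of concatenation alternates from there on.
  _⋈_ : ∀ {m} → Vec Row m → Vec Row m → Vec Row m
  []      ⋈ []      = []
  (r ∷ R) ⋈ (s ∷ S) = (r ++ s) ∷ (S ⋈ R)

  _+·𝟏_ : ∀ {m} → Vec Row m → ℕ → Vec Row m
  R +·𝟏 a = Vec.map (map (_+ a)) R

  module _ (n : ℕ) where

    A₁ B₁ A₂ B₂ : Row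
    A₁ = applyUpTo (λ i → 2 * i + 1) (2 ^ (n ∸ 2))
    B₁ = applyUpTo (λ i → 2 ^ (n ∸ 1) + (2 * i + 1)) (2 ^ (n ∸ 2))
    A₂ = applyUpTo (λ i → 2 * i + 2) (2 ^ (n ∸ 2))
    B₂ = applyUpTo (λ i → 2 ^ (n ∸ 1) + (2 * i + 2)) (2 ^ (n ∸ 2))

    v₁ v₂ v₃ v₄ : Row
    v₁ = A₁ ++ B₁ ++ A₂ ++ B₂
    v₂ = reverse A₂ ++ reverse B₂ ++ reverse A₁ ++ reverse B₁
    v₃ = B₁ ++ A₂ ++ B₂ ++ A₁
    v₄ = reverse B₂ ++ reverse A₁ ++ reverse B₁ ++ reverse A₂

  rows : (k : ℕ) → Vec Row (size k)
  rows zero    = R₃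
  rows (suc k) = v₁ n ∷ v₂ n ∷ v₃ n ∷ v₄ n ∷ (rows k ⋈ (rows k +·𝟏 (2 ^ (n ∸ 1))))
    where
    n : ℕ
    n = 4 + k

  randomProfile : ∀ {m} → Vec Row m → Vec ℕ m → Profile
  randomProfile R w = concat (Vec.toList (Vec.zipWith replicate w R))

  -- w gives the number of voters selecting each row.
  F : (k : ℕ) → Pred (Vec ℕ (size k)) 0ℓ
  F k w = ¬ (majorityGraph (randomProfile (rows k) w) ≡[ candidates (2 ^ (3 + k)) ] graph k)

  F? : (k : ℕ) → Decidable (F k)
  F? k w = ¬? (majorityGraph (randomProfile (rows k) w) ≡[ candidates (2 ^ (3 + k)) ]? graph k)

open Voting public using (size; F; F?)

module Estimates where

  open import Data.Rational.Base using (_+_; _*_; _-_; -_; ∣_∣; _≤_; _<_; 1/_)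
  open ℚ.≤-Reasoning

  ring : AlmostCommutativeRing 0ℓ 0ℓ
  ring = fromCommutativeRing ℚ.+-*-commutativeRing (λ p → dec⇒maybe (0ℚ ℚ.≟ p))

  opaque

    1/ℕ : (d : ℕ) .{{_ : ℕ.NonZero d}} → ℚ
    1/ℕ d = ℤ.+ 1 ℚ./ d

    fromℕ : ℕ → ℚ
    fromℕ n = ℤ.+ n ℚ./ 1

  opaque
    unfolding 1/ℕ fromℕ

    fromℕ-0 : fromℕ 0 ≡ 0ℚ
    fromℕ-0 = refl

    fromℕ-1 : fromℕ 1 ≡ 1ℚ
    fromℕ-1 = refl

    0≤1/ℕ : ∀ d .{{_ : ℕ.NonZero d}} → 0ℚ ≤ 1/ℕ d
    0≤1/ℕ d = ℚ.nonNegative⁻¹ (1/ℕ d) {{ℚ.normalize-nonNeg 1 d}}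

    0<1/ℕ : ∀ d .{{_ : ℕ.NonZero d}} → 0ℚ < 1/ℕ d
    0<1/ℕ d = ℚ.positive⁻¹ (1/ℕ d) {{ℚ.normalize-pos 1 d}}

    0≤fromℕ : ∀ n → 0ℚ ≤ fromℕ n
    0≤fromℕ n = ℚ.nonNegative⁻¹ (fromℕ n) {{ℚ.normalize-nonNeg n 1}}

    fromℕ-suc : ∀ n → fromℕ (suc n) ≡ fromℕ n + 1ℚ
    fromℕ-suc n = ℚ.toℚᵘ-injective (ℚᵘ.≃-trans (ℚ.toℚᵘ-fromℚᵘ (ℚᵘ.mkℚᵘ (ℤ.+ suc n) 0))
      (ℚᵘ.≃-sym (ℚᵘ.≃-trans (ℚ.toℚᵘ-homo-+ (fromℕ n) 1ℚ)
        (ℚᵘ.≃-trans (ℚᵘ.+-cong (ℚ.toℚᵘ-fromℚᵘ (ℚᵘ.mkℚᵘ (ℤ.+ n) 0)) (ℚ.toℚᵘ-fromℚᵘ (ℚᵘ.mkℚᵘ (ℤ.+ 1) 0)))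
          (ℚᵘ.*≡* (eq n))))))
      where
      eq : ∀ n → (ℤ.+ n ℤ.* ℤ.+ 1 ℤ.+ ℤ.+ 1 ℤ.* ℤ.+ 1) ℤ.* ℤ.+ 1 ≡ ℤ.+ suc n ℤ.* ℤ.+ 1
      eq n = cong (ℤ._* ℤ.+ 1) (trans (cong (ℤ._+ ℤ.+ 1) (ℤ.*-identityʳ (ℤ.+ n))) (cong ℤ.+_ (ℕ.+-comm n 1)))

    1/ℕ-* : ∀ a b .{{_ : ℕ.NonZero a}} .{{_ : ℕ.NonZero b}} .{{_ : ℕ.NonZero (a ℕ.* b)}} →
            1/ℕ (a ℕ.* b) ≡ 1/ℕ a * 1/ℕ b
    1/ℕ-* (suc a) (suc b) = ℚ.toℚᵘ-injective (ℚᵘ.≃-trans (ℚ.toℚᵘ-fromℚᵘ (ℚᵘ.mkℚᵘ (ℤ.+ 1) _))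
      (ℚᵘ.≃-sym (ℚᵘ.≃-trans (ℚ.toℚᵘ-homo-* (1/ℕ (suc a)) (1/ℕ (suc b)))
        (ℚᵘ.*-cong (ℚ.toℚᵘ-fromℚᵘ (ℚᵘ.mkℚᵘ (ℤ.+ 1) a)) (ℚ.toℚᵘ-fromℚᵘ (ℚᵘ.mkℚᵘ (ℤ.+ 1) b))))))

    fromℕ*1/ℕ : ∀ n → fromℕ (suc n) * 1/ℕ (suc n) ≡ 1ℚ
    fromℕ*1/ℕ n = ℚ.toℚᵘ-injective (ℚᵘ.≃-trans (ℚ.toℚᵘ-homo-* (fromℕ (suc n)) (1/ℕ (suc n)))
      (ℚᵘ.≃-trans (ℚᵘ.*-cong (ℚ.toℚᵘ-fromℚᵘ (ℚᵘ.mkℚᵘ (ℤ.+ suc n) 0)) (ℚ.toℚᵘ-fromℚᵘ (ℚᵘ.mkℚᵘ (ℤ.+ 1) n)))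
        (ℚᵘ.*≡* (eq n))))
      where
      eq : ∀ n → (ℤ.+ suc n ℤ.* ℤ.+ 1) ℤ.* ℤ.+ 1 ≡ ℤ.+ 1 ℤ.* (ℤ.+ (1 ℕ.* suc n))
      eq n = trans (ℤ.*-identityʳ _) (trans (ℤ.*-identityʳ _)
        (sym (trans (ℤ.*-identityˡ _) (cong ℤ.+_ (ℕ.*-identityˡ (suc n))))))

    above : ∀ q → ∃ λ n → q ≤ fromℕ n
    above q@(ℚ.mkℚ (ℤ.+ n) d _) = n , ℚ.toℚᵘ-cancel-≤
      (ℚᵘ.≤-respʳ-≃ (ℚᵘ.≃-sym (ℚ.toℚᵘ-fromℚᵘ (ℚᵘ.mkℚᵘ (ℤ.+ n) 0)))
        (ℚᵘ.*≤* (ℤ.*-monoˡ-≤-nonNeg (ℤ.+ n) (ℤ.+≤+ (ℕ.s≤s ℕ.z≤n)))))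
    above q@(ℚ.mkℚ (ℤ.-[1+ n ]) d _) = 0 , ℚ.nonPositive⁻¹ q
  infixr 8 _^_
  _^_ : ℚ → ℕ → ℚ
  q ^ zero  = 1ℚ
  q ^ suc k = q * q ^ k

  Σ< : ℕ → (ℕ → ℚ) → ℚ
  Σ< zero    f = 0ℚ
  Σ< (suc n) f = Σ< n f + f n

  expTerm : ℚ → ℕ → ℚ
  expTerm q k = q ^ k * 1/ℕ (k !) {{k ℕ.!≢0}}

  Σbox : (m N : ℕ) → (Vec ℕ m → ℚ) → ℚ
  Σbox zero    N f = f []
  Σbox (suc m) N f = Σ< N λ i → Σbox m N λ w → f (i ∷ w)

  abstract

    *-monoˡ : ∀ {r p q} → 0ℚ ≤ r → p ≤ q → r * p ≤ r * q
    *-monoˡ {r} 0≤r = ℚ.*-monoˡ-≤-nonNeg r {{ℚ.nonNegative 0≤r}}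

    *-monoʳ : ∀ {r p q} → 0ℚ ≤ r → p ≤ q → p * r ≤ q * r
    *-monoʳ {r} 0≤r = ℚ.*-monoʳ-≤-nonNeg r {{ℚ.nonNegative 0≤r}}

    *-mono : ∀ {a b c d} → 0ℚ ≤ a → 0ℚ ≤ d → a ≤ b → c ≤ d → a * c ≤ b * d
    *-mono 0≤a 0≤d a≤b c≤d = ℚ.≤-trans (*-monoˡ 0≤a c≤d) (*-monoʳ 0≤d a≤b)

    0≤* : ∀ {p q} → 0ℚ ≤ p → 0ℚ ≤ q → 0ℚ ≤ p * q
    0≤* {p} {q} 0≤p 0≤q = begin
      0ℚ      ≡⟨ ℚ.*-zeroʳ p ⟨
      p * 0ℚ  ≤⟨ *-monoˡ 0≤p 0≤q ⟩
      p * q   ∎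

    0<* : ∀ {p q} → 0ℚ < p → 0ℚ < q → 0ℚ < p * q
    0<* {p} {q} 0<p 0<q = begin-strict
      0ℚ      ≡⟨ ℚ.*-zeroʳ p ⟨
      p * 0ℚ  <⟨ ℚ.*-monoʳ-<-pos p {{ℚ.positive 0<p}} 0<q ⟩
      p * q   ∎

    0≤+ : ∀ {p q} → 0ℚ ≤ p → 0ℚ ≤ q → 0ℚ ≤ p + q
    0≤+ = ℚ.+-mono-≤

    0<½ : 0ℚ < ½
    0<½ = ℚ.positive⁻¹ ½

    0<½* : ∀ {ε} → 0ℚ < ε → 0ℚ < ε * ½
    0<½* 0<ε = 0<* 0<ε 0<½

    halves : ∀ ε → ε * ½ + ε * ½ ≡ ε
    halves ε = trans (sym (ℚ.*-distribˡ-+ ε ½ ½)) (ℚ.*-identityʳ ε)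

    fromℕ-mono : ∀ {m n} → m ℕ.≤ n → fromℕ m ≤ fromℕ n
    fromℕ-mono {m} {zero} ℕ.z≤n = ℚ.≤-refl
    fromℕ-mono {m} {suc n} m≤1+n with ℕ.m≤n⇒m<n∨m≡n m≤1+n
    ... | inj₂ refl       = ℚ.≤-refl
    ... | inj₁ (ℕ.s≤s m≤n) = begin
      fromℕ m       ≤⟨ fromℕ-mono m≤n ⟩
      fromℕ n       ≡⟨ ℚ.+-identityʳ _ ⟨
      fromℕ n + 0ℚ  ≤⟨ ℚ.+-monoʳ-≤ (fromℕ n) (ℚ.nonNegative⁻¹ 1ℚ) ⟩
      fromℕ n + 1ℚ  ≡⟨ fromℕ-suc n ⟨
      fromℕ (suc n) ∎

    below : ∀ {ε} → 0ℚ < ε → ∃ λ n → 1/ℕ (suc n) ≤ ε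
    below {ε} 0<ε with above ((1/ ε) {{ℚ.>-nonZero 0<ε}})
    ... | n , 1/ε≤n = n , (begin
      1/ℕ (suc n)                  ≡⟨ ℚ.*-identityˡ _ ⟨
      1ℚ * 1/ℕ (suc n)             ≡⟨ cong (_* _) (ℚ.*-inverseʳ ε {{ℚ.>-nonZero 0<ε}}) ⟨
      ε * e′ * 1/ℕ (suc n)         ≤⟨ *-monoʳ (0≤1/ℕ (suc n)) (*-monoˡ (ℚ.<⇒≤ 0<ε)
                                        (ℚ.≤-trans 1/ε≤n (fromℕ-mono (ℕ.n≤1+n n)))) ⟩
      ε * fromℕ (suc n) * 1/ℕ (suc n) ≡⟨ ℚ.*-assoc ε _ _ ⟩
      ε * (fromℕ (suc n) * 1/ℕ (suc n)) ≡⟨ cong (ε *_) (fromℕ*1/ℕ n) ⟩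
      ε * 1ℚ                       ≡⟨ ℚ.*-identityʳ ε ⟩
      ε                            ∎)
      where
      e′ : ℚ
      e′ = (1/ ε) {{ℚ.>-nonZero 0<ε}}

    shrink : ∀ b {ε} → 0ℚ < ε → ∃ λ δ → 0ℚ < δ × b * δ ≤ ε
    shrink b {ε} 0<ε with above b
    ... | n , b≤n = δ , 0<δ , (begin
      b * δ                               ≤⟨ *-monoʳ (ℚ.<⇒≤ 0<δ) (ℚ.≤-trans b≤n (fromℕ-mono (ℕ.n≤1+n n))) ⟩
      fromℕ (suc n) * (1/ℕ (suc n) * ε)   ≡⟨ ℚ.*-assoc (fromℕ (suc n)) _ _ ⟨
      fromℕ (suc n) * 1/ℕ (suc n) * ε     ≡⟨ cong (_* ε) (fromℕ*1/ℕ n) ⟩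
      1ℚ * ε                              ≡⟨ ℚ.*-identityˡ ε ⟩
      ε                                   ∎)
      where
      δ : ℚ
      δ = 1/ℕ (suc n) * ε
      0<δ : 0ℚ < δ
      0<δ = 0<* (0<1/ℕ (suc n)) 0<ε

    p≤∣p∣ : ∀ p → p ≤ ∣ p ∣
    p≤∣p∣ p with ℚ.≤-total 0ℚ p
    ... | inj₁ 0≤p = ℚ.≤-reflexive (sym (ℚ.0≤p⇒∣p∣≡p 0≤p))
    ... | inj₂ p≤0 = ℚ.≤-trans p≤0 (ℚ.0≤∣p∣ p)

    ∣p-q∣≡∣q-p∣ : ∀ p q → ∣ p - q ∣ ≡ ∣ q - p ∣
    ∣p-q∣≡∣q-p∣ p q = trans (cong ∣_∣ (eq p q)) (ℚ.∣-p∣≡∣p∣ (q - p))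
      where
      eq : ∀ p q → p - q ≡ - (q - p)
      eq = solve-∀ ring

    triangle : ∀ p q r → ∣ p - r ∣ ≤ ∣ p - q ∣ + ∣ q - r ∣
    triangle p q r = subst (λ d → ∣ d ∣ ≤ ∣ p - q ∣ + ∣ q - r ∣) (eq p q r) (ℚ.∣p+q∣≤∣p∣+∣q∣ (p - q) (q - r))
      where
      eq : ∀ p q r → (p - q) + (q - r) ≡ p - r
      eq = solve-∀ ring

    ∣∣-lub : ∀ {p b} → p ≤ b → - p ≤ b → ∣ p ∣ ≤ b
    ∣∣-lub {p} p≤b -p≤b with ℚ.∣p∣≡p∨∣p∣≡-p p
    ... | inj₁ eq = subst (_≤ _) (sym eq) p≤b
    ... | inj₂ eq = subst (_≤ _) (sym eq) -p≤b

    ∣p∣≤∣q∣+∣p-q∣ : ∀ p q → ∣ p ∣ ≤ ∣ q ∣ + ∣ p - q ∣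
    ∣p∣≤∣q∣+∣p-q∣ p q = subst (λ d → ∣ d ∣ ≤ ∣ q ∣ + ∣ p - q ∣) (eq p q) (ℚ.∣p+q∣≤∣p∣+∣q∣ q (p - q))
      where
      eq : ∀ p q → q + (p - q) ≡ p
      eq = solve-∀ ring

    ∣∣-lipschitz : ∀ p q → ∣ ∣ p ∣ - ∣ q ∣ ∣ ≤ ∣ p - q ∣
    ∣∣-lipschitz p q = ∣∣-lub (move p q)
      (subst (_≤ ∣ p - q ∣) (eq ∣ p ∣ ∣ q ∣) (subst (∣ q ∣ - ∣ p ∣ ≤_) (∣p-q∣≡∣q-p∣ q p) (move q p)))
      where
      eq : ∀ a b → b - a ≡ - (a - b)
      eq = solve-∀ ring
      eq′ : ∀ a b → b + a - b ≡ a
      eq′ = solve-∀ ring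
      move : ∀ p q → ∣ p ∣ - ∣ q ∣ ≤ ∣ p - q ∣
      move p q = subst (∣ p ∣ - ∣ q ∣ ≤_) (eq′ ∣ p - q ∣ ∣ q ∣) (ℚ.+-monoˡ-≤ (- ∣ q ∣) (∣p∣≤∣q∣+∣p-q∣ p q))

    ∣∣-* : ∀ {p q a b} → ∣ p ∣ ≤ a → ∣ q ∣ ≤ b → ∣ p * q ∣ ≤ a * b
    ∣∣-* {p} {q} p≤a q≤b = subst (_≤ _) (sym (ℚ.∣p*q∣≡∣p∣*∣q∣ p q))
      (*-mono (ℚ.0≤∣p∣ p) (ℚ.≤-trans (ℚ.0≤∣p∣ q) q≤b) p≤a q≤b)

    1/ℕ-anti : ∀ m n → m ℕ.≤ n → 1/ℕ (suc n) ≤ 1/ℕ (suc m)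
    1/ℕ-anti m n m≤n = begin
      1/ℕ (suc n)                               ≡⟨ ℚ.*-identityʳ _ ⟨
      1/ℕ (suc n) * 1ℚ                          ≡⟨ cong (1/ℕ (suc n) *_) (fromℕ*1/ℕ m) ⟨
      1/ℕ (suc n) * (fromℕ (suc m) * 1/ℕ (suc m)) ≤⟨ *-monoˡ (0≤1/ℕ (suc n))
                                                      (*-monoʳ (0≤1/ℕ (suc m)) (fromℕ-mono (ℕ.s≤s m≤n))) ⟩
      1/ℕ (suc n) * (fromℕ (suc n) * 1/ℕ (suc m)) ≡⟨ eq (1/ℕ (suc n)) (fromℕ (suc n)) (1/ℕ (suc m)) ⟩
      fromℕ (suc n) * 1/ℕ (suc n) * 1/ℕ (suc m) ≡⟨ cong (_* 1/ℕ (suc m)) (fromℕ*1/ℕ n) ⟩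
      1ℚ * 1/ℕ (suc m)                          ≡⟨ ℚ.*-identityˡ _ ⟩
      1/ℕ (suc m)                               ∎
      where
      eq : ∀ a b c → a * (b * c) ≡ b * a * c
      eq = solve-∀ ring

    0≤^ : ∀ {b} → 0ℚ ≤ b → ∀ k → 0ℚ ≤ b ^ k
    0≤^ 0≤b zero    = ℚ.nonNegative⁻¹ 1ℚ
    0≤^ 0≤b (suc k) = 0≤* 0≤b (0≤^ 0≤b k)

    ∣^∣≤ : ∀ {q b} → ∣ q ∣ ≤ b → ∀ k → ∣ q ^ k ∣ ≤ b ^ k
    ∣^∣≤ q≤b zero    = ℚ.≤-refl
    ∣^∣≤ {q} q≤b (suc k) = ∣∣-* {q} q≤b (∣^∣≤ q≤b k)

    0≤expTerm : ∀ {b} → 0ℚ ≤ b → ∀ k → 0ℚ ≤ expTerm b k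
    0≤expTerm 0≤b k = 0≤* (0≤^ 0≤b k) (0≤1/ℕ (k !) {{k ℕ.!≢0}})

    ∣expTerm∣≤ : ∀ {q b} → ∣ q ∣ ≤ b → ∀ k → ∣ expTerm q k ∣ ≤ expTerm b k
    ∣expTerm∣≤ {q} q≤b k = ∣∣-* {q ^ k} (∣^∣≤ q≤b k)
      (ℚ.≤-reflexive (ℚ.0≤p⇒∣p∣≡p (0≤1/ℕ (k !) {{k ℕ.!≢0}})))

    expTerm-suc : ∀ q k → expTerm q (suc k) ≡ expTerm q k * (q * 1/ℕ (suc k))
    expTerm-suc q k = trans
      (cong (q * q ^ k *_) (1/ℕ-* (suc k) (k !) {{_}} {{k ℕ.!≢0}} {{suc k ℕ.!≢0}}))
      (eq q (q ^ k) (1/ℕ (suc k)) (1/ℕ (k !) {{k ℕ.!≢0}}))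
      where
      eq : ∀ q p a b → q * p * (a * b) ≡ p * b * (q * a)
      eq = solve-∀ ring

    Σ<-increment : ∀ (f g : ℕ → ℚ) → (∀ k → ∣ f k ∣ ≤ g k) → ∀ {N M} → N ℕ.≤ M →
                   ∣ Σ< M f - Σ< N f ∣ ≤ Σ< M g - Σ< N g
    Σ<-increment f g f≤g {N} {M} N≤M with ℕ.m≤n⇒m<n∨m≡n N≤M
    ... | inj₂ refl = ℚ.≤-reflexive (trans (cong ∣_∣ (ℚ.+-inverseʳ (Σ< N f))) (sym (ℚ.+-inverseʳ (Σ< N g))))
    Σ<-increment f g f≤g {N} {suc M} _ | inj₁ (ℕ.s≤s N≤M) = begin
      ∣ Σ< M f + f M - Σ< N f ∣       ≡⟨ cong ∣_∣ (eq (Σ< M f) (f M) (Σ< N f)) ⟩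
      ∣ (Σ< M f - Σ< N f) + f M ∣     ≤⟨ ℚ.∣p+q∣≤∣p∣+∣q∣ (Σ< M f - Σ< N f) (f M) ⟩
      ∣ Σ< M f - Σ< N f ∣ + ∣ f M ∣   ≤⟨ ℚ.+-mono-≤ (Σ<-increment f g f≤g N≤M) (f≤g M) ⟩
      (Σ< M g - Σ< N g) + g M         ≡⟨ eq (Σ< M g) (g M) (Σ< N g) ⟨
      Σ< M g + g M - Σ< N g           ∎
      where
      eq : ∀ a b c → a + b - c ≡ (a - c) + b
      eq = solve-∀ ring

    Σ<-mono-N : ∀ (g : ℕ → ℚ) → (∀ k → 0ℚ ≤ g k) → ∀ {N M} → N ℕ.≤ M → Σ< N g ≤ Σ< M g
    Σ<-mono-N g 0≤g {N} {M} N≤M = begin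
      Σ< N g                        ≡⟨ ℚ.+-identityʳ _ ⟨
      Σ< N g + 0ℚ                   ≤⟨ ℚ.+-monoʳ-≤ (Σ< N g) (ℚ.≤-trans (ℚ.0≤∣p∣ (Σ< M g - Σ< N g))
                                         (Σ<-increment g g (λ k → ℚ.≤-reflexive (ℚ.0≤p⇒∣p∣≡p (0≤g k))) N≤M)) ⟩
      Σ< N g + (Σ< M g - Σ< N g)    ≡⟨ eq (Σ< N g) (Σ< M g) ⟩
      Σ< M g                        ∎
      where
      eq : ∀ a b → a + (b - a) ≡ b
      eq = solve-∀ ring

    expTerm-halving : ∀ b k → 2 ℕ.* b ℕ.≤ suc k →
                      expTerm (fromℕ b) (suc k) + expTerm (fromℕ b) (suc k) ≤ expTerm (fromℕ b) k
    expTerm-halving b k 2b≤ = begin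
      t′ + t′                       ≡⟨ cong₂ _+_ (expTerm-suc (fromℕ b) k) (expTerm-suc (fromℕ b) k) ⟩
      t * (β * r) + t * (β * r)     ≡⟨ eq t β r ⟩
      t * ((β + β) * r)             ≤⟨ *-monoˡ (0≤expTerm (0≤fromℕ b) k) (*-monoʳ (0≤1/ℕ (suc k)) β+β≤) ⟩
      t * (fromℕ (suc k) * r)       ≡⟨ cong (t *_) (fromℕ*1/ℕ k) ⟩
      t * 1ℚ                        ≡⟨ ℚ.*-identityʳ t ⟩
      t                             ∎
      where
      β r t t′ : ℚ
      β = fromℕ b
      r = 1/ℕ (suc k)
      t = expTerm (fromℕ b) k
      t′ = expTerm (fromℕ b) (suc k)
      eq : ∀ t β r → t * (β * r) + t * (β * r) ≡ t * ((β + β) * r)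
      eq = solve-∀ ring
      double : ∀ b → fromℕ b + fromℕ b ≡ fromℕ (2 ℕ.* b)
      double zero    = trans (cong₂ _+_ fromℕ-0 fromℕ-0) (sym fromℕ-0)
      double (suc b) = trans (cong₂ _+_ (fromℕ-suc b) (fromℕ-suc b)) (trans (eq₂ (fromℕ b) 1ℚ)
        (trans (cong (λ p → p + 1ℚ + 1ℚ) (double b)) (sym (trans (cong (λ n → fromℕ (suc n)) (ℕ.+-suc b (b ℕ.+ 0)))
          (trans (fromℕ-suc (suc (2 ℕ.* b))) (cong (_+ 1ℚ) (fromℕ-suc (2 ℕ.* b))))))))
        where
        eq₂ : ∀ a u → (a + u) + (a + u) ≡ a + a + u + u
        eq₂ = solve-∀ ring
      β+β≤ : β + β ≤ fromℕ (suc k)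
      β+β≤ = subst (_≤ fromℕ (suc k)) (sym (double b)) (fromℕ-mono 2b≤)

    expTail-≤ : ∀ b N → 2 ℕ.* b ℕ.≤ N → ∀ j →
                Σ< (j ℕ.+ N) (expTerm (fromℕ b)) + (expTerm (fromℕ b) (j ℕ.+ N) + expTerm (fromℕ b) (j ℕ.+ N))
                ≤ Σ< N (expTerm (fromℕ b)) + (expTerm (fromℕ b) N + expTerm (fromℕ b) N)
    expTail-≤ b N 2b≤N zero    = ℚ.≤-refl
    expTail-≤ b N 2b≤N (suc j) = begin
      s + t + (t′ + t′)   ≤⟨ ℚ.+-monoʳ-≤ (s + t) (expTerm-halving b k
                               (ℕ.≤-trans 2b≤N (ℕ.≤-trans (ℕ.m≤n+m N j) (ℕ.n≤1+n k)))) ⟩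
      s + t + t           ≡⟨ ℚ.+-assoc s t t ⟩
      s + (t + t)         ≤⟨ expTail-≤ b N 2b≤N j ⟩
      Σ< N (expTerm (fromℕ b)) + (expTerm (fromℕ b) N + expTerm (fromℕ b) N) ∎
      where
      k : ℕ
      k = j ℕ.+ N
      s t t′ : ℚ
      s = Σ< k (expTerm (fromℕ b))
      t = expTerm (fromℕ b) k
      t′ = expTerm (fromℕ b) (suc k)

    expTerm-decay : ∀ b j → expTerm (fromℕ b) (j ℕ.+ 2 ℕ.* b) ≤ expTerm (fromℕ b) (2 ℕ.* b) * 1/ℕ (suc j)
    expTerm-decay b j = begin
      t j                                     ≡⟨ ℚ.*-identityʳ (t j) ⟨
      t j * 1ℚ                                ≡⟨ cong (t j *_) (fromℕ*1/ℕ j) ⟨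
      t j * (fromℕ (suc j) * 1/ℕ (suc j))     ≡⟨ ℚ.*-assoc (t j) _ _ ⟨
      t j * fromℕ (suc j) * 1/ℕ (suc j)       ≤⟨ *-monoʳ (0≤1/ℕ (suc j)) (go j) ⟩
      t 0 * 1/ℕ (suc j)                       ∎
      where
      t : ℕ → ℚ
      t j = expTerm (fromℕ b) (j ℕ.+ 2 ℕ.* b)
      0≤t : ∀ j → 0ℚ ≤ t j
      0≤t j = 0≤expTerm (0≤fromℕ b) (j ℕ.+ 2 ℕ.* b)
      eq : ∀ t n u → t * (n + u) ≡ t * n + t * u
      eq = solve-∀ ring
      eq₂ : ∀ t n → t * n + t * n ≡ (t + t) * n
      eq₂ = solve-∀ ring
      go : ∀ j → t j * fromℕ (suc j) ≤ t 0
      go zero    = ℚ.≤-reflexive (trans (cong (t 0 *_) fromℕ-1) (ℚ.*-identityʳ (t 0)))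
      go (suc j) = begin
        t (suc j) * fromℕ (suc (suc j))                           ≡⟨ cong (t (suc j) *_) (fromℕ-suc (suc j)) ⟩
        t (suc j) * (fromℕ (suc j) + 1ℚ)                          ≡⟨ ℚ.*-distribˡ-+ (t (suc j)) _ _ ⟩
        t (suc j) * fromℕ (suc j) + t (suc j) * 1ℚ                ≤⟨ ℚ.+-monoʳ-≤ (t (suc j) * fromℕ (suc j))
                                                                       (*-monoˡ (0≤t (suc j)) (subst (_≤ fromℕ (suc j)) fromℕ-1 (fromℕ-mono {1} {suc j} (ℕ.s≤s ℕ.z≤n)))) ⟩
        t (suc j) * fromℕ (suc j) + t (suc j) * fromℕ (suc j)     ≡⟨ eq₂ (t (suc j)) (fromℕ (suc j)) ⟩
        (t (suc j) + t (suc j)) * fromℕ (suc j)                   ≤⟨ *-monoʳ (0≤fromℕ (suc j)) (expTerm-halving b (j ℕ.+ 2 ℕ.* b)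
                                                                       (ℕ.≤-trans (ℕ.m≤n+m (2 ℕ.* b) j) (ℕ.n≤1+n _))) ⟩
        t j * fromℕ (suc j)                                       ≤⟨ go j ⟩
        t 0                                                       ∎

    expTail : ∀ b {ε} → 0ℚ < ε → ∃ λ N → ∀ M →
              Σ< M (expTerm (fromℕ b)) ≤ Σ< N (expTerm (fromℕ b)) + ε
    expTail b {ε} 0<ε with shrink (expTerm (fromℕ b) (2 ℕ.* b)) (0<½* 0<ε)
    ... | δ , 0<δ , t0δ≤ with below 0<δ
    ... | j , 1/j≤δ = N , bound
      where
      N : ℕ
      N = j ℕ.+ 2 ℕ.* b
      S : ℕ → ℚ
      S M = Σ< M (expTerm (fromℕ b))
      t≤ : expTerm (fromℕ b) N ≤ ε * ½
      t≤ = ℚ.≤-trans (expTerm-decay b j) (ℚ.≤-trans (*-monoˡ (0≤expTerm (0≤fromℕ b) (2 ℕ.* b)) 1/j≤δ) t0δ≤)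
      bound : ∀ M → S M ≤ S N + ε
      bound M = begin
        S M                           ≤⟨ Σ<-mono-N _ (0≤expTerm (0≤fromℕ b)) (ℕ.m≤m+n M N) ⟩
        S (M ℕ.+ N)                   ≡⟨ ℚ.+-identityʳ _ ⟨
        S (M ℕ.+ N) + 0ℚ              ≤⟨ ℚ.+-monoʳ-≤ (S (M ℕ.+ N)) (0≤+ (0≤expTerm (0≤fromℕ b) (M ℕ.+ N))
                                                                        (0≤expTerm (0≤fromℕ b) (M ℕ.+ N))) ⟩
        S (M ℕ.+ N) + (expTerm (fromℕ b) (M ℕ.+ N) + expTerm (fromℕ b) (M ℕ.+ N))
                                      ≤⟨ expTail-≤ b N (ℕ.m≤n+m (2 ℕ.* b) j) M ⟩
        S N + (expTerm (fromℕ b) N + expTerm (fromℕ b) N)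
                                      ≤⟨ ℚ.+-monoʳ-≤ (S N) (ℚ.+-mono-≤ t≤ t≤) ⟩
        S N + (ε * ½ + ε * ½)         ≡⟨ cong (S N +_) (halves ε) ⟩
        S N + ε                       ∎

    expTail-increment : ∀ b {ε} → 0ℚ < ε → ∃ λ N₀ → ∀ {N M} → N₀ ℕ.≤ N →
                        Σ< M (expTerm (fromℕ b)) - Σ< N (expTerm (fromℕ b)) ≤ ε
    expTail-increment b {ε} 0<ε = proj₁ tail , λ {N} {M} → bound {N} {M}
      where
      S : ℕ → ℚ
      S M = Σ< M (expTerm (fromℕ b))
      tail : ∃ λ N → ∀ M → S M ≤ S N + ε
      tail = expTail b 0<ε
      eq : ∀ a e → a + e - a ≡ e
      eq = solve-∀ ring
      S-mono : ∀ {N M} → N ℕ.≤ M → S N ≤ S M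
      S-mono = Σ<-mono-N (expTerm (fromℕ b)) (0≤expTerm (0≤fromℕ b))
      bound : ∀ {N M} → proj₁ tail ℕ.≤ N → S M - S N ≤ ε
      bound {N} {M} N₀≤N = begin
        S M - S N         ≤⟨ ℚ.+-monoˡ-≤ (- S N) (ℚ.≤-trans (proj₂ tail M) (ℚ.+-monoˡ-≤ ε (S-mono N₀≤N))) ⟩
        S N + ε - S N     ≡⟨ eq (S N) ε ⟩
        ε                 ∎

    Σ<-abs : ∀ (f g : ℕ → ℚ) → (∀ k → ∣ f k ∣ ≤ g k) → ∀ M → ∣ Σ< M f ∣ ≤ Σ< M g
    Σ<-abs f g f≤g zero    = ℚ.≤-refl
    Σ<-abs f g f≤g (suc M) = ℚ.≤-trans (ℚ.∣p+q∣≤∣p∣+∣q∣ (Σ< M f) (f M)) (ℚ.+-mono-≤ (Σ<-abs f g f≤g M) (f≤g M))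

    Σ<-*ˡ : ∀ c f M → Σ< M (λ k → c * f k) ≡ c * Σ< M f
    Σ<-*ˡ c f zero    = sym (ℚ.*-zeroʳ c)
    Σ<-*ˡ c f (suc M) = trans (cong (_+ c * f M) (Σ<-*ˡ c f M)) (sym (ℚ.*-distribˡ-+ c (Σ< M f) (f M)))

    *-distribˡ-minus : ∀ c a b → c * a - c * b ≡ c * (a - b)
    *-distribˡ-minus = solve-∀ ring

    Σ<-minus : ∀ f g M → Σ< M f - Σ< M g ≡ Σ< M (λ k → f k - g k)
    Σ<-minus f g zero    = refl
    Σ<-minus f g (suc M) = trans (eq (Σ< M f) (f M) (Σ< M g) (g M)) (cong (_+ (f M - g M)) (Σ<-minus f g M))
      where
      eq : ∀ a b c d → a + b - (c + d) ≡ a - c + (b - d)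
      eq = solve-∀ ring

  Π : {m : ℕ} → (ℕ → ℚ) → Vec ℕ m → ℚ
  Π g []      = 1ℚ
  Π g (k ∷ w) = g k * Π g w

  module _ (g : ℕ → ℚ) (0≤g : ∀ k → 0ℚ ≤ g k) (D : ℚ) (0≤D : 0ℚ ≤ D) (Σg≤D : ∀ M → Σ< M g ≤ D) where

    Kbox : ℕ → ℚ
    Kbox zero    = 0ℚ
    Kbox (suc m) = D * Kbox m + D ^ m

    abstract

      slice : ∀ {m} {h : Vec ℕ (suc m) → ℚ} s → (∀ w → ∣ h w ∣ ≤ s * Π g w) →
              ∀ i (w : Vec ℕ m) → ∣ h (i ∷ w) ∣ ≤ s * g i * Π g w
      slice {h = h} s h≤ i w = subst (∣ h (i ∷ w) ∣ ≤_) (sym (ℚ.*-assoc s (g i) (Π g w))) (h≤ (i ∷ w))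

      Σ<-scaled : ∀ s c M → Σ< M (λ i → s * g i * c) ≡ s * c * Σ< M g
      Σ<-scaled s c zero    = sym (ℚ.*-zeroʳ (s * c))
      Σ<-scaled s c (suc M) = trans (cong (_+ s * g M * c) (Σ<-scaled s c M)) (eq s c (Σ< M g) (g M))
        where
        eq : ∀ s c a b → s * c * a + s * b * c ≡ s * c * (a + b)
        eq = solve-∀ ring

      Σbox-abs : ∀ m s (h : Vec ℕ m → ℚ) → 0ℚ ≤ s → (∀ w → ∣ h w ∣ ≤ s * Π g w) →
                 ∀ M → ∣ Σbox m M h ∣ ≤ s * D ^ m
      Σbox-abs zero    s h 0≤s h≤ M = h≤ []
      Σbox-abs (suc m) s h 0≤s h≤ M = begin
        ∣ Σ< M (λ i → Σbox m M λ w → h (i ∷ w)) ∣   ≤⟨ Σ<-abs _ (λ i → s * g i * D ^ m)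
                                                          (λ i → Σbox-abs m (s * g i) (λ w → h (i ∷ w)) (0≤* 0≤s (0≤g i))
                                                            (slice {h = h} s h≤ i) M) M ⟩
        Σ< M (λ i → s * g i * D ^ m)                ≡⟨ Σ<-scaled s (D ^ m) M ⟩
        s * D ^ m * Σ< M g                          ≤⟨ *-monoˡ (0≤* 0≤s (0≤^ 0≤D m)) (Σg≤D M) ⟩
        s * D ^ m * D                               ≡⟨ eq s (D ^ m) D ⟩
        s * (D * D ^ m)                             ∎
        where
        eq : ∀ s p d → s * p * d ≡ s * (d * p)
        eq = solve-∀ ring

      Σbox-increment : ∀ {N M δ} → N ℕ.≤ M → Σ< M g - Σ< N g ≤ δ →
                       ∀ m s (h : Vec ℕ m → ℚ) → 0ℚ ≤ s → (∀ w → ∣ h w ∣ ≤ s * Π g w) →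
                       ∣ Σbox m M h - Σbox m N h ∣ ≤ s * (Kbox m * δ)
      Σbox-increment {N} {M} {δ} N≤M gδ zero s h 0≤s h≤ =
        ℚ.≤-reflexive (trans (cong ∣_∣ (ℚ.+-inverseʳ (h []))) (sym (trans (cong (s *_) (ℚ.*-zeroˡ δ)) (ℚ.*-zeroʳ s))))
      Σbox-increment {N} {M} {δ} N≤M gδ (suc m) s h 0≤s h≤ = begin
        ∣ Σ< M FM - Σ< N FN ∣                                       ≤⟨ triangle (Σ< M FM) (Σ< N FM) (Σ< N FN) ⟩
        ∣ Σ< M FM - Σ< N FM ∣ + ∣ Σ< N FM - Σ< N FN ∣               ≤⟨ ℚ.+-mono-≤ outer inner ⟩
        s * D ^ m * δ + s * (Kbox m * δ) * D                        ≡⟨ eq s (D ^ m) δ (Kbox m) D ⟩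
        s * ((D * Kbox m + D ^ m) * δ)                              ∎
        where
        FM FN : ℕ → ℚ
        FM i = Σbox m M λ w → h (i ∷ w)
        FN i = Σbox m N λ w → h (i ∷ w)
        eq : ∀ s p d k e → s * p * d + s * (k * d) * e ≡ s * ((e * k + p) * d)
        eq = solve-∀ ring
        0≤sg : ∀ i → 0ℚ ≤ s * g i
        0≤sg i = 0≤* 0≤s (0≤g i)
        0≤Kbox : ∀ m → 0ℚ ≤ Kbox m
        0≤Kbox zero    = ℚ.≤-refl
        0≤Kbox (suc m) = 0≤+ (0≤* 0≤D (0≤Kbox m)) (0≤^ 0≤D m)
        0≤δ : 0ℚ ≤ δ
        0≤δ = ℚ.≤-trans (ℚ.≤-trans (ℚ.0≤∣p∣ (Σ< M g - Σ< N g))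
                (Σ<-increment g g (λ k → ℚ.≤-reflexive (ℚ.0≤p⇒∣p∣≡p (0≤g k))) N≤M)) gδ
        outer : ∣ Σ< M FM - Σ< N FM ∣ ≤ s * D ^ m * δ
        outer = begin
          ∣ Σ< M FM - Σ< N FM ∣                                     ≤⟨ Σ<-increment FM (λ i → s * g i * D ^ m)
                                                                         (λ i → Σbox-abs m (s * g i) (λ w → h (i ∷ w)) (0≤sg i)
                                                                           (slice {h = h} s h≤ i) M) N≤M ⟩
          Σ< M (λ i → s * g i * D ^ m) - Σ< N (λ i → s * g i * D ^ m) ≡⟨ cong₂ _-_ (Σ<-scaled s (D ^ m) M) (Σ<-scaled s (D ^ m) N) ⟩
          s * D ^ m * Σ< M g - s * D ^ m * Σ< N g                   ≡⟨ *-distribˡ-minus (s * D ^ m) (Σ< M g) (Σ< N g) ⟩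
          s * D ^ m * (Σ< M g - Σ< N g)                             ≤⟨ *-monoˡ (0≤* 0≤s (0≤^ 0≤D m)) gδ ⟩
          s * D ^ m * δ                                             ∎
        inner : ∣ Σ< N FM - Σ< N FN ∣ ≤ s * (Kbox m * δ) * D
        inner = begin
          ∣ Σ< N FM - Σ< N FN ∣                                     ≡⟨ cong ∣_∣ (Σ<-minus FM FN N) ⟩
          ∣ Σ< N (λ i → FM i - FN i) ∣                              ≤⟨ Σ<-abs _ (λ i → s * g i * (Kbox m * δ))
                                                                         (λ i → Σbox-increment N≤M gδ m (s * g i) (λ w → h (i ∷ w))
                                                                           (0≤sg i) (slice {h = h} s h≤ i)) N ⟩
          Σ< N (λ i → s * g i * (Kbox m * δ))                       ≡⟨ Σ<-scaled s (Kbox m * δ) N ⟩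
          s * (Kbox m * δ) * Σ< N g                                 ≤⟨ *-monoˡ (0≤* 0≤s (0≤* (0≤Kbox m) 0≤δ)) (Σg≤D N) ⟩
          s * (Kbox m * δ) * D                                      ∎

  -- Two rational sequences with the same limit; x ~ x says that x is Cauchy.

  infix 4 _~_
  _~_ : (ℕ → ℚ) → (ℕ → ℚ) → Set
  x ~ y = ∀ ε → 0ℚ < ε → ∃ λ N → ∀ m n → N ℕ.≤ m → N ℕ.≤ n → ∣ x m - y n ∣ ≤ ε

  abstract

    ~-sym : ∀ {x y} → x ~ y → y ~ x
    ~-sym {x} {y} x~y ε 0<ε = proj₁ (x~y ε 0<ε) , λ m n N≤m N≤n →
      subst (_≤ ε) (∣p-q∣≡∣q-p∣ (x n) (y m)) (proj₂ (x~y ε 0<ε) n m N≤n N≤m)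

    ~-bounded : ∀ {x y} → x ~ y → ∃ λ b → ∃ λ N → ∀ n → N ℕ.≤ n → ∣ x n ∣ ≤ fromℕ b
    ~-bounded {x} {y} x~y = proj₁ a , N , λ n N≤n → begin
      ∣ x n ∣                    ≤⟨ ∣p∣≤∣q∣+∣p-q∣ (x n) (y N) ⟩
      ∣ y N ∣ + ∣ x n - y N ∣    ≤⟨ ℚ.+-monoʳ-≤ ∣ y N ∣ (proj₂ near n N N≤n ℕ.≤-refl) ⟩
      ∣ y N ∣ + 1ℚ               ≤⟨ proj₂ a ⟩
      fromℕ (proj₁ a)            ∎
      where
      near : ∃ λ N → ∀ m n → N ℕ.≤ m → N ℕ.≤ n → ∣ x m - y n ∣ ≤ 1ℚ
      near = x~y 1ℚ (ℚ.positive⁻¹ 1ℚ)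
      N : ℕ
      N = proj₁ near
      a : ∃ λ n → ∣ y N ∣ + 1ℚ ≤ fromℕ n
      a = above (∣ y N ∣ + 1ℚ)

    ~-const : ∀ q → (λ _ → q) ~ (λ _ → q)
    ~-const q ε 0<ε = 0 , λ _ _ _ _ → subst (_≤ ε) (sym (cong ∣_∣ (ℚ.+-inverseʳ q))) (ℚ.<⇒≤ 0<ε)

    ~-+ : ∀ {x x′ y y′} → x ~ x′ → y ~ y′ → (λ n → x n + y n) ~ (λ n → x′ n + y′ n)
    ~-+ {x} {x′} {y} {y′} x~ y~ ε 0<ε = N ℕ.⊔ N′ , λ m n ≤m ≤n → begin
      ∣ x m + y m - (x′ n + y′ n) ∣             ≡⟨ cong ∣_∣ (eq (x m) (y m) (x′ n) (y′ n)) ⟩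
      ∣ (x m - x′ n) + (y m - y′ n) ∣           ≤⟨ ℚ.∣p+q∣≤∣p∣+∣q∣ (x m - x′ n) (y m - y′ n) ⟩
      ∣ x m - x′ n ∣ + ∣ y m - y′ n ∣           ≤⟨ ℚ.+-mono-≤
                                                     (proj₂ (x~ (ε * ½) (0<½* 0<ε)) m n (ℕ.m⊔n≤o⇒m≤o N N′ ≤m) (ℕ.m⊔n≤o⇒m≤o N N′ ≤n))
                                                     (proj₂ (y~ (ε * ½) (0<½* 0<ε)) m n (ℕ.m⊔n≤o⇒n≤o N N′ ≤m) (ℕ.m⊔n≤o⇒n≤o N N′ ≤n)) ⟩
      ε * ½ + ε * ½                             ≡⟨ halves ε ⟩
      ε                                         ∎
      where
      N N′ : ℕ
      N  = proj₁ (x~ (ε * ½) (0<½* 0<ε))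
      N′ = proj₁ (y~ (ε * ½) (0<½* 0<ε))
      eq : ∀ a b c d → a + b - (c + d) ≡ (a - c) + (b - d)
      eq = solve-∀ ring

    ~-neg : ∀ {x x′} → x ~ x′ → (λ n → - x n) ~ (λ n → - x′ n)
    ~-neg {x} {x′} x~ ε 0<ε = proj₁ (x~ ε 0<ε) , λ m n ≤m ≤n →
      subst (_≤ ε) (trans (sym (ℚ.∣-p∣≡∣p∣ (x m - x′ n))) (cong ∣_∣ (eq (x m) (x′ n)))) (proj₂ (x~ ε 0<ε) m n ≤m ≤n)
      where
      eq : ∀ a b → - (a - b) ≡ - a - - b
      eq = solve-∀ ring

    ~-abs : ∀ {x x′} → x ~ x′ → (λ n → ∣ x n ∣) ~ (λ n → ∣ x′ n ∣)
    ~-abs {x} {x′} x~ ε 0<ε = proj₁ (x~ ε 0<ε) , λ m n ≤m ≤n →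
      ℚ.≤-trans (∣∣-lipschitz (x m) (x′ n)) (proj₂ (x~ ε 0<ε) m n ≤m ≤n)

    ~-* : ∀ {x x′ y y′} → x ~ x′ → y ~ y′ → (λ n → x n * y n) ~ (λ n → x′ n * y′ n)
    ~-* {x} {x′} {y} {y′} x~ y~ ε 0<ε = N , λ m n ≤m ≤n → begin
      ∣ x m * y m - x′ n * y′ n ∣                       ≡⟨ cong ∣_∣ (eq (x m) (y m) (x′ n) (y′ n)) ⟩
      ∣ x m * (y m - y′ n) + y′ n * (x m - x′ n) ∣      ≤⟨ ℚ.∣p+q∣≤∣p∣+∣q∣ (x m * (y m - y′ n)) (y′ n * (x m - x′ n)) ⟩
      ∣ x m * (y m - y′ n) ∣ + ∣ y′ n * (x m - x′ n) ∣  ≤⟨ ℚ.+-mono-≤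
           (ℚ.≤-trans (∣∣-* {x m} (proj₂ (proj₂ bx) m (ℕ.≤-trans (≤₁ N₁ N₂ N₃ N₄) ≤m))
             (proj₂ (y~ _ (proj₁ (proj₂ sx))) m n (ℕ.≤-trans (≤₃ N₁ N₂ N₃ N₄) ≤m) (ℕ.≤-trans (≤₃ N₁ N₂ N₃ N₄) ≤n))) (proj₂ (proj₂ sx)))
           (ℚ.≤-trans (∣∣-* {y′ n} (proj₂ (proj₂ by) n (ℕ.≤-trans (≤₂ N₁ N₂ N₃ N₄) ≤n))
             (proj₂ (x~ _ (proj₁ (proj₂ sy))) m n (ℕ.≤-trans (≤₄ N₁ N₂ N₃ N₄) ≤m) (ℕ.≤-trans (≤₄ N₁ N₂ N₃ N₄) ≤n))) (proj₂ (proj₂ sy))) ⟩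
      ε * ½ + ε * ½                                     ≡⟨ halves ε ⟩
      ε                                                 ∎
      where
      bx : ∃ λ b → ∃ λ N → ∀ n → N ℕ.≤ n → ∣ x n ∣ ≤ fromℕ b
      bx = ~-bounded {x} {x′} x~
      by : ∃ λ b → ∃ λ N → ∀ n → N ℕ.≤ n → ∣ y′ n ∣ ≤ fromℕ b
      by = ~-bounded {y′} {y} (~-sym {y} {y′} y~)
      sx : ∃ λ δ → 0ℚ < δ × fromℕ (proj₁ bx) * δ ≤ ε * ½
      sx = shrink (fromℕ (proj₁ bx)) (0<½* 0<ε)
      sy : ∃ λ δ → 0ℚ < δ × fromℕ (proj₁ by) * δ ≤ ε * ½
      sy = shrink (fromℕ (proj₁ by)) (0<½* 0<ε)
      N₁ N₂ N₃ N₄ N : ℕ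
      N₁ = proj₁ (proj₂ bx)
      N₂ = proj₁ (proj₂ by)
      N₃ = proj₁ (y~ _ (proj₁ (proj₂ sx)))
      N₄ = proj₁ (x~ _ (proj₁ (proj₂ sy)))
      N  = (N₁ ℕ.⊔ N₂) ℕ.⊔ (N₃ ℕ.⊔ N₄)
      ≤₁ : ∀ a b c d → a ℕ.≤ (a ℕ.⊔ b) ℕ.⊔ (c ℕ.⊔ d)
      ≤₁ a b c d = ℕ.≤-trans (ℕ.m≤m⊔n a b) (ℕ.m≤m⊔n (a ℕ.⊔ b) (c ℕ.⊔ d))
      ≤₂ : ∀ a b c d → b ℕ.≤ (a ℕ.⊔ b) ℕ.⊔ (c ℕ.⊔ d)
      ≤₂ a b c d = ℕ.≤-trans (ℕ.m≤n⊔m a b) (ℕ.m≤m⊔n (a ℕ.⊔ b) (c ℕ.⊔ d))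
      ≤₃ : ∀ a b c d → c ℕ.≤ (a ℕ.⊔ b) ℕ.⊔ (c ℕ.⊔ d)
      ≤₃ a b c d = ℕ.≤-trans (ℕ.m≤m⊔n c d) (ℕ.m≤n⊔m (a ℕ.⊔ b) (c ℕ.⊔ d))
      ≤₄ : ∀ a b c d → d ℕ.≤ (a ℕ.⊔ b) ℕ.⊔ (c ℕ.⊔ d)
      ≤₄ a b c d = ℕ.≤-trans (ℕ.m≤n⊔m c d) (ℕ.m≤n⊔m (a ℕ.⊔ b) (c ℕ.⊔ d))
      eq : ∀ a b c d → a * b - c * d ≡ a * (b - d) + d * (a - c)
      eq = solve-∀ ring

module E = Estimates
open E using (_~_)

-- Equality and order compare Cauchy approximations at independent indices m and n; for Cauchy
-- sequences this agrees with comparing them at equal indices.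

record ℝ : Set where
  constructor mkℝ
  field
    seq    : ℕ → ℚ
    cauchy : seq ~ seq

open ℝ public

infix  4 _≈_ _<_ _≤_
infixl 6 _+_ _-_
infixl 7 _*_ _÷_
infix  8 -_
infixr 8 _^_

_≈_ _<_ _≤_ : ℝ → ℝ → Set
x ≈ y = seq x ~ seq y
x < y = ∃ λ ε → 0ℚ ℚ.< ε × ∃ λ N → ∀ m n → N ℕ.≤ m → N ℕ.≤ n → seq x m ℚ.+ ε ℚ.≤ seq y n
x ≤ y = ∀ ε → 0ℚ ℚ.< ε → ∃ λ N → ∀ m n → N ℕ.≤ m → N ℕ.≤ n → seq x m ℚ.≤ seq y n ℚ.+ ε

fromℚ : ℚ → ℝ
fromℚ q = mkℝ (λ _ → q) (E.~-const q)

fromℕ : ℕ → ℝ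
fromℕ n = fromℚ (E.fromℕ n)

0ℝ 1ℝ : ℝ
0ℝ = fromℚ 0ℚ
1ℝ = fromℚ 1ℚ

_+_ _*_ : ℝ → ℝ → ℝ
x + y = mkℝ (λ n → seq x n ℚ.+ seq y n) (E.~-+ {seq x} {seq x} {seq y} {seq y} (cauchy x) (cauchy y))
x * y = mkℝ (λ n → seq x n ℚ.* seq y n) (E.~-* {seq x} {seq x} {seq y} {seq y} (cauchy x) (cauchy y))

-_ ∣_∣ : ℝ → ℝ
- x = mkℝ (λ n → ℚ.- seq x n) (E.~-neg {seq x} {seq x} (cauchy x))
∣ x ∣ = mkℝ (λ n → ℚ.∣ seq x n ∣) (E.~-abs {seq x} {seq x} (cauchy x))

_-_ : ℝ → ℝ → ℝ
x - y = x + (- y)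

_÷_ : ℝ → (d : ℕ) .{{_ : ℕ.NonZero d}} → ℝ
x ÷ d = x * fromℚ (E.1/ℕ d)

_^_ : ℝ → ℕ → ℝ
x ^ zero  = 1ℝ
x ^ suc k = x * x ^ k

Σ< : ℕ → (ℕ → ℝ) → ℝ
Σ< zero    f = 0ℝ
Σ< (suc n) f = Σ< n f + f n

infix 4 _⟶_
_⟶_ : (ℕ → ℝ) → ℝ → Set
X ⟶ L = ∀ ε → 0ℚ ℚ.< ε → ∃ λ N → ∀ n → N ℕ.≤ n → ∣ X n - L ∣ < fromℚ ε

CauchySequence : (ℕ → ℝ) → Set
CauchySequence X = ∀ ε → 0ℚ ℚ.< ε → ∃ λ N → ∀ m n → N ℕ.≤ m → N ℕ.≤ n → ∣ X m - X n ∣ < fromℚ ε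

module Limit (X : ℕ → ℝ) (c : CauchySequence X) where

  open import Data.Rational.Base using () renaming (_+_ to _⊕_; _*_ to _⊛_; _-_ to _⊖_; ∣_∣ to abs; _≤_ to _≼_)
  open ℚ.≤-Reasoning

  -- The n-th approximant of the limit is within 1/(n+1) of X n.
  index : ℕ → ℕ
  index n = proj₁ (cauchy (X n) (E.1/ℕ (suc n)) (E.0<1/ℕ (suc n)))

  approximant : ℕ → ℚ
  approximant n = seq (X n) (index n)

  abstract

    approximant-close : ∀ n j → index n ℕ.≤ j → abs (seq (X n) j ⊖ approximant n) ≼ E.1/ℕ (suc n)
    approximant-close n j i≤j = proj₂ (cauchy (X n) (E.1/ℕ (suc n)) (E.0<1/ℕ (suc n))) j (index n) i≤j ℕ.≤-refl

    terms-close : ∀ {ε} → 0ℚ ℚ.< ε → ∃ λ N → ∀ m n → N ℕ.≤ m → N ℕ.≤ n →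
                  ∃ λ J → ∀ j → J ℕ.≤ j → abs (seq (X m) j ⊖ seq (X n) j) ≼ ε
    terms-close {ε} 0<ε = proj₁ (c ε 0<ε) , λ m n N≤m N≤n →
      let (ε₀ , 0<ε₀ , J , below) = proj₂ (c ε 0<ε) m n N≤m N≤n in
      J , λ j J≤j → begin
        abs (seq (X m) j ⊖ seq (X n) j)        ≡⟨ ℚ.+-identityʳ _ ⟨
        abs (seq (X m) j ⊖ seq (X n) j) ⊕ 0ℚ   ≤⟨ ℚ.+-monoʳ-≤ (abs (seq (X m) j ⊖ seq (X n) j)) (ℚ.<⇒≤ 0<ε₀) ⟩
        abs (seq (X m) j ⊖ seq (X n) j) ⊕ ε₀   ≤⟨ below j j J≤j J≤j ⟩
        ε                                      ∎

    term-approximant : ∀ {ε} → 0ℚ ℚ.< ε → ∃ λ N → ∀ m n → N ℕ.≤ m → N ℕ.≤ n →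
                       ∃ λ J → ∀ j → J ℕ.≤ j → abs (seq (X m) j ⊖ approximant n) ≼ ε
    term-approximant {ε} 0<ε = N ℕ.⊔ N′ , λ m n ≤m ≤n →
      let (J , close) = proj₂ (terms-close (E.0<½* 0<ε)) m n (ℕ.m⊔n≤o⇒m≤o N N′ ≤m) (ℕ.m⊔n≤o⇒m≤o N N′ ≤n) in
      J ℕ.⊔ index n , λ j ≤j → begin
        abs (seq (X m) j ⊖ approximant n)
          ≤⟨ E.triangle (seq (X m) j) (seq (X n) j) (approximant n) ⟩
        abs (seq (X m) j ⊖ seq (X n) j) ⊕ abs (seq (X n) j ⊖ approximant n)
          ≤⟨ ℚ.+-mono-≤ (close j (ℕ.m⊔n≤o⇒m≤o J (index n) ≤j))
               (ℚ.≤-trans (approximant-close n j (ℕ.m⊔n≤o⇒n≤o J (index n) ≤j))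
                 (ℚ.≤-trans (E.1/ℕ-anti N′ n (ℕ.m⊔n≤o⇒n≤o N N′ ≤n)) (proj₂ (E.below (E.0<½* 0<ε))))) ⟩
        ε ⊛ ½ ⊕ ε ⊛ ½
          ≡⟨ E.halves ε ⟩
        ε ∎
      where
      N N′ : ℕ
      N = proj₁ (terms-close (E.0<½* 0<ε))
      N′ = proj₁ (E.below (E.0<½* 0<ε))

    approximant-cauchy : approximant ~ approximant
    approximant-cauchy ε 0<ε = N , λ m n N≤m N≤n →
      let (J , close) = proj₂ (term-approximant (E.0<½* 0<ε)) m n N≤m N≤n
          (J′ , close′) = proj₂ (term-approximant (E.0<½* 0<ε)) m m N≤m N≤m
          j = J ℕ.⊔ J′ in
      begin
        abs (approximant m ⊖ approximant n)
          ≤⟨ E.triangle (approximant m) (seq (X m) j) (approximant n) ⟩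
        abs (approximant m ⊖ seq (X m) j) ⊕ abs (seq (X m) j ⊖ approximant n)
          ≡⟨ cong (_⊕ abs (seq (X m) j ⊖ approximant n)) (E.∣p-q∣≡∣q-p∣ (approximant m) (seq (X m) j)) ⟩
        abs (seq (X m) j ⊖ approximant m) ⊕ abs (seq (X m) j ⊖ approximant n)
          ≤⟨ ℚ.+-mono-≤ (close′ j (ℕ.m≤n⊔m J J′)) (close j (ℕ.m≤m⊔n J J′)) ⟩
        ε ⊛ ½ ⊕ ε ⊛ ½
          ≡⟨ E.halves ε ⟩
        ε ∎
      where
      N : ℕ
      N = proj₁ (term-approximant (E.0<½* 0<ε))

  lim : ℝ
  lim = mkℝ approximant approximant-cauchy

  abstract

    lim-converges : X ⟶ lim
    lim-converges ε 0<ε = N , λ n N≤n → η , 0<η , N ℕ.⊔ J n , λ a _ ≤a _ →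
      let N≤a = ℕ.m⊔n≤o⇒m≤o N (J n) ≤a
          J≤a = ℕ.m⊔n≤o⇒n≤o N (J n) ≤a
          (J′ , close) = proj₂ (term-approximant 0<η/2) n a N≤n N≤a
          j = a ℕ.⊔ J′ in
      begin
        abs (seq (X n) a ⊖ approximant a) ⊕ η
          ≤⟨ ℚ.+-monoˡ-≤ η (E.triangle (seq (X n) a) (seq (X n) j) (approximant a)) ⟩
        abs (seq (X n) a ⊖ seq (X n) j) ⊕ abs (seq (X n) j ⊖ approximant a) ⊕ η
          ≤⟨ ℚ.+-monoˡ-≤ η (ℚ.+-mono-≤ (proj₂ (cauchy (X n) (η ⊛ ½) 0<η/2) a j J≤a (ℕ.≤-trans J≤a (ℕ.m≤m⊔n a J′)))
                                        (close j (ℕ.m≤n⊔m a J′))) ⟩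
        η ⊛ ½ ⊕ η ⊛ ½ ⊕ η
          ≡⟨ cong (_⊕ η) (E.halves η) ⟩
        η ⊕ η
          ≡⟨ E.halves ε ⟩
        ε ∎
      where
      η : ℚ
      η = ε ⊛ ½
      0<η : 0ℚ ℚ.< η
      0<η = E.0<½* 0<ε
      0<η/2 : 0ℚ ℚ.< η ⊛ ½
      0<η/2 = E.0<½* 0<η
      N : ℕ
      N = proj₁ (term-approximant 0<η/2)
      J : ℕ → ℕ
      J n = proj₁ (cauchy (X n) (η ⊛ ½) 0<η/2)

open Limit public using (lim; lim-converges)

expTerm : ℝ → ℕ → ℝ
expTerm x k = (x ^ k ÷ k !) {{k ℕ.!≢0}}

abstract

  cauchyFromApproximations : (X : ℕ → ℝ) →
    (∀ ε → 0ℚ ℚ.< ε → ∃ λ N → ∀ {n m} → N ℕ.≤ n → n ℕ.≤ m →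
      ∃ λ J → ∀ j → J ℕ.≤ j → ℚ.∣ seq (X m) j ℚ.- seq (X n) j ∣ ℚ.≤ ε) →
    CauchySequence X
  cauchyFromApproximations X close ε 0<ε = N , bound
    where
    η : ℚ
    η = ε ℚ.* ½
    0<η : 0ℚ ℚ.< η
    0<η = E.0<½* 0<ε
    N : ℕ
    N = proj₁ (close η 0<η)
    finish : ∀ {d} → d ℚ.≤ η → d ℚ.+ η ℚ.≤ ε
    finish {d} d≤η = subst (d ℚ.+ η ℚ.≤_) (E.halves ε) (ℚ.+-monoˡ-≤ η d≤η)
    bound : ∀ m n → N ℕ.≤ m → N ℕ.≤ n → ∣ X m - X n ∣ < fromℚ ε
    bound m n N≤m N≤n with ℕ.≤-total n m
    ... | inj₁ n≤m = η , 0<η , proj₁ (proj₂ (close η 0<η) N≤n n≤m) , λ j _ J≤j _ →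
                     finish (proj₂ (proj₂ (close η 0<η) N≤n n≤m) j J≤j)
    ... | inj₂ m≤n = η , 0<η , proj₁ (proj₂ (close η 0<η) N≤m m≤n) , λ j _ J≤j _ →
                     finish (subst (ℚ._≤ η) (E.∣p-q∣≡∣q-p∣ (seq (X n) j) (seq (X m) j))
                       (proj₂ (proj₂ (close η 0<η) N≤m m≤n) j J≤j))

  seq-^ : ∀ x k j → seq (x ^ k) j ≡ seq x j E.^ k
  seq-^ x zero    j = refl
  seq-^ x (suc k) j = cong (seq x j ℚ.*_) (seq-^ x k j)

  seq-expTerm : ∀ x k j → seq (expTerm x k) j ≡ E.expTerm (seq x j) k
  seq-expTerm x k j = cong (ℚ._* E.1/ℕ (k !) {{k ℕ.!≢0}}) (seq-^ x k j)

  seq-Σ< : ∀ (f : ℕ → ℝ) (g : ℕ → ℚ) j → (∀ k → seq (f k) j ≡ g k) → ∀ n → seq (Σ< n f) j ≡ E.Σ< n g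
  seq-Σ< f g j f≡g zero    = refl
  seq-Σ< f g j f≡g (suc n) = cong₂ ℚ._+_ (seq-Σ< f g j f≡g n) (f≡g n)

  expTerm-summable : ∀ x → CauchySequence (λ N → Σ< N (expTerm x))
  expTerm-summable x = cauchyFromApproximations (λ N → Σ< N (expTerm x)) λ ε 0<ε →
    proj₁ (tail ε 0<ε) , λ {n} {m} N≤n n≤m → proj₁ (proj₂ bx) , λ j J≤j →
      subst (ℚ._≤ ε) (sym (cong₂ (λ p q → ℚ.∣ p ℚ.- q ∣)
          (seq-Σ< (expTerm x) (E.expTerm (seq x j)) j (λ k → seq-expTerm x k j) m)
          (seq-Σ< (expTerm x) (E.expTerm (seq x j)) j (λ k → seq-expTerm x k j) n)))
        (ℚ.≤-trans (E.Σ<-increment (E.expTerm (seq x j)) (E.expTerm (E.fromℕ b))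
            (E.∣expTerm∣≤ {seq x j} (proj₂ (proj₂ bx) j J≤j)) n≤m)
          (proj₂ (tail ε 0<ε) {n} {m} N≤n))
    where
    bx : ∃ λ b → ∃ λ N → ∀ n → N ℕ.≤ n → ℚ.∣ seq x n ∣ ℚ.≤ E.fromℕ b
    bx = E.~-bounded {seq x} {seq x} (cauchy x)
    b : ℕ
    b = proj₁ bx
    tail : ∀ ε → 0ℚ ℚ.< ε → ∃ λ N₀ → ∀ {N M} → N₀ ℕ.≤ N →
           E.Σ< M (E.expTerm (E.fromℕ b)) ℚ.- E.Σ< N (E.expTerm (E.fromℕ b)) ℚ.≤ ε
    tail ε 0<ε = E.expTail-increment b 0<ε

exp : ℝ → ℝ
exp x = lim (λ N → Σ< N (expTerm x)) (expTerm-summable x)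

-- c <liminf X says c < sup_N inf_{n ≥ N} X n in the extended reals, so it also holds when the
-- right-hand side is +∞; the infimum of a tail exceeds c iff the tail has a lower bound r > c.

_<inf[_≤]_ : ℝ → ℕ → (ℕ → ℝ) → Set
c <inf[ N ≤] X = ∃ λ r → c < r × ∀ n → N ℕ.≤ n → r ≤ X n

infix 4 _<liminf_
_<liminf_ : ℝ → (ℕ → ℝ) → Set
c <liminf X = ∃ λ N → c <inf[ N ≤] X

-- The probability of an event E about m independent Poisson(μ) variables W₁,…,W_m, as the sum of
-- the joint mass function over the w ∈ ℕᵐ satisfying E.

poissonMass : ℝ → ℕ → ℝ
poissonMass μ k = exp (- μ) * expTerm μ k

jointMass : {m : ℕ} → ℝ → Vec ℕ m → ℝ
jointMass μ []      = 1ℝ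
jointMass μ (k ∷ w) = poissonMass μ k * jointMass μ w

indicator : {A : Set} → Dec A → ℝ
indicator d = if does d then 1ℝ else 0ℝ

-- The sum over {0,…,N-1}ᵐ.
Σbox : (m N : ℕ) → (Vec ℕ m → ℝ) → ℝ
Σbox zero    N f = f []
Σbox (suc m) N f = Σ< N λ k → Σbox m N λ w → f (k ∷ w)

module _ {m : ℕ} (μ : ℝ) {E : Pred (Vec ℕ m) 0ℓ} (E? : Decidable E) where

  partialProbability : ℕ → ℝ
  partialProbability N = Σbox m N λ w → indicator (E? w) * jointMass μ w

abstract

  seq-Σbox : ∀ m N (f : Vec ℕ m → ℝ) j → seq (Σbox m N f) j ≡ E.Σbox m N (λ w → seq (f w) j)
  seq-Σbox zero    N f j = refl
  seq-Σbox (suc m) N f j =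
    seq-Σ< (λ k → Σbox m N λ w → f (k ∷ w)) (λ k → E.Σbox m N λ w → seq (f (k ∷ w)) j) j
      (λ k → seq-Σbox m N (λ w → f (k ∷ w)) j) N

  ∣indicator∣≤1 : ∀ {A : Set} (d : Dec A) j → ℚ.∣ seq (indicator d) j ∣ ℚ.≤ 1ℚ
  ∣indicator∣≤1 d j with does d
  ... | true  = ℚ.≤-refl
  ... | false = ℚ.nonNegative⁻¹ 1ℚ

  ∣jointMass∣≤ : ∀ (μ : ℝ) (g : ℕ → ℚ) j → (∀ k → ℚ.∣ seq (poissonMass μ k) j ∣ ℚ.≤ g k) →
                 ∀ {m} (w : Vec ℕ m) → ℚ.∣ seq (jointMass μ w) j ∣ ℚ.≤ E.Π g w
  ∣jointMass∣≤ μ g j ≤g []      = ℚ.≤-refl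
  ∣jointMass∣≤ μ g j ≤g (k ∷ w) = E.∣∣-* {seq (poissonMass μ k) j} (≤g k) (∣jointMass∣≤ μ g j ≤g w)

  partialProbability-cauchy : ∀ {m} (μ : ℝ) {E : Pred (Vec ℕ m) 0ℓ} (E? : Decidable E) →
                              CauchySequence (partialProbability μ E?)
  partialProbability-cauchy {m} μ E? = cauchyFromApproximations P λ ε 0<ε →
    proj₁ (tail ε 0<ε) , λ {n} {m′} N≤n n≤m′ → J , λ j J≤j →
      subst (ℚ._≤ ε) (sym (cong₂ (λ p q → ℚ.∣ p ℚ.- q ∣) (seq-Σbox m m′ f j) (seq-Σbox m n f j)))
        (ℚ.≤-trans (E.Σbox-increment g 0≤g D 0≤D Σg≤D {n} {m′} {proj₁ (δ ε 0<ε)} n≤m′ (proj₂ (tail ε 0<ε) {n} {m′} N≤n)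
            m 1ℚ (λ w → seq (f w) j) (ℚ.nonNegative⁻¹ 1ℚ)
            (λ w → E.∣∣-* {seq (indicator (E? w)) j} (∣indicator∣≤1 (E? w) j) (∣jointMass∣≤ μ g j (mass≤ J≤j) w)))
          (subst (ℚ._≤ ε) (sym (ℚ.*-identityˡ (K ℚ.* proj₁ (δ ε 0<ε)))) (proj₂ (proj₂ (δ ε 0<ε)))))
    where
    P : ℕ → ℝ
    P = partialProbability μ E?
    f : Vec ℕ m → ℝ
    f w = indicator (E? w) * jointMass μ w
    boundOf : ∀ x → ∃ λ b → ∃ λ N → ∀ n → N ℕ.≤ n → ℚ.∣ seq x n ∣ ℚ.≤ E.fromℕ b
    boundOf x = E.~-bounded {seq x} {seq x} (cauchy x)
    b c J : ℕ
    b = proj₁ (boundOf μ)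
    c = proj₁ (boundOf (exp (- μ)))
    J = proj₁ (proj₂ (boundOf (exp (- μ)))) ℕ.⊔ proj₁ (proj₂ (boundOf μ))
    C : ℚ
    C = E.fromℕ c
    S : ℕ → ℚ
    S M = E.Σ< M (E.expTerm (E.fromℕ b))
    g : ℕ → ℚ
    g k = C ℚ.* E.expTerm (E.fromℕ b) k
    0≤g : ∀ k → 0ℚ ℚ.≤ g k
    0≤g k = E.0≤* (E.0≤fromℕ c) (E.0≤expTerm (E.0≤fromℕ b) k)
    mass≤ : ∀ {j} → J ℕ.≤ j → ∀ k → ℚ.∣ seq (poissonMass μ k) j ∣ ℚ.≤ g k
    mass≤ {j} J≤j k = E.∣∣-* {seq (exp (- μ)) j}
      (proj₂ (proj₂ (boundOf (exp (- μ)))) j (ℕ.m⊔n≤o⇒m≤o _ (proj₁ (proj₂ (boundOf μ))) J≤j))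
      (subst (λ p → ℚ.∣ p ∣ ℚ.≤ E.expTerm (E.fromℕ b) k) (sym (seq-expTerm μ k j))
        (E.∣expTerm∣≤ {seq μ j} (proj₂ (proj₂ (boundOf μ)) j (ℕ.m⊔n≤o⇒n≤o (proj₁ (proj₂ (boundOf (exp (- μ))))) _ J≤j)) k))
    total : ∃ λ N → ∀ M → S M ℚ.≤ S N ℚ.+ 1ℚ
    total = E.expTail b (ℚ.positive⁻¹ 1ℚ)
    D : ℚ
    D = C ℚ.* (S (proj₁ total) ℚ.+ 1ℚ)
    Σg≤D : ∀ M → E.Σ< M g ℚ.≤ D
    Σg≤D M = subst (ℚ._≤ D) (sym (E.Σ<-*ˡ C (E.expTerm (E.fromℕ b)) M)) (E.*-monoˡ (E.0≤fromℕ c) (proj₂ total M))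
    0≤D : 0ℚ ℚ.≤ D
    0≤D = Σg≤D 0
    K : ℚ
    K = E.Kbox g 0≤g D 0≤D Σg≤D m
    δ : ∀ ε → 0ℚ ℚ.< ε → ∃ λ δ → 0ℚ ℚ.< δ × K ℚ.* δ ℚ.≤ ε
    δ ε 0<ε = E.shrink K 0<ε
    δ′ : ∀ ε (0<ε : 0ℚ ℚ.< ε) → ∃ λ δ′ → 0ℚ ℚ.< δ′ × C ℚ.* δ′ ℚ.≤ proj₁ (δ ε 0<ε)
    δ′ ε 0<ε = E.shrink C (proj₁ (proj₂ (δ ε 0<ε)))
    tail : ∀ ε (0<ε : 0ℚ ℚ.< ε) → ∃ λ N₀ → ∀ {N M} → N₀ ℕ.≤ N → E.Σ< M g ℚ.- E.Σ< N g ℚ.≤ proj₁ (δ ε 0<ε)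
    tail ε 0<ε = proj₁ (E.expTail-increment b (proj₁ (proj₂ (δ′ ε 0<ε)))) , λ {N} {M} N₀≤N →
      subst (ℚ._≤ proj₁ (δ ε 0<ε))
        (sym (trans (cong₂ ℚ._-_ (E.Σ<-*ˡ C (E.expTerm (E.fromℕ b)) M) (E.Σ<-*ˡ C (E.expTerm (E.fromℕ b)) N))
               (E.*-distribˡ-minus C (S M) (S N))))
        (ℚ.≤-trans (E.*-monoˡ (E.0≤fromℕ c) (proj₂ (E.expTail-increment b (proj₁ (proj₂ (δ′ ε 0<ε)))) {N} {M} N₀≤N))
          (proj₂ (proj₂ (δ′ ε 0<ε))))

ℙ : {m : ℕ} (μ : ℝ) {E : Pred (Vec ℕ m) 0ℓ} → Decidable E → ℝ
ℙ μ E? = lim (partialProbability μ E?) (partialProbability-cauchy μ E?)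

-- Here n = 3 + k and ν is the expected number of voters; by Poisson thinning each of the 4n - 2 rows
-- is selected by an independent Poisson(ν / (4n - 2)) number of voters.
ℙF : ℕ → ℝ → ℝ
ℙF k ν = ℙ (ν ÷ size k) (F? k)

{-# OPTIONS --safe #-}
-- Any two candidates are ordered as in G_n by exactly 2n of the 4n - 2 rows of R_n. This follows by
-- induction on n: within a half of the candidates, v₁, …, v₄ contribute 2 and ⋈ preserves the count of
-- R_{n-1}; across the halves they contribute 3, and ⋈ alternates. If the random majority graph is wrong
-- at a pair, then the rows agreeing with G_n there receive at most as many votes as the others. Weighting
-- each vote for an agreeing row by (2n - 1) / 2n and each other vote by 2n / (2n - 1), Markov's inequality
-- bounds the probability of this by exp(- λ / ((4n - 2)(2n - 1))), and summing over at most 4ⁿ pairs gives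
-- exp(2n ln 2 - λ / ((4n - 2)(2n - 1))), where (4n - 2)(2n - 1) < 8n². The finitely many n with λ_n too
-- small are absorbed by K.

module Submission where

-- Let agreeing votes weigh 1/x and the others x, with x at least 1. For p = 2n - 1 a pair has p + 1
-- agreeing rows and p - 1 others, so the exponent is the row rate times (p + 1)(1/x - 1) + (p -
-- 1)(x - 1). This is smallest at x = sqrt((p + 1)/(p - 1)), which is irrational in general. The
-- rational x = 1 + 1/p agrees with it to first order in 1/p and gives exactly - 1/p, the leading
-- order of the optimum. The 16 of the hypothesis is then 2 * 8: the factor 2 from 4ⁿ = exp(2n ln 2)
-- pairs, the factor 8 from the denominator 8n².
--
-- Probabilities are limits of sums over boxes, so Markov's inequality is applied inside each finite
-- box. There the truncated expectation of a product is a product of partial sums of exponential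
-- series, which lie below `exp` because their arguments are nonnegative. `exp` itself is only given
-- as a limit of Cauchy reals; its addition formula, positivity and monotonicity are derived from
-- rational diagonal sums, the j-th partial sum evaluated at the j-th approximation of the argument.

-- Precedence in concatenated, reversed, shifted and block-structured rows.

module Precedence where

  open import Data.Bool.Base using (Bool; true; false; not; if_then_else_; _∨_; T)
  import Data.Bool.Properties as Bool
  open import Data.Bool.ListAction using (any)
  open import Data.List.Base using (List; []; _∷_; _++_; map; reverse; concat)
  import Data.List.Properties as List
  open import Data.List.Membership.Propositional using (_∈_; _∉_)
  open import Data.List.Relation.Unary.All as All using ()
  open import Data.List.Relation.Unary.AllPairs using (_∷_)
  open import Data.List.Relation.Unary.Any using (here; there)
  import Data.List.Relation.Unary.Any.Properties as Any
  open import Data.List.Relation.Unary.Unique.Propositional using (Unique)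
  open import Data.Nat.Base using (ℕ; zero; suc; _+_; _≡ᵇ_)
  import Data.Nat.Properties as ℕ
  open import Function.Base using (_∘_; case_of_)
  open import Relation.Binary.PropositionalEquality
  open import Relation.Nullary using (yes; no; contradiction)
  open import Defs using (module Voting)
  open Voting using (Row; _precedes_)

  T⇒true : ∀ {b} → T b → b ≡ true
  T⇒true {true} _ = refl

  ≡ᵇ-refl : ∀ n → (n ≡ᵇ n) ≡ true
  ≡ᵇ-refl zero    = refl
  ≡ᵇ-refl (suc n) = ≡ᵇ-refl n

  ≢⇒≡ᵇ : ∀ {m n} → m ≢ n → (m ≡ᵇ n) ≡ false
  ≢⇒≡ᵇ {m} {n} m≢n with m ≡ᵇ n in eq
  ... | true  = contradiction (ℕ.≡ᵇ⇒≡ m n (subst T (sym eq) _)) m≢n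
  ... | false = refl

  any-++ : ∀ (p : ℕ → Bool) r s → any p (r ++ s) ≡ any p r ∨ any p s
  any-++ p []      s = refl
  any-++ p (x ∷ r) s = trans (cong (p x ∨_) (any-++ p r s)) (sym (Bool.∨-assoc (p x) _ _))

  any-∈ : ∀ {b r} → b ∈ r → any (b ≡ᵇ_) r ≡ true
  any-∈ {b} {_ ∷ r} (here refl) = cong (_∨ any (b ≡ᵇ_) r) (≡ᵇ-refl b)
  any-∈ {b} {x ∷ _} (there b∈r) = trans (cong ((b ≡ᵇ x) ∨_) (any-∈ b∈r)) (Bool.∨-zeroʳ (b ≡ᵇ x))

  any-∉ : ∀ {b r} → b ∉ r → any (b ≡ᵇ_) r ≡ false
  any-∉ {b} {[]}    b∉r = refl
  any-∉ {b} {x ∷ r} b∉r = cong₂ _∨_ (≢⇒≡ᵇ (b∉r ∘ here)) (any-∉ (b∉r ∘ there))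

  precedes-here : ∀ a b r → (a precedes b) (a ∷ r) ≡ any (b ≡ᵇ_) r
  precedes-here a b r = cong (if_then any (b ≡ᵇ_) r else (a precedes b) r) (≡ᵇ-refl a)

  precedes-there : ∀ {a x} b r → x ≢ a → (a precedes b) (x ∷ r) ≡ (a precedes b) r
  precedes-there {a} b r x≢a = cong (if_then any (b ≡ᵇ_) r else (a precedes b) r) (≢⇒≡ᵇ x≢a)

  precedes-∉ʳ : ∀ {a b r} → b ∉ r → (a precedes b) r ≡ false
  precedes-∉ʳ {r = []} b∉r = refl
  precedes-∉ʳ {a} {b} {x ∷ r} b∉r with x ≡ᵇ a
  ... | true  = any-∉ (b∉r ∘ there)
  ... | false = precedes-∉ʳ (b∉r ∘ there)

  precedes-++-∉ˡ : ∀ {a b r} s → a ∉ r → (a precedes b) (r ++ s) ≡ (a precedes b) s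
  precedes-++-∉ˡ {r = []}            s a∉r = refl
  precedes-++-∉ˡ {b = b} {r = x ∷ r} s a∉r =
    trans (precedes-there b (r ++ s) (a∉r ∘ here ∘ sym)) (precedes-++-∉ˡ s (a∉r ∘ there))

  precedes-++-∉ʳ : ∀ {a b} r {s} → b ∉ s → (a precedes b) (r ++ s) ≡ (a precedes b) r
  precedes-++-∉ʳ []      b∉s = precedes-∉ʳ b∉s
  precedes-++-∉ʳ {a} {b} (x ∷ r) {s} b∉s with x ≡ᵇ a
  ... | true  = trans (any-++ (b ≡ᵇ_) r s) (trans (cong (any (b ≡ᵇ_) r ∨_) (any-∉ b∉s)) (Bool.∨-identityʳ _))
  ... | false = precedes-++-∉ʳ r b∉s

  precedes-++-∈ : ∀ {a b r} s → a ∈ r → b ∉ r → (a precedes b) (r ++ s) ≡ any (b ≡ᵇ_) s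
  precedes-++-∈ {a} {b} {x ∷ r} s a∈r b∉r with x ℕ.≟ a
  ... | yes refl = trans (precedes-here a b (r ++ s)) (trans (any-++ (b ≡ᵇ_) r s) (cong (_∨ _) (any-∉ (b∉r ∘ there))))
  ... | no x≢a   = trans (precedes-there b (r ++ s) x≢a) (case a∈r of λ where
    (here a≡x)  → contradiction (sym a≡x) x≢a
    (there a∈r) → precedes-++-∈ s a∈r (b∉r ∘ there))

  -- The head x moves to the end of the reversed row. If x is a, nothing follows it there; if x is
  -- b, it now follows a; otherwise it affects neither side. `Unique` prevents the head from
  -- recurring in the tail.
  precedes-reverse : ∀ {a b r} → Unique r → a ∈ r → b ∈ r → a ≢ b → (a precedes b) (reverse r) ≡ not ((a precedes b) r)
  precedes-reverse {a} {b} {x ∷ r} (x∉r ∷ ur) a∈ b∈ a≢b rewrite List.unfold-reverse x r with a∈ | b∈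
  ... | here refl  | here refl  = contradiction refl a≢b
  ... | here refl  | there b∈r  = trans
    (precedes-++-∉ˡ (a ∷ []) λ a∈ → All.lookup x∉r (Any.reverse⁻ a∈) refl)
    (trans (precedes-here a b []) (cong not (sym (trans (precedes-here a b r) (any-∈ b∈r)))))
  ... | there a∈r  | here refl  = trans
    (precedes-++-∈ (b ∷ []) (Any.reverse⁺ a∈r) λ b∈ → All.lookup x∉r (Any.reverse⁻ b∈) refl)
    (trans (any-∈ {b} {b ∷ []} (here refl)) (cong not (sym (trans (precedes-there b r (a≢b ∘ sym))
      (precedes-∉ʳ λ b∈r → All.lookup x∉r b∈r refl)))))
  ... | there a∈r  | there b∈r  = trans
    (precedes-++-∉ʳ (reverse r) {x ∷ []} λ where (here refl) → All.lookup x∉r b∈r refl)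
    (trans (precedes-reverse ur a∈r b∈r a≢b)
      (cong not (sym (precedes-there b r (All.lookup x∉r a∈r)))))

  ≡ᵇ-+ʳ : ∀ m n o → (m + o ≡ᵇ n + o) ≡ (m ≡ᵇ n)
  ≡ᵇ-+ʳ m n o rewrite ℕ.+-comm m o | ℕ.+-comm n o = go o
    where
    go : ∀ o → (o + m ≡ᵇ o + n) ≡ (m ≡ᵇ n)
    go zero    = refl
    go (suc o) = go o

  any-shift : ∀ b o r → any (b + o ≡ᵇ_) (map (_+ o) r) ≡ any (b ≡ᵇ_) r
  any-shift b o []      = refl
  any-shift b o (x ∷ r) = cong₂ _∨_ (≡ᵇ-+ʳ b x o) (any-shift b o r)

  precedes-shift : ∀ a b o r → ((a + o) precedes (b + o)) (map (_+ o) r) ≡ (a precedes b) r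
  precedes-shift a b o []      = refl
  precedes-shift a b o (x ∷ r) rewrite ≡ᵇ-+ʳ x a o | precedes-shift a b o r | any-shift b o r = refl

  -- Exactly one occurrence. With two copies of a block, a in the first copy would precede b in the
  -- second, whatever their order inside the block.
  once : ℕ → List ℕ → Bool
  once l []        = false
  once l (l′ ∷ ls) = if l′ ≡ᵇ l then not (any (l ≡ᵇ_) ls) else once l ls

  module _ (block : ℕ → Row) (disjoint : ∀ {l l′ x} → x ∈ block l → x ∈ block l′ → l ≡ l′) where

    blocks : List ℕ → Row
    blocks ls = concat (map block ls)

    any-blocks : ∀ {b l} ls → b ∈ block l → any (b ≡ᵇ_) (blocks ls) ≡ any (l ≡ᵇ_) ls
    any-blocks [] b∈ = refl
    any-blocks {b} {l} (l′ ∷ ls) b∈ = trans (any-++ (b ≡ᵇ_) (block l′) (blocks ls)) (cong₂ _∨_ head (any-blocks ls b∈))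
      where
      head : any (b ≡ᵇ_) (block l′) ≡ (l ≡ᵇ l′)
      head with l ℕ.≟ l′
      ... | yes refl = trans (any-∈ b∈) (sym (≡ᵇ-refl l))
      ... | no l≢l′  = trans (any-∉ λ b∈′ → l≢l′ (disjoint b∈ b∈′)) (sym (≢⇒≡ᵇ l≢l′))

    -- Labels are read by the same `precedes` as candidates: after the first block that contains a,
    -- b occurs again iff the label of its block does. Precedence across blocks thus becomes a
    -- closed computation on short label lists.
    precedes-blocks : ∀ {a b l l′} → a ∈ block l → b ∈ block l′ → l ≢ l′ →
                      ∀ ls → (a precedes b) (blocks ls) ≡ (l precedes l′) ls
    precedes-blocks a∈ b∈ l≢l′ [] = refl
    precedes-blocks {a} {b} {l} {l′} a∈ b∈ l≢l′ (h ∷ ls) with h ℕ.≟ l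
    ... | yes refl = trans (precedes-++-∈ (blocks ls) a∈ λ b∈′ → l≢l′ (disjoint b∈′ b∈))
                       (trans (any-blocks ls b∈) (sym (precedes-here l l′ ls)))
    ... | no h≢l   = trans (precedes-++-∉ˡ (blocks ls) λ a∈′ → h≢l (disjoint a∈′ a∈))
                       (trans (precedes-blocks a∈ b∈ l≢l′ ls) (sym (precedes-there l′ ls h≢l)))

    precedes-block : ∀ {a b l} → a ∈ block l → b ∈ block l →
                     ∀ ls → once l ls ≡ true → (a precedes b) (blocks ls) ≡ (a precedes b) (block l)
    precedes-block {a} {b} {l} a∈ b∈ (h ∷ ls) o with h ℕ.≟ l
    ... | yes refl = precedes-++-∉ʳ (block l) λ b∈′ → case trans (sym (any-∈ b∈′)) (trans (any-blocks ls b∈) absent) of λ ()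
      where
      absent : any (l ≡ᵇ_) ls ≡ false
      absent = Bool.not-injective (trans (cong (if_then not (any (l ≡ᵇ_) ls) else once l ls) (sym (≡ᵇ-refl l))) o)
    ... | no h≢l   = trans (precedes-++-∉ˡ (blocks ls) λ a∈′ → h≢l (disjoint a∈′ a∈))
      (precedes-block a∈ b∈ ls (trans (cong (if_then not (any (l ≡ᵇ_) ls) else once l ls) (sym (≢⇒≡ᵇ h≢l))) o))

-- Every pair of distinct candidates is ordered as in the graph by exactly 2n rows.

module Agreement where

  open import Data.Bool.Base using (Bool; true; false; not; if_then_else_; _xor_; T)
  import Data.Bool.Properties as Bool
  open import Data.List.Base using (List; []; _∷_; _++_; map; reverse; concat)
  import Data.List.Properties as List
  open import Data.List.Membership.Propositional using (_∈_; _∉_)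
  import Data.Nat.Properties as ℕ
  open import Data.List.Membership.DecPropositional ℕ._≟_ using (_∈?_)
  open import Data.List.Membership.Propositional.Properties using
    (∈-++⁺ˡ; ∈-++⁺ʳ; ∈-++⁻; ∈-map⁺; ∈-map⁻; ∈-concat⁺′; ∈-concat⁻′; ∈-applyUpTo⁺; ∈-applyUpTo⁻; ∈-upTo⁺; ∈-upTo⁻)
  open import Data.List.Relation.Unary.All as ListAll using () renaming (All to ListAll)
  open import Data.List.Relation.Unary.Any using (here; there)
  import Data.List.Relation.Unary.Any.Properties as Any
  open import Data.List.Relation.Unary.AllPairs using ([])
  open import Data.List.Relation.Unary.Unique.Propositional using (Unique)
  open import Data.List.Relation.Unary.Unique.Propositional.Properties using (applyUpTo⁺₁)
  open import Data.Nat.Base using (ℕ; zero; suc; _+_; _*_; _∸_; _^_; _≡ᵇ_; _<ᵇ_; _≤ᵇ_; _≤_; _<_; z≤n; s≤s; ⌊_/2⌋; ⌈_/2⌉)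
  open import Data.Nat.Divisibility using (n∣m*n)
  import Data.Nat.DivMod as DivMod
  open import Data.Product.Base using (_×_; _,_; ∃; proj₁; proj₂)
  open import Data.Sum.Base as Sum using (_⊎_; inj₁; inj₂)
  open import Data.Vec.Base as Vec using (Vec; []; _∷_)
  open import Data.Vec.Relation.Unary.All as All using (All; []; _∷_)
  open import Function.Base using (_∘_; case_of_)
  open import Relation.Binary.PropositionalEquality
  open import Relation.Nullary using (contradiction; ¬_)
  open import Relation.Nullary.Decidable using (from-yes; _→-dec_; _×-dec_; ¬?)
  open import Data.Nat.Tactic.RingSolver using (solve-∀)
  open import Defs using (module Voting)
  open Voting
  open Precedence

  even-suc : ∀ n → even (suc n) ≡ not (even n)
  even-suc zero          = refl
  even-suc (suc zero)    = refl
  even-suc (suc (suc n)) = even-suc n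

  even-+ : ∀ m n → even (m + n) ≡ not (even m xor even n)
  even-+ zero    n = sym (Bool.not-involutive (even n))
  even-+ (suc m) n = trans (even-suc (m + n)) (trans (cong not (even-+ m n))
    (cong not (trans (Bool.not-distribˡ-xor (even m) (even n)) (cong (_xor even n) (sym (even-suc m))))))

  even-double : ∀ n → even (2 * n) ≡ true
  even-double n = trans (even-+ n (n + 0)) (trans (cong (λ m → not (even n xor even m)) (ℕ.+-identityʳ n))
    (cong not (Bool.xor-same (even n))))

  even-double+ : ∀ m n → even (2 * m + n) ≡ even n
  even-double+ m n = trans (even-+ (2 * m) n) (trans (cong (λ b → not (b xor even n)) (even-double m)) (Bool.not-involutive (even n)))

  Candidate : ℕ → ℕ → Set
  Candidate M x = 1 ≤ x × x ≤ M

  top : ℕ → ℕ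
  top k = 2 ^ (3 + k)

  -- The numbering makes both relevant features of a candidate readable from its label: the upper
  -- half has labels 2 and 3, and a candidate in block l has the parity of l + 1.
  block : ℕ → ℕ → Row
  block k 0 = A₁ (4 + k)
  block k 1 = A₂ (4 + k)
  block k 2 = B₁ (4 + k)
  block k 3 = B₂ (4 + k)
  block k _ = []

  module _ (k : ℕ) where

    N M : ℕ
    N = 2 ^ (2 + k)
    M = top k

    -- A left inverse of membership in a block. That membership determines a function value is what
    -- makes the blocks disjoint.
    label : ℕ → ℕ
    label x = if x ≤ᵇ M then (if even x then 1 else 0) else (if even x then 3 else 2)

    ≤M : ∀ {i} → i < N → 2 * i + 2 ≤ M
    ≤M {i} i<N = ℕ.≤-trans (ℕ.≤-reflexive (trans (ℕ.+-comm (2 * i) 2) (sym (ℕ.*-suc 2 i)))) (ℕ.*-monoʳ-≤ 2 i<N)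

    low : ∀ {x} → x ≤ M → (x ≤ᵇ M) ≡ true
    low x≤M = T⇒true (ℕ.≤⇒≤ᵇ x≤M)

    high : ∀ {x} → 1 ≤ x → (M + x ≤ᵇ M) ≡ false
    high {x} 1≤x with M + x ≤ᵇ M in eq
    ... | true  = contradiction (ℕ.≤ᵇ⇒≤ (M + x) M (subst T (sym eq) _)) (ℕ.<⇒≱ (ℕ.m<m+n M 1≤x))
    ... | false = refl

    odd-low : ∀ i → even (2 * i + 1) ≡ false
    odd-low i = even-double+ i 1

    even-low : ∀ i → even (2 * i + 2) ≡ true
    even-low i = even-double+ i 2

    odd-high : ∀ i → even (M + (2 * i + 1)) ≡ false
    odd-high i = trans (even-double+ N (2 * i + 1)) (odd-low i)

    even-high : ∀ i → even (M + (2 * i + 2)) ≡ true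
    even-high i = trans (even-double+ N (2 * i + 2)) (even-low i)

    1≤ : ∀ {i p} → 1 ≤ p → 1 ≤ 2 * i + p
    1≤ {i} {p} 1≤p = ℕ.≤-trans 1≤p (ℕ.m≤n+m p (2 * i))

    ≤M′ : ∀ {i} → i < N → 2 * i + 1 ≤ M
    ≤M′ {i} i<N = ℕ.≤-trans (ℕ.+-monoʳ-≤ (2 * i) (s≤s z≤n)) (≤M i<N)

    label-block : ∀ l {x} → x ∈ block k l → label x ≡ l
    label-block 0 x∈ with ∈-applyUpTo⁻ _ x∈
    ... | i , i<N , refl rewrite low (≤M′ i<N) | odd-low i = refl
    label-block 1 x∈ with ∈-applyUpTo⁻ _ x∈
    ... | i , i<N , refl rewrite low (≤M i<N) | even-low i = refl
    label-block 2 x∈ with ∈-applyUpTo⁻ _ x∈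
    ... | i , i<N , refl rewrite high (1≤ {i} {1} (s≤s z≤n)) | odd-high i = refl
    label-block 3 x∈ with ∈-applyUpTo⁻ _ x∈
    ... | i , i<N , refl rewrite high (1≤ {i} {2} (s≤s z≤n)) | even-high i = refl

    disjoint : ∀ {l l′ x} → x ∈ block k l → x ∈ block k l′ → l ≡ l′
    disjoint {l} {l′} x∈ x∈′ = trans (sym (label-block l x∈)) (label-block l′ x∈′)

    disjoint-reverse : ∀ {l l′ x} → x ∈ reverse (block k l) → x ∈ reverse (block k l′) → l ≡ l′
    disjoint-reverse {l} {l′} x∈ x∈′ = disjoint {l} {l′} (Any.reverse⁻ x∈) (Any.reverse⁻ x∈′)

    parity : ∀ x → 1 ≤ x → ∃ λ i → x ≡ 2 * i + 1 ⊎ x ≡ 2 * i + 2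
    parity 1             _ = 0 , inj₁ refl
    parity 2             _ = 0 , inj₂ refl
    parity (suc (suc (suc x))) _ with parity (suc x) (s≤s z≤n)
    ... | i , inj₁ eq = suc i , inj₁ (trans (cong (2 +_) eq) (cong (_+ 1) (sym (ℕ.*-suc 2 i))))
    ... | i , inj₂ eq = suc i , inj₂ (trans (cong (2 +_) eq) (cong (_+ 2) (sym (ℕ.*-suc 2 i))))

    <N : ∀ i p → 2 * i + suc p ≤ M → i < N
    <N i p ≤M = ℕ.*-cancelˡ-< 2 i N (ℕ.<-≤-trans (ℕ.m<m+n (2 * i) (s≤s z≤n)) ≤M)

    low-block : ∀ {x} → Candidate M x → x ∈ block k 0 ⊎ x ∈ block k 1
    low-block {x} (1≤x , x≤M) with parity x 1≤x
    ... | i , inj₁ refl = inj₁ (∈-applyUpTo⁺ (λ i → 2 * i + 1) (<N i 0 x≤M))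
    ... | i , inj₂ refl = inj₂ (∈-applyUpTo⁺ (λ i → 2 * i + 2) (<N i 1 x≤M))

    high-block : ∀ {x} → Candidate M x → x + M ∈ block k 2 ⊎ x + M ∈ block k 3
    high-block {x} (1≤x , x≤M) with parity x 1≤x
    ... | i , inj₁ refl = inj₁ (subst (_∈ block k 2) (ℕ.+-comm M _) (∈-applyUpTo⁺ (λ i → M + (2 * i + 1)) (<N i 0 x≤M)))
    ... | i , inj₂ refl = inj₂ (subst (_∈ block k 3) (ℕ.+-comm M _) (∈-applyUpTo⁺ (λ i → M + (2 * i + 2)) (<N i 1 x≤M)))

    split : ∀ {x} → Candidate (top (suc k)) x → Candidate M x ⊎ ∃ λ y → Candidate M y × x ≡ y + M
    split {x} (1≤x , x≤2M) with ℕ.≤-<-connex x M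
    ... | inj₁ x≤M = inj₁ (1≤x , x≤M)
    ... | inj₂ M<x = inj₂ (x ∸ M , (ℕ.m<n⇒0<n∸m M<x , ℕ.≤-trans (ℕ.m≤n+o⇒m∸n≤o x M x≤2M) (ℕ.≤-reflexive (ℕ.+-identityʳ M)))
                          , sym (ℕ.m∸n+n≡m (ℕ.<⇒≤ M<x)))

    low-candidate : ∀ {x} → Candidate M x → Candidate (top (suc k)) x
    low-candidate (1≤x , x≤M) = 1≤x , ℕ.≤-trans x≤M (ℕ.m≤m+n M (M + 0))

    high-candidate : ∀ {x} → Candidate M x → Candidate (top (suc k)) (x + M)
    high-candidate {x} (1≤x , x≤M) = ℕ.≤-trans 1≤x (ℕ.m≤m+n x M) ,
      ℕ.≤-trans (ℕ.+-monoˡ-≤ M x≤M) (ℕ.≤-reflexive (cong (M +_) (sym (ℕ.+-identityʳ M))))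

    block-candidate : ∀ l {x} → x ∈ block k l → Candidate (top (suc k)) x
    block-candidate 0 x∈ with ∈-applyUpTo⁻ _ x∈
    ... | i , i<N , refl = low-candidate (1≤ {i} (s≤s z≤n) , ≤M′ i<N)
    block-candidate 1 x∈ with ∈-applyUpTo⁻ _ x∈
    ... | i , i<N , refl = low-candidate (1≤ {i} (s≤s z≤n) , ≤M i<N)
    block-candidate 2 x∈ with ∈-applyUpTo⁻ _ x∈
    ... | i , i<N , refl = subst (Candidate _) (ℕ.+-comm _ M) (high-candidate (1≤ {i} (s≤s z≤n) , ≤M′ i<N))
    block-candidate 3 x∈ with ∈-applyUpTo⁻ _ x∈
    ... | i , i<N , refl = subst (Candidate _) (ℕ.+-comm _ M) (high-candidate (1≤ {i} (s≤s z≤n) , ≤M i<N))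

    block-unique : ∀ l → Unique (block k l)
    block-unique 0 = applyUpTo⁺₁ (λ i → 2 * i + 1) N λ i<j _ eq →
      ℕ.<⇒≢ (ℕ.+-monoˡ-< 1 (ℕ.*-monoʳ-< 2 i<j)) eq
    block-unique 1 = applyUpTo⁺₁ (λ i → 2 * i + 2) N λ i<j _ eq →
      ℕ.<⇒≢ (ℕ.+-monoˡ-< 2 (ℕ.*-monoʳ-< 2 i<j)) eq
    block-unique 2 = applyUpTo⁺₁ (λ i → M + (2 * i + 1)) N λ i<j _ eq →
      ℕ.<⇒≢ (ℕ.+-monoʳ-< M (ℕ.+-monoˡ-< 1 (ℕ.*-monoʳ-< 2 i<j))) eq
    block-unique 3 = applyUpTo⁺₁ (λ i → M + (2 * i + 2)) N λ i<j _ eq →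
      ℕ.<⇒≢ (ℕ.+-monoʳ-< M (ℕ.+-monoˡ-< 2 (ℕ.*-monoʳ-< 2 i<j))) eq
    block-unique (suc (suc (suc (suc _)))) = []

  -- The sequences of blocks in `v₁`, ..., `v₄`. In the second and the fourth, each block is itself
  -- reversed.
  order₁ order₂ order₃ order₄ : List ℕ
  order₁ = 0 ∷ 2 ∷ 1 ∷ 3 ∷ []
  order₂ = 1 ∷ 3 ∷ 0 ∷ 2 ∷ []
  order₃ = 2 ∷ 1 ∷ 3 ∷ 0 ∷ []
  order₄ = 3 ∷ 0 ∷ 2 ∷ 1 ∷ []

  concat-4 : (a b c d : Row) → a ++ b ++ c ++ d ≡ concat (a ∷ b ∷ c ∷ d ∷ [])
  concat-4 a b c d = cong (λ r → a ++ b ++ c ++ r) (sym (List.++-identityʳ d))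

  count : ∀ {m} → Vec Bool m → ℕ
  count []       = 0
  count (b ∷ bs) = (if b then 1 else 0) + count bs

  -- Here g is the arrow bit of (a , b) and p says whether a precedes b. Agreement with a missing
  -- arrow means that a does not precede b, so that arrows and missing arrows are handled by one
  -- count.
  agree : Bool → Bool → Bool
  agree g p = if g then p else not p

  outer : ℕ → (Row → Bool) → Vec Bool 4
  outer k f = f (v₁ (4 + k)) ∷ f (v₂ (4 + k)) ∷ f (v₃ (4 + k)) ∷ f (v₄ (4 + k)) ∷ []

  -- The pattern of a pair inside one block: `v₁` and `v₃` list the block forwards, `v₂` and `v₄`
  -- backwards.
  count-agree-not : ∀ g p → count (agree g p ∷ agree g (not p) ∷ agree g p ∷ agree g (not p) ∷ []) ≡ 2
  count-agree-not true  true  = refl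
  count-agree-not true  false = refl
  count-agree-not false true  = refl
  count-agree-not false false = refl

  module _ (k : ℕ) {a b : ℕ} (g : Bool) where

    private
      f : Row → Bool
      f = agree g ∘ (a precedes b)

      B R : ℕ → Row
      B = block k
      R = reverse ∘ B

      reshape : ∀ {p₁ p₂ p₃ p₄} →
        (a precedes b) (blocks B (disjoint k) order₁) ≡ p₁ → (a precedes b) (blocks R (disjoint-reverse k) order₂) ≡ p₂ →
        (a precedes b) (blocks B (disjoint k) order₃) ≡ p₃ → (a precedes b) (blocks R (disjoint-reverse k) order₄) ≡ p₄ →
        outer k f ≡ agree g p₁ ∷ agree g p₂ ∷ agree g p₃ ∷ agree g p₄ ∷ []
      reshape refl refl refl refl
        rewrite concat-4 (B 0) (B 2) (B 1) (B 3) | concat-4 (R 1) (R 3) (R 0) (R 2)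
              | concat-4 (B 2) (B 1) (B 3) (B 0) | concat-4 (R 3) (R 0) (R 2) (R 1) = refl

    outer-same-block : ∀ l → a ∈ block k l → b ∈ block k l → a ≢ b →
      once l order₁ ≡ true → once l order₂ ≡ true → once l order₃ ≡ true → once l order₄ ≡ true → count (outer k f) ≡ 2
    outer-same-block l a∈ b∈ a≢b o₁ o₂ o₃ o₄ = trans (cong count (reshape
        (precedes-block B (disjoint k) {l = l} a∈ b∈ order₁ o₁)
        (trans (precedes-block R (disjoint-reverse k) {l = l} (Any.reverse⁺ a∈) (Any.reverse⁺ b∈) order₂ o₂) rev)
        (precedes-block B (disjoint k) {l = l} a∈ b∈ order₃ o₃)
        (trans (precedes-block R (disjoint-reverse k) {l = l} (Any.reverse⁺ a∈) (Any.reverse⁺ b∈) order₄ o₄) rev)))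
      (count-agree-not g ((a precedes b) (B l)))
      where
      rev : (a precedes b) (R l) ≡ not ((a precedes b) (B l))
      rev = precedes-reverse (block-unique k l) a∈ b∈ a≢b

    outer-blocks : ∀ l l′ → a ∈ block k l → b ∈ block k l′ → l ≢ l′ → outer k f ≡
      agree g ((l precedes l′) order₁) ∷ agree g ((l precedes l′) order₂) ∷
      agree g ((l precedes l′) order₃) ∷ agree g ((l precedes l′) order₄) ∷ []
    outer-blocks l l′ a∈ b∈ l≢l′ = reshape
      (precedes-blocks B (disjoint k) {l = l} {l′} a∈ b∈ l≢l′ order₁)
      (precedes-blocks R (disjoint-reverse k) {l = l} {l′} (Any.reverse⁺ a∈) (Any.reverse⁺ b∈) l≢l′ order₂)
      (precedes-blocks B (disjoint k) {l = l} {l′} a∈ b∈ l≢l′ order₃)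
      (precedes-blocks R (disjoint-reverse k) {l = l} {l′} (Any.reverse⁺ a∈) (Any.reverse⁺ b∈) l≢l′ order₄)

    count-outer-blocks : ∀ l l′ {g′ c} → a ∈ block k l → b ∈ block k l′ → l ≢ l′ → g ≡ g′ →
      count (agree g′ ((l precedes l′) order₁) ∷ agree g′ ((l precedes l′) order₂) ∷
             agree g′ ((l precedes l′) order₃) ∷ agree g′ ((l precedes l′) order₄) ∷ []) ≡ c → count (outer k f) ≡ c
    count-outer-blocks l l′ a∈ b∈ l≢l′ refl = trans (cong count (outer-blocks l l′ a∈ b∈ l≢l′))

  even-block : ∀ k l {x} → x ∈ block k l → even x ≡ even (suc l)
  even-block k 0 x∈ with ∈-applyUpTo⁻ _ x∈
  ... | i , i<N , refl = odd-low k i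
  even-block k 1 x∈ with ∈-applyUpTo⁻ _ x∈
  ... | i , i<N , refl = even-low k i
  even-block k 2 x∈ with ∈-applyUpTo⁻ _ x∈
  ... | i , i<N , refl = odd-high k i
  even-block k 3 x∈ with ∈-applyUpTo⁻ _ x∈
  ... | i , i<N , refl = even-high k i

  even-blocks : ∀ k l l′ {a b} → a ∈ block k l → b ∈ block k l′ → even (a + b) ≡ not (even (suc l) xor even (suc l′))
  even-blocks k l l′ {a} {b} a∈ b∈ = trans (even-+ a b) (cong₂ (λ p q → not (p xor q)) (even-block k l a∈) (even-block k l′ b∈))

  module _ (k : ℕ) {a b : ℕ} where

    -- Inside one block the two reversals balance the two forward lists. Between the odd and the
    -- even block of the lower half, `order₁` and `order₄` put 0 first, `order₂` and `order₃` put 1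
    -- first. Two of the four rows therefore agree with any g.
    outer-low : ∀ g → Candidate (top k) a → Candidate (top k) b → a ≢ b → count (outer k (agree g ∘ (a precedes b))) ≡ 2
    outer-low g ca cb a≢b with low-block k ca | low-block k cb
    ... | inj₁ a∈ | inj₁ b∈ = outer-same-block k g 0 a∈ b∈ a≢b refl refl refl refl
    ... | inj₂ a∈ | inj₂ b∈ = outer-same-block k g 1 a∈ b∈ a≢b refl refl refl refl
    -- The case distinction on g lets the count of four closed bits evaluate to 2.
    outer-low true  ca cb a≢b | inj₁ a∈ | inj₂ b∈ = count-outer-blocks k true 0 1 a∈ b∈ (λ ()) refl refl
    outer-low false ca cb a≢b | inj₁ a∈ | inj₂ b∈ = count-outer-blocks k false 0 1 a∈ b∈ (λ ()) refl refl
    outer-low true  ca cb a≢b | inj₂ a∈ | inj₁ b∈ = count-outer-blocks k true 1 0 a∈ b∈ (λ ()) refl refl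
    outer-low false ca cb a≢b | inj₂ a∈ | inj₁ b∈ = count-outer-blocks k false 1 0 a∈ b∈ (λ ()) refl refl

    outer-high : ∀ g → Candidate (top k) a → Candidate (top k) b → a + top k ≢ b + top k →
      count (outer k (agree g ∘ ((a + top k) precedes (b + top k)))) ≡ 2
    outer-high g ca cb a≢b with high-block k ca | high-block k cb
    ... | inj₁ a∈ | inj₁ b∈ = outer-same-block k g 2 a∈ b∈ a≢b refl refl refl refl
    ... | inj₂ a∈ | inj₂ b∈ = outer-same-block k g 3 a∈ b∈ a≢b refl refl refl refl
    outer-high true  ca cb a≢b | inj₁ a∈ | inj₂ b∈ = count-outer-blocks k true 2 3 a∈ b∈ (λ ()) refl refl
    outer-high false ca cb a≢b | inj₁ a∈ | inj₂ b∈ = count-outer-blocks k false 2 3 a∈ b∈ (λ ()) refl refl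
    outer-high true  ca cb a≢b | inj₂ a∈ | inj₁ b∈ = count-outer-blocks k true 3 2 a∈ b∈ (λ ()) refl refl
    outer-high false ca cb a≢b | inj₂ a∈ | inj₁ b∈ = count-outer-blocks k false 3 2 a∈ b∈ (λ ()) refl refl

    -- The four orders are arranged so that exactly one violates the parity rule for each pair of a
    -- low and a high block: blocks of equal parity have the low one first three times, blocks of
    -- different parity the high one first three times.
    outer-low-high : Candidate (top k) a → Candidate (top k) b →
      count (outer k (agree (even (a + (b + top k))) ∘ (a precedes (b + top k)))) ≡ 3
    outer-low-high ca cb with low-block k ca | high-block k cb
    ... | inj₁ a∈ | inj₁ b∈ = count-outer-blocks k _ 0 2 a∈ b∈ (λ ()) (even-blocks k 0 2 a∈ b∈) refl
    ... | inj₁ a∈ | inj₂ b∈ = count-outer-blocks k _ 0 3 a∈ b∈ (λ ()) (even-blocks k 0 3 a∈ b∈) refl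
    ... | inj₂ a∈ | inj₁ b∈ = count-outer-blocks k _ 1 2 a∈ b∈ (λ ()) (even-blocks k 1 2 a∈ b∈) refl
    ... | inj₂ a∈ | inj₂ b∈ = count-outer-blocks k _ 1 3 a∈ b∈ (λ ()) (even-blocks k 1 3 a∈ b∈) refl

    outer-high-low : Candidate (top k) a → Candidate (top k) b →
      count (outer k (agree (not (even (a + top k + b))) ∘ ((a + top k) precedes b))) ≡ 3
    outer-high-low ca cb with high-block k ca | low-block k cb
    ... | inj₁ a∈ | inj₁ b∈ = count-outer-blocks k _ 2 0 a∈ b∈ (λ ()) (cong not (even-blocks k 2 0 a∈ b∈)) refl
    ... | inj₁ a∈ | inj₂ b∈ = count-outer-blocks k _ 2 1 a∈ b∈ (λ ()) (cong not (even-blocks k 2 1 a∈ b∈)) refl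
    ... | inj₂ a∈ | inj₁ b∈ = count-outer-blocks k _ 3 0 a∈ b∈ (λ ()) (cong not (even-blocks k 3 0 a∈ b∈)) refl
    ... | inj₂ a∈ | inj₂ b∈ = count-outer-blocks k _ 3 1 a∈ b∈ (λ ()) (cong not (even-blocks k 3 1 a∈ b∈)) refl

  top≡ : ∀ k → top k ≡ 2 ^ k * 8
  top≡ k = trans (ℕ.^-distribˡ-+-* 2 3 k) (ℕ.*-comm 8 (2 ^ k))

  class-low : ∀ k {x} → Candidate (top k) x → class x < 2 ^ k
  class-low k {suc x} (_ , x≤) = DivMod.m<n*o⇒m/o<n {x} {2 ^ k} {8} (subst (suc x ≤_) (top≡ k) x≤)

  class-shift : ∀ k x → 1 ≤ x → class (x + top k) ≡ class x + 2 ^ k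
  class-shift k (suc x) _ rewrite top≡ k = trans (DivMod.+-distrib-/-∣ʳ x {2 ^ k * 8} {8} (n∣m*n (2 ^ k)))
    (cong (class (suc x) +_) (DivMod.m*n/n≡m (2 ^ k) 8))

  position-shift : ∀ k x → 1 ≤ x → position (x + top k) ≡ position x
  position-shift k x 1≤x = begin
    x + top k ∸ 8 * class (x + top k)            ≡⟨ cong (λ c → x + top k ∸ 8 * c) (class-shift k x 1≤x) ⟩
    x + top k ∸ 8 * (class x + 2 ^ k)            ≡⟨ cong (x + top k ∸_) (trans (ℕ.*-distribˡ-+ 8 (class x) (2 ^ k))
                                                      (cong (8 * class x +_) (sym (ℕ.^-distribˡ-+-* 2 3 k)))) ⟩
    x + top k ∸ (8 * class x + top k)            ≡⟨ cong₂ _∸_ (ℕ.+-comm x (top k)) (ℕ.+-comm (8 * class x) (top k)) ⟩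
    top k + x ∸ (top k + 8 * class x)            ≡⟨ ℕ.[m+n]∸[m+o]≡n∸o (top k) x (8 * class x) ⟩
    x ∸ 8 * class x                              ∎
    where open ≡-Reasoning

  <ᵇ-+ʳ : ∀ m n o → (m + o <ᵇ n + o) ≡ (m <ᵇ n)
  <ᵇ-+ʳ m n o rewrite ℕ.+-comm m o | ℕ.+-comm n o = go o
    where
    go : ∀ o → (o + m <ᵇ o + n) ≡ (m <ᵇ n)
    go zero    = refl
    go (suc o) = go o

  -- From the second level on, the formula for the graph does not mention its level. Only the first
  -- level needs an argument: all of 1, ..., 8 lie in class 0, where positions are the candidates
  -- themselves.
  graph-low : ∀ k {a b} → Candidate (top k) a → Candidate (top k) b → graph (suc k) a b ≡ graph k a b
  graph-low (suc k) ca cb = refl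
  graph-low zero {a} {b} ca cb rewrite ℕ.n<1⇒n≡0 (class-low 0 {a} ca) | ℕ.n<1⇒n≡0 (class-low 0 {b} cb) = refl

  parity-shift : ∀ k a b → even (a + top k + (b + top k)) ≡ even (a + b)
  parity-shift k a b = trans (cong even (begin
    a + top k + (b + top k)                            ≡⟨ ℕ.+-assoc a (top k) (b + top k) ⟩
    a + (top k + (b + top k))                          ≡⟨ cong (a +_) (ℕ.+-comm (top k) (b + top k)) ⟩
    a + (b + top k + top k)                            ≡⟨ cong (a +_) (ℕ.+-assoc b (top k) (top k)) ⟩
    a + (b + (top k + top k))                          ≡⟨ ℕ.+-assoc a b _ ⟨
    a + b + (top k + top k)                            ≡⟨ ℕ.+-comm (a + b) _ ⟩
    top k + top k + (a + b)                            ≡⟨ cong (λ m → top k + m + (a + b)) (ℕ.+-identityʳ (top k)) ⟨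
    2 * top k + (a + b)                                ∎)) (even-double+ (top k) (a + b))
    where open ≡-Reasoning

  -- With n = 3 + k, a shift by 2ⁿ adds 2^(n - 3) to both classes and changes neither the positions,
  -- nor the order of the two candidates, nor the parity of their sum. `arc` collects these
  -- ingredients so that they can be replaced together.
  graph-high : ∀ k {a b} → Candidate (top k) a → Candidate (top k) b → graph (suc k) (a + top k) (b + top k) ≡ graph k a b
  graph-high k {a} {b} ca@(1≤a , _) cb@(1≤b , _) = trans (arc-cong
      (trans (cong₂ _≡ᵇ_ (class-shift k a 1≤a) (class-shift k b 1≤b)) (≡ᵇ-+ʳ (class a) (class b) (2 ^ k)))
      (position-shift k a 1≤a) (position-shift k b 1≤b) (<ᵇ-+ʳ a b (top k)) (parity-shift k a b))
    (graph-low k ca cb)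
    where
    arc : Bool → ℕ → ℕ → Bool → Bool → Bool
    arc same i j less ev = if same then G₃ i j else if less then ev else not ev
    arc-cong : ∀ {s s′ i i′ j j′ l l′ e e′} → s ≡ s′ → i ≡ i′ → j ≡ j′ → l ≡ l′ → e ≡ e′ →
               arc s i j l e ≡ arc s′ i′ j′ l′ e′
    arc-cong refl refl refl refl refl = refl

  class-≢ : ∀ k {a b} → Candidate (top k) a → Candidate (top k) b → class a ≢ class (b + top k)
  class-≢ k {a} {b} ca (1≤b , _) eq = ℕ.<⇒≱ (class-low k ca) (ℕ.≤-trans (ℕ.m≤n+m (2 ^ k) (class b))
    (ℕ.≤-reflexive (sym (trans eq (class-shift k b 1≤b)))))

  graph-low-high : ∀ k {a b} → Candidate (top k) a → Candidate (top k) b → graph (suc k) a (b + top k) ≡ even (a + (b + top k))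
  graph-low-high k {a} {b} ca@(_ , a≤) cb@(1≤b , _) rewrite ≢⇒≡ᵇ (class-≢ k ca cb)
    | T⇒true (ℕ.<⇒<ᵇ (ℕ.≤-<-trans a≤ (ℕ.m<n+m (top k) 1≤b))) = refl

  ≮⇒<ᵇ : ∀ {m n} → ¬ (m < n) → (m <ᵇ n) ≡ false
  ≮⇒<ᵇ {m} {n} m≮n with m <ᵇ n in eq
  ... | true  = contradiction (ℕ.<ᵇ⇒< m n (subst T (sym eq) _)) m≮n
  ... | false = refl

  graph-high-low : ∀ k {a b} → Candidate (top k) a → Candidate (top k) b → graph (suc k) (a + top k) b ≡ not (even (a + top k + b))
  graph-high-low k {a} {b} ca@(1≤a , _) cb@(_ , b≤) rewrite ≢⇒≡ᵇ (class-≢ k cb ca ∘ sym)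
    | ≮⇒<ᵇ (ℕ.<⇒≯ (ℕ.≤-<-trans b≤ (ℕ.m<n+m (top k) 1≤a))) = refl

  G₃-irrefl : ∀ i → G₃ i i ≡ false
  G₃-irrefl 0 = refl
  G₃-irrefl 1 = refl
  G₃-irrefl 2 = refl
  G₃-irrefl 3 = refl
  G₃-irrefl 4 = refl
  G₃-irrefl 5 = refl
  G₃-irrefl 6 = refl
  G₃-irrefl 7 = refl
  G₃-irrefl 8 = refl
  G₃-irrefl (suc (suc (suc (suc (suc (suc (suc (suc (suc _))))))))) = refl

  graph-irrefl : ∀ k i → graph k i i ≡ false
  graph-irrefl zero    i = G₃-irrefl i
  graph-irrefl (suc k) i rewrite ≡ᵇ-refl (class i) = G₃-irrefl (position i)

  count-if : ∀ {m} → (Row → Bool) → Vec Row m → ℕ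
  count-if f R = count (Vec.map f R)

  -- `_⋈_` exchanges its arguments at every step, so the induction exchanges the two predicates and
  -- the two ways of concatenating.
  ⋈-All : ∀ {m} {P Q X : Row → Set} → (∀ {r s} → P r → Q s → X (r ++ s)) → (∀ {r s} → P r → Q s → X (s ++ r)) →
          {R S : Vec Row m} → All P R → All Q S → All X (R ⋈ S)
  ⋈-All rs sr []      []      = []
  ⋈-All rs sr (p ∷ P) (q ∷ Q) = rs p q ∷ ⋈-All (λ q p → sr p q) (λ q p → rs p q) Q P

  module _ {P Q : Row → Set} (f : Row → Bool) where

    module _ (g : Row → Bool) where

      mutual
        -- For a pair within one half: f sees only the part of the row that lists this half, on
        -- whichever side of the concatenation it stands. The mutual partner covers the exchanged
        -- arguments of the recursive call.
        ⋈-countˡ : (∀ {r s} → P r → Q s → f (r ++ s) ≡ g r) → (∀ {r s} → P r → Q s → f (s ++ r) ≡ g r) →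
                   ∀ {m} {R S : Vec Row m} → All P R → All Q S → count-if f (R ⋈ S) ≡ count-if g R
        ⋈-countˡ rs sr []      []      = refl
        ⋈-countˡ rs sr (p ∷ P) (q ∷ Q) = cong₂ (λ b c → (if b then 1 else 0) + c) (rs p q) (⋈-countʳ rs sr P Q)

        ⋈-countʳ : (∀ {r s} → P r → Q s → f (r ++ s) ≡ g r) → (∀ {r s} → P r → Q s → f (s ++ r) ≡ g r) →
                    ∀ {m} {R S : Vec Row m} → All P R → All Q S → count-if f (S ⋈ R) ≡ count-if g R
        ⋈-countʳ rs sr []      []      = refl
        ⋈-countʳ rs sr (p ∷ P) (q ∷ Q) = cong₂ (λ b c → (if b then 1 else 0) + c) (sr p q) (⋈-countˡ rs sr P Q)

    mutual
      -- For a pair across the halves: f holds exactly when the P part comes first, which happens in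
      -- every other row, beginning with the first.
      ⋈-count-⌈⌉ : (∀ {r s} → P r → Q s → f (r ++ s) ≡ true) → (∀ {r s} → P r → Q s → f (s ++ r) ≡ false) →
                   ∀ {m} {R S : Vec Row m} → All P R → All Q S → count-if f (R ⋈ S) ≡ ⌈ m /2⌉
      ⋈-count-⌈⌉ rs sr []      []      = refl
      ⋈-count-⌈⌉ rs sr (p ∷ P) (q ∷ Q) = cong₂ (λ b c → (if b then 1 else 0) + c) (rs p q) (⋈-count-⌊⌋ rs sr P Q)

      ⋈-count-⌊⌋ : (∀ {r s} → P r → Q s → f (r ++ s) ≡ true) → (∀ {r s} → P r → Q s → f (s ++ r) ≡ false) →
                   ∀ {m} {R S : Vec Row m} → All P R → All Q S → count-if f (S ⋈ R) ≡ ⌊ m /2⌋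
      ⋈-count-⌊⌋ rs sr []      []      = refl
      ⋈-count-⌊⌋ rs sr (p ∷ P) (q ∷ Q) = cong₂ (λ b c → (if b then 1 else 0) + c) (sr p q) (⋈-count-⌈⌉ rs sr P Q)

  count-rows : ∀ k f → count-if f (rows (suc k)) ≡ count (outer k f) + count-if f (rows k ⋈ (rows k +·𝟏 top k))
  count-rows k f = assoc (ind (f (v₁ (4 + k)))) (ind (f (v₂ (4 + k)))) (ind (f (v₃ (4 + k)))) (ind (f (v₄ (4 + k))))
    (count-if f (rows k ⋈ (rows k +·𝟏 top k)))
    where
    ind : Bool → ℕ
    ind b = if b then 1 else 0
    assoc : ∀ a b c d e → a + (b + (c + (d + e))) ≡ a + (b + (c + (d + 0))) + e
    assoc = solve-∀

  -- The first component shows that a candidate of one half is absent from the rows of the other,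
  -- the second that it is present in the rows of its own; the concatenation lemmas ask for these
  -- two facts.
  Lists Shifted : ℕ → Row → Set
  Lists   M r = (∀ {x} → x ∈ r → Candidate M x) × (∀ {x} → Candidate M x → x ∈ r)
  Shifted M s = (∀ {x} → x ∈ s → ∃ λ y → Candidate M y × x ≡ y + M) × (∀ {y} → Candidate M y → y + M ∈ s)

  candidate-∈ : ∀ {M x} → Candidate M x → x ∈ candidates M
  candidate-∈ {x = suc x} (_ , x<M) = ∈-map⁺ suc (∈-upTo⁺ x<M)

  ∈-candidate : ∀ {M x} → x ∈ candidates M → Candidate M x
  ∈-candidate x∈ with ∈-map⁻ suc x∈
  ... | y , y∈ , refl = s≤s z≤n , ∈-upTo⁻ y∈

  R₃-lists : All (Lists 8) R₃
  R₃-lists = All.map (λ {r} → listed r)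
    (from-yes (All.all? (λ r → ListAll.all? (λ x → (1 ℕ.≤? x) ×-dec (x ℕ.≤? 8)) r ×-dec ListAll.all? (_∈? r) (candidates 8)) R₃))
    where
    listed : ∀ r → ListAll (Candidate 8) r × ListAll (_∈ r) (candidates 8) → Lists 8 r
    listed r (⊆ , ⊇) = (λ x∈ → ListAll.lookup ⊆ x∈) , λ c → ListAll.lookup ⊇ (candidate-∈ c)

  Shifted-map : ∀ {M m} {R : Vec Row m} → All (Lists M) R → All (Shifted M) (R +·𝟏 M)
  Shifted-map []                = []
  Shifted-map {M} ((⊆ , ⊇) ∷ R) =
    ((λ x∈ → case ∈-map⁻ (_+ M) x∈ of λ where (y , y∈ , refl) → y , ⊆ y∈ , refl) , ∈-map⁺ (_+ M) ∘ ⊇) ∷ Shifted-map R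

  low-∉-Shifted : ∀ {M s x} → Shifted M s → Candidate M x → x ∉ s
  low-∉-Shifted {M} (⊆ , _) (_ , x≤M) x∈ with ⊆ x∈
  ... | y , (1≤y , _) , refl = ℕ.<⇒≱ (ℕ.m<n+m M 1≤y) x≤M

  high-∉-Lists : ∀ {M r y} → Lists M r → Candidate M y → y + M ∉ r
  high-∉-Lists {M} (⊆ , _) (1≤y , _) y∈ = ℕ.<⇒≱ (ℕ.m<n+m M 1≤y) (proj₂ (⊆ y∈))

  -- B is either `block k` or its reversal, so one proof serves all four new rows.
  blocks-lists : ∀ k (B : ℕ → Row) → (∀ l {x} → x ∈ block k l → x ∈ B l) → (∀ l {x} → x ∈ B l → x ∈ block k l) →
                 ∀ a b c d → 0 ∈ a ∷ b ∷ c ∷ d ∷ [] → 1 ∈ a ∷ b ∷ c ∷ d ∷ [] → 2 ∈ a ∷ b ∷ c ∷ d ∷ [] → 3 ∈ a ∷ b ∷ c ∷ d ∷ [] →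
                 Lists (top (suc k)) (B a ++ B b ++ B c ++ B d)
  blocks-lists k B from to a b c d 0∈ 1∈ 2∈ 3∈ rewrite concat-4 (B a) (B b) (B c) (B d) = sound , complete
    where
    ls : List ℕ
    ls = a ∷ b ∷ c ∷ d ∷ []
    sound : ∀ {x} → x ∈ concat (map B ls) → Candidate (top (suc k)) x
    sound x∈ with ∈-concat⁻′ (map B ls) x∈
    ... | _ , x∈B , B∈ with ∈-map⁻ B B∈
    ... | l , _ , refl = block-candidate k l (to l x∈B)
    put : ∀ l {x} → l ∈ ls → x ∈ block k l → x ∈ concat (map B ls)
    put l l∈ x∈ = ∈-concat⁺′ (from l x∈) (∈-map⁺ B l∈)
    complete : ∀ {x} → Candidate (top (suc k)) x → x ∈ concat (map B ls)
    complete c with split k c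
    ... | inj₁ low = Sum.[ put 0 0∈ , put 1 1∈ ] (low-block k low)
    ... | inj₂ (_ , high , refl) = Sum.[ put 2 2∈ , put 3 3∈ ] (high-block k high)

  rows-list : ∀ k → All (Lists (top k)) (rows k)
  rows-list zero    = R₃-lists
  rows-list (suc k) =
    forward 0 2 1 3 (here refl) (there (there (here refl))) (there (here refl)) (there (there (there (here refl)))) ∷
    backward 1 3 0 2 (there (there (here refl))) (here refl) (there (there (there (here refl)))) (there (here refl)) ∷
    forward 2 1 3 0 (there (there (there (here refl)))) (there (here refl)) (here refl) (there (there (here refl))) ∷
    backward 3 0 2 1 (there (here refl)) (there (there (there (here refl)))) (there (there (here refl))) (here refl) ∷
    ⋈-All (λ {r} {s} → low++high {r} {s}) (λ {r} {s} → high++low {r} {s}) (rows-list k) (Shifted-map (rows-list k))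
    where
    forward = blocks-lists k (block k) (λ _ x∈ → x∈) (λ _ x∈ → x∈)
    backward = blocks-lists k (reverse ∘ block k) (λ _ → Any.reverse⁺) (λ _ → Any.reverse⁻)
    low++high : ∀ {r s} → Lists (top k) r → Shifted (top k) s → Lists (top (suc k)) (r ++ s)
    low++high {r} {s} (r⊆ , r⊇) (s⊆ , s⊇) =
      (λ x∈ → case ∈-++⁻ r x∈ of λ where
        (inj₁ x∈r) → low-candidate k (r⊆ x∈r)
        (inj₂ x∈s) → case s⊆ x∈s of λ where (_ , c , refl) → high-candidate k c) ,
      λ c → case split k c of λ where
        (inj₁ low)              → ∈-++⁺ˡ (r⊇ low)
        (inj₂ (_ , high , refl)) → ∈-++⁺ʳ r (s⊇ high)
    high++low : ∀ {r s} → Lists (top k) r → Shifted (top k) s → Lists (top (suc k)) (s ++ r)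
    high++low {r} {s} L S =
      (λ x∈ → proj₁ (low++high {r} {s} L S) (Sum.[ ∈-++⁺ʳ r , ∈-++⁺ˡ ] (∈-++⁻ s x∈))) ,
      λ c → Sum.[ ∈-++⁺ʳ s , ∈-++⁺ˡ ] (∈-++⁻ r (proj₂ (low++high {r} {s} L S) c))

  count-if-shift : ∀ g a b M {m} (R : Vec Row m) →
    count-if (agree g ∘ ((a + M) precedes (b + M))) (R +·𝟏 M) ≡ count-if (agree g ∘ (a precedes b)) R
  count-if-shift g a b M []      = refl
  count-if-shift g a b M (r ∷ R) =
    cong₂ (λ p c → (if agree g p then 1 else 0) + c) (precedes-shift a b M r) (count-if-shift g a b M R)

  ⌊size/2⌋ : ∀ k → ⌊ size k /2⌋ ≡ 5 + k * 2
  ⌊size/2⌋ zero    = refl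
  ⌊size/2⌋ (suc k) = cong (2 +_) (⌊size/2⌋ k)

  ⌈size/2⌉ : ∀ k → ⌈ size k /2⌉ ≡ 5 + k * 2
  ⌈size/2⌉ zero    = refl
  ⌈size/2⌉ (suc k) = cong (2 +_) (⌈size/2⌉ k)

  -- The size 10 + 4k is even, so it does not matter whether the favourable order stands in the odd
  -- or in the even rows: both ways exactly half of them count.
  count-alternating : ∀ k (f : Row → Bool) p →
    (∀ {r s} → Lists (top k) r → Shifted (top k) s → f (r ++ s) ≡ p) →
    (∀ {r s} → Lists (top k) r → Shifted (top k) s → f (s ++ r) ≡ not p) →
    count-if f (rows k ⋈ (rows k +·𝟏 top k)) ≡ 5 + k * 2
  count-alternating k f true  rs sr = trans
    (⋈-count-⌈⌉ f (λ {r} {s} → rs {r} {s}) (λ {r} {s} → sr {r} {s}) (rows-list k) (Shifted-map (rows-list k))) (⌈size/2⌉ k)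
  count-alternating k f false rs sr = trans
    (⋈-count-⌊⌋ f (λ {r} {s} S L → sr {s} {r} L S) (λ {r} {s} S L → rs {s} {r} L S) (Shifted-map (rows-list k)) (rows-list k)) (⌊size/2⌋ k)

  agreement : ∀ k a b → Vec Bool (size k)
  agreement k a b = Vec.map (agree (graph k a b) ∘ (a precedes b)) (rows k)

  agree-not : ∀ g p → agree g (not p) ≡ not (agree g p)
  agree-not true  p = refl
  agree-not false p = refl

  -- Passing from n - 1 to n must add 2. Within a half, the new rows contribute 2 and the old count
  -- 2(n - 1) survives. Across the halves there is no old count: the new rows contribute 3 and the
  -- alternation gives half of 4(n - 1) - 2, that is 2n - 3.
  count-agreement : ∀ k {a b} → Candidate (top k) a → Candidate (top k) b → a ≢ b → count (agreement k a b) ≡ 2 * (3 + k)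
  count-agreement zero ca cb a≢b = ListAll.lookup (ListAll.lookup pairwise (candidate-∈ ca)) (candidate-∈ cb) a≢b
    where
    pairwise : ListAll (λ a → ListAll (λ b → a ≢ b → count (agreement 0 a b) ≡ 6) (candidates 8)) (candidates 8)
    -- The base case n = 3 is decided by evaluating all pairs on the ten rows of `R₃`.
    pairwise = from-yes (ListAll.all? (λ a → ListAll.all? (λ b → ¬? (a ℕ.≟ b) →-dec (count (agreement 0 a b) ℕ.≟ 6)) (candidates 8)) (candidates 8))
  count-agreement (suc k) {a} {b} ca cb a≢b with split k ca | split k cb
  ... | inj₁ la | inj₁ lb = begin
    count (agreement (suc k) a b)
      ≡⟨ cong (λ g → count-if (agree g ∘ (a precedes b)) (rows (suc k))) (graph-low k la lb) ⟩
    count-if f (rows (suc k))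
      ≡⟨ count-rows k f ⟩
    count (outer k f) + count-if f (rows k ⋈ (rows k +·𝟏 top k))
      ≡⟨ cong₂ _+_ (outer-low k (graph k a b) la lb a≢b)
           (⋈-countˡ f f (λ {r} {s} L S → cong (agree (graph k a b)) (precedes-++-∉ʳ r (low-∉-Shifted S lb)))
                         (λ {r} {s} L S → cong (agree (graph k a b)) (precedes-++-∉ˡ r (low-∉-Shifted S la)))
                         (rows-list k) (Shifted-map (rows-list k))) ⟩
    2 + count (agreement k a b)
      ≡⟨ cong (2 +_) (count-agreement k la lb a≢b) ⟩
    2 + 2 * (3 + k)
      ≡⟨ ℕ.*-suc 2 (3 + k) ⟨
    2 * (4 + k) ∎
    where
    open ≡-Reasoning
    f : Row → Bool
    f = agree (graph k a b) ∘ (a precedes b)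
  ... | inj₂ (a′ , ha , refl) | inj₂ (b′ , hb , refl) = begin
    count (agreement (suc k) a b)
      ≡⟨ cong (λ g → count-if (agree g ∘ (a precedes b)) (rows (suc k))) (graph-high k ha hb) ⟩
    count-if f (rows (suc k))
      ≡⟨ count-rows k f ⟩
    count (outer k f) + count-if f (rows k ⋈ (rows k +·𝟏 top k))
      ≡⟨ cong₂ _+_ (outer-high k (graph k a′ b′) ha hb a≢b)
           (⋈-countʳ f f (λ {r} {s} S L → cong (agree (graph k a′ b′)) (precedes-++-∉ʳ r (high-∉-Lists L hb)))
                         (λ {r} {s} S L → cong (agree (graph k a′ b′)) (precedes-++-∉ˡ r (high-∉-Lists L ha)))
                         (Shifted-map (rows-list k)) (rows-list k)) ⟩
    2 + count-if f (rows k +·𝟏 top k)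
      ≡⟨ cong (2 +_) (count-if-shift (graph k a′ b′) a′ b′ (top k) (rows k)) ⟩
    2 + count (agreement k a′ b′)
      ≡⟨ cong (2 +_) (count-agreement k ha hb (a≢b ∘ cong (_+ top k))) ⟩
    2 + 2 * (3 + k)
      ≡⟨ ℕ.*-suc 2 (3 + k) ⟨
    2 * (4 + k) ∎
    where
    open ≡-Reasoning
    f : Row → Bool
    f = agree (graph k a′ b′) ∘ (a precedes b)
  ... | inj₁ la | inj₂ (b′ , hb , refl) = begin
    count (agreement (suc k) a b)
      ≡⟨ cong (λ g → count-if (agree g ∘ (a precedes b)) (rows (suc k))) (graph-low-high k la hb) ⟩
    count-if f (rows (suc k))
      ≡⟨ count-rows k f ⟩
    count (outer k f) + count-if f (rows k ⋈ (rows k +·𝟏 top k))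
      ≡⟨ cong₂ _+_ (outer-low-high k la hb) (count-alternating k f (agree g true)
           (λ {r} {s} L S → cong (agree g) (trans (precedes-++-∈ s (proj₂ L la) (high-∉-Lists L hb)) (any-∈ (proj₂ S hb))))
           (λ {r} {s} L S → trans (cong (agree g) (trans (precedes-++-∉ˡ r (low-∉-Shifted S la)) (precedes-∉ʳ (high-∉-Lists L hb))))
                                  (agree-not g true))) ⟩
    -- 3 + (5 + k * 2) is this number by computation.
    (4 + k) * 2
      ≡⟨ ℕ.*-comm (4 + k) 2 ⟩
    2 * (4 + k) ∎
    where
    open ≡-Reasoning
    g : Bool
    g = even (a + b)
    f : Row → Bool
    f = agree g ∘ (a precedes b)
  ... | inj₂ (a′ , ha , refl) | inj₁ lb = begin
    count (agreement (suc k) a b)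
      ≡⟨ cong (λ g → count-if (agree g ∘ (a precedes b)) (rows (suc k))) (graph-high-low k ha lb) ⟩
    count-if f (rows (suc k))
      ≡⟨ count-rows k f ⟩
    count (outer k f) + count-if f (rows k ⋈ (rows k +·𝟏 top k))
      ≡⟨ cong₂ _+_ (outer-high-low k ha lb) (count-alternating k f (agree g false)
           (λ {r} {s} L S → cong (agree g) (trans (precedes-++-∉ˡ s (high-∉-Lists L ha)) (precedes-∉ʳ (low-∉-Shifted S lb))))
           (λ {r} {s} L S → trans (cong (agree g) (trans (precedes-++-∈ r (proj₂ S ha) (low-∉-Shifted S lb)) (any-∈ (proj₂ L lb))))
                                  (agree-not g false))) ⟩
    (4 + k) * 2
      ≡⟨ ℕ.*-comm (4 + k) 2 ⟩
    2 * (4 + k) ∎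
    where
    open ≡-Reasoning
    g : Bool
    g = not (even (a + b))
    f : Row → Bool
    f = agree g ∘ (a precedes b)

-- Rational partial sums of the exponential series and the error in their addition formula.

module RationalExp where

  open import Data.Nat.Base as ℕ using (ℕ; zero; suc; s≤s)
  import Data.Nat.Properties as ℕ
  open import Data.Rational.Base as ℚ using (ℚ; 0ℚ; 1ℚ; _+_; _*_; _-_; -_; ∣_∣; _≤_; _<_)
  import Data.Rational.Properties as ℚ
  open import Function.Base using (_∘_)
  open import Relation.Binary.PropositionalEquality
  open import Tactic.RingSolver using (solve-∀)
  open import Defs using (module E)
  open E using (Σ<; expTerm; fromℕ; 1/ℕ; ring)

  Σ<-cong : ∀ N {f g : ℕ → ℚ} → (∀ i → i ℕ.< N → f i ≡ g i) → Σ< N f ≡ Σ< N g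
  Σ<-cong zero    f≡g = refl
  Σ<-cong (suc N) f≡g = cong₂ _+_ (Σ<-cong N λ i i<N → f≡g i (ℕ.m<n⇒m<1+n i<N)) (f≡g N ℕ.≤-refl)

  Σ<-mono : ∀ N {f g : ℕ → ℚ} → (∀ i → i ℕ.< N → f i ≤ g i) → Σ< N f ≤ Σ< N g
  Σ<-mono zero    f≤g = ℚ.≤-refl
  Σ<-mono (suc N) f≤g = ℚ.+-mono-≤ (Σ<-mono N λ i i<N → f≤g i (ℕ.m<n⇒m<1+n i<N)) (f≤g N ℕ.≤-refl)

  Σ<-+ : ∀ N f g → Σ< N (λ i → f i + g i) ≡ Σ< N f + Σ< N g
  Σ<-+ zero    f g = refl
  Σ<-+ (suc N) f g = trans (cong (_+ (f N + g N)) (Σ<-+ N f g)) (eq (Σ< N f) (Σ< N g) (f N) (g N))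
    where
    eq : ∀ a b c d → a + b + (c + d) ≡ a + c + (b + d)
    eq = solve-∀ ring

  Σ<-*ʳ : ∀ N f c → Σ< N (λ i → f i * c) ≡ Σ< N f * c
  Σ<-*ʳ zero    f c = sym (ℚ.*-zeroˡ c)
  Σ<-*ʳ (suc N) f c = trans (cong (_+ f N * c) (Σ<-*ʳ N f c)) (sym (ℚ.*-distribʳ-+ c (Σ< N f) (f N)))

  Σ<-0 : ∀ N → Σ< N (λ _ → 0ℚ) ≡ 0ℚ
  Σ<-0 zero    = refl
  Σ<-0 (suc N) = trans (cong (_+ 0ℚ) (Σ<-0 N)) (ℚ.+-identityʳ 0ℚ)

  Σ<-front : ∀ N f → Σ< (suc N) f ≡ f 0 + Σ< N (f ∘ suc)
  Σ<-front zero    f = trans (ℚ.+-identityˡ (f 0)) (sym (ℚ.+-identityʳ (f 0)))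
  Σ<-front (suc N) f = trans (cong (_+ f (suc N)) (Σ<-front N f)) (ℚ.+-assoc (f 0) _ _)

  Σ<-nonneg : ∀ N {f} → (∀ i → 0ℚ ≤ f i) → 0ℚ ≤ Σ< N f
  Σ<-nonneg zero    0≤f = ℚ.≤-refl
  Σ<-nonneg (suc N) 0≤f = E.0≤+ (Σ<-nonneg N 0≤f) (0≤f N)

  fromℕ-+ : ∀ m n → fromℕ (m ℕ.+ n) ≡ fromℕ m + fromℕ n
  fromℕ-+ zero    n = trans (sym (ℚ.+-identityˡ (fromℕ n))) (cong (_+ fromℕ n) (sym E.fromℕ-0))
  fromℕ-+ (suc m) n = begin
    fromℕ (suc (m ℕ.+ n))        ≡⟨ E.fromℕ-suc (m ℕ.+ n) ⟩
    fromℕ (m ℕ.+ n) + 1ℚ         ≡⟨ cong (_+ 1ℚ) (fromℕ-+ m n) ⟩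
    fromℕ m + fromℕ n + 1ℚ       ≡⟨ eq (fromℕ m) (fromℕ n) 1ℚ ⟩
    fromℕ m + 1ℚ + fromℕ n       ≡⟨ cong (_+ fromℕ n) (E.fromℕ-suc m) ⟨
    fromℕ (suc m) + fromℕ n      ∎
    where
    open ≡-Reasoning
    eq : ∀ a b c → a + b + c ≡ a + c + b
    eq = solve-∀ ring

  fromℕ-* : ∀ m n → fromℕ (m ℕ.* n) ≡ fromℕ m * fromℕ n
  fromℕ-* zero    n = trans E.fromℕ-0 (sym (trans (cong (_* fromℕ n) E.fromℕ-0) (ℚ.*-zeroˡ (fromℕ n))))
  fromℕ-* (suc m) n = begin
    fromℕ (n ℕ.+ m ℕ.* n)            ≡⟨ fromℕ-+ n (m ℕ.* n) ⟩
    fromℕ n + fromℕ (m ℕ.* n)        ≡⟨ cong (fromℕ n +_) (fromℕ-* m n) ⟩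
    fromℕ n + fromℕ m * fromℕ n      ≡⟨ cong (_+ fromℕ m * fromℕ n) (ℚ.*-identityˡ (fromℕ n)) ⟨
    1ℚ * fromℕ n + fromℕ m * fromℕ n ≡⟨ eq (fromℕ m) (fromℕ n) 1ℚ ⟩
    (fromℕ m + 1ℚ) * fromℕ n         ≡⟨ cong (_* fromℕ n) (E.fromℕ-suc m) ⟨
    fromℕ (suc m) * fromℕ n          ∎
    where
    open ≡-Reasoning
    eq : ∀ a b c → c * b + a * b ≡ (a + c) * b
    eq = solve-∀ ring

  fromℕ-suc-cancelˡ : ∀ k {p q} → fromℕ (suc k) * p ≡ fromℕ (suc k) * q → p ≡ q
  fromℕ-suc-cancelˡ k {p} {q} eq = trans (sym (undo p)) (trans (cong (1/ℕ (suc k) *_) eq) (undo q))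
    where
    undo : ∀ p → 1/ℕ (suc k) * (fromℕ (suc k) * p) ≡ p
    undo p = begin
      1/ℕ (suc k) * (fromℕ (suc k) * p)  ≡⟨ rearrange (1/ℕ (suc k)) (fromℕ (suc k)) p ⟩
      fromℕ (suc k) * 1/ℕ (suc k) * p    ≡⟨ cong (_* p) (E.fromℕ*1/ℕ k) ⟩
      1ℚ * p                             ≡⟨ ℚ.*-identityˡ p ⟩
      p                                  ∎
      where
      open ≡-Reasoning
      rearrange : ∀ a b c → a * (b * c) ≡ b * a * c
      rearrange = solve-∀ ring

  expTerm-0 : ∀ q → expTerm q 0 ≡ 1ℚ
  expTerm-0 q = trans (cong (_* 1/ℕ 1) (sym E.fromℕ-1)) (E.fromℕ*1/ℕ 0)

  expTerm-rec : ∀ q k → fromℕ (suc k) * expTerm q (suc k) ≡ q * expTerm q k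
  expTerm-rec q k = begin
    fromℕ (suc k) * expTerm q (suc k)                  ≡⟨ cong (fromℕ (suc k) *_) (E.expTerm-suc q k) ⟩
    fromℕ (suc k) * (expTerm q k * (q * 1/ℕ (suc k)))  ≡⟨ rearrange (fromℕ (suc k)) (expTerm q k) q (1/ℕ (suc k)) ⟩
    fromℕ (suc k) * 1/ℕ (suc k) * (q * expTerm q k)    ≡⟨ cong (_* (q * expTerm q k)) (E.fromℕ*1/ℕ k) ⟩
    1ℚ * (q * expTerm q k)                             ≡⟨ ℚ.*-identityˡ _ ⟩
    q * expTerm q k                                    ∎
    where
    open ≡-Reasoning
    rearrange : ∀ a b c d → a * (b * (c * d)) ≡ a * d * (c * b)
    rearrange = solve-∀ ring

  expSum : ℕ → ℚ → ℚ
  expSum N q = Σ< N (expTerm q)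

  convolution : (ℕ → ℚ) → (ℕ → ℚ) → ℕ → ℚ
  convolution f g k = Σ< (suc k) λ i → f i * g (k ℕ.∸ i)

  -- The product rule for formal power series: i ↦ (i + 1) f(i + 1) are the coefficients of the
  -- derivative. It comes from writing k + 1 as i + (k + 1 - i) in each summand.
  convolution-leibniz : ∀ f g k → fromℕ (suc k) * convolution f g (suc k) ≡
    convolution (λ i → fromℕ (suc i) * f (suc i)) g k + convolution f (λ i → fromℕ (suc i) * g (suc i)) k
  convolution-leibniz f g k = begin
    fromℕ (suc k) * convolution f g (suc k)
      ≡⟨ E.Σ<-*ˡ (fromℕ (suc k)) (λ i → f i * g (suc k ℕ.∸ i)) (suc (suc k)) ⟨
    Σ< (suc (suc k)) (λ i → fromℕ (suc k) * (f i * g (suc k ℕ.∸ i)))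
      ≡⟨ Σ<-cong (suc (suc k)) split ⟩
    Σ< (suc (suc k)) (λ i → L i + R i)
      ≡⟨ Σ<-+ (suc (suc k)) L R ⟩
    Σ< (suc (suc k)) L + (Σ< (suc k) R + R (suc k))
      ≡⟨ cong₂ _+_ (trans (Σ<-front (suc k) L) (trans (cong (_+ Σ< (suc k) (L ∘ suc)) L0) (ℚ.+-identityˡ (Σ< (suc k) (L ∘ suc)))))
                   (trans (cong (Σ< (suc k) R +_) Rk) (ℚ.+-identityʳ (Σ< (suc k) R))) ⟩
    Σ< (suc k) (L ∘ suc) + Σ< (suc k) R
      ≡⟨ cong (Σ< (suc k) (L ∘ suc) +_) (Σ<-cong (suc k) shift) ⟩
    convolution (λ i → fromℕ (suc i) * f (suc i)) g k + convolution f (λ i → fromℕ (suc i) * g (suc i)) k ∎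
    where
    open ≡-Reasoning
    L R : ℕ → ℚ
    L i = fromℕ i * f i * g (suc k ℕ.∸ i)
    R i = f i * (fromℕ (suc k ℕ.∸ i) * g (suc k ℕ.∸ i))
    distribute : ∀ a b x y → (a + b) * (x * y) ≡ a * x * y + x * (b * y)
    distribute = solve-∀ ring
    split : ∀ i → i ℕ.< suc (suc k) → fromℕ (suc k) * (f i * g (suc k ℕ.∸ i)) ≡ L i + R i
    split i (s≤s i≤) = trans
      (cong (_* (f i * g (suc k ℕ.∸ i))) (trans (cong fromℕ (sym (ℕ.m+[n∸m]≡n i≤))) (fromℕ-+ i (suc k ℕ.∸ i))))
      (distribute (fromℕ i) (fromℕ (suc k ℕ.∸ i)) (f i) (g (suc k ℕ.∸ i)))
    L0 : L 0 ≡ 0ℚ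
    L0 = trans (cong (λ z → z * f 0 * g (suc k)) E.fromℕ-0) (trans (cong (_* g (suc k)) (ℚ.*-zeroˡ (f 0))) (ℚ.*-zeroˡ (g (suc k))))
    Rk : R (suc k) ≡ 0ℚ
    Rk = trans (cong (λ i → f (suc k) * (fromℕ i * g i)) (ℕ.n∸n≡0 k))
      (trans (cong (λ z → f (suc k) * (z * g 0)) E.fromℕ-0) (trans (cong (f (suc k) *_) (ℚ.*-zeroˡ (g 0))) (ℚ.*-zeroʳ (f (suc k)))))
    shift : ∀ i → i ℕ.< suc k → R i ≡ f i * (fromℕ (suc (k ℕ.∸ i)) * g (suc (k ℕ.∸ i)))
    shift i (s≤s i≤k) = cong (λ j → f i * (fromℕ j * g j)) (ℕ.+-∸-assoc 1 i≤k)

  -- Both sides satisfy (k + 1) c(k + 1) = (a + b) c(k) and start at 1. This differential equation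
  -- for formal series replaces the binomial theorem.
  convolution-expTerm : ∀ a b k → convolution (expTerm a) (expTerm b) k ≡ expTerm (a + b) k
  convolution-expTerm a b zero = trans (ℚ.+-identityˡ _)
    (trans (cong₂ _*_ (expTerm-0 a) (expTerm-0 b)) (sym (expTerm-0 (a + b))))
  convolution-expTerm a b (suc k) = fromℕ-suc-cancelˡ k (begin
    fromℕ (suc k) * convolution (expTerm a) (expTerm b) (suc k)
      ≡⟨ convolution-leibniz (expTerm a) (expTerm b) k ⟩
    convolution (λ i → fromℕ (suc i) * expTerm a (suc i)) (expTerm b) k +
    convolution (expTerm a) (λ i → fromℕ (suc i) * expTerm b (suc i)) k
      ≡⟨ cong₂ _+_ (trans (Σ<-cong (suc k) λ i _ → trans (cong (_* expTerm b (k ℕ.∸ i)) (expTerm-rec a i))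
                             (ℚ.*-assoc a (expTerm a i) (expTerm b (k ℕ.∸ i))))
                           (E.Σ<-*ˡ a (λ i → expTerm a i * expTerm b (k ℕ.∸ i)) (suc k)))
                   (trans (Σ<-cong (suc k) λ i _ → trans (cong (expTerm a i *_) (expTerm-rec b (k ℕ.∸ i)))
                             (rearrange b (expTerm a i) (expTerm b (k ℕ.∸ i))))
                           (E.Σ<-*ˡ b (λ i → expTerm a i * expTerm b (k ℕ.∸ i)) (suc k))) ⟩
    a * c + b * c                           ≡⟨ ℚ.*-distribʳ-+ c a b ⟨
    (a + b) * c                             ≡⟨ cong ((a + b) *_) (convolution-expTerm a b k) ⟩
    (a + b) * expTerm (a + b) k             ≡⟨ expTerm-rec (a + b) k ⟨
    fromℕ (suc k) * expTerm (a + b) (suc k) ∎)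
    where
    open ≡-Reasoning
    c : ℚ
    c = convolution (expTerm a) (expTerm b) k
    rearrange : ∀ b x y → x * (b * y) ≡ b * (x * y)
    rearrange = solve-∀ ring

  -- The sum of f i * g j over i + j < N. Growing N by one adds an antidiagonal, which is a
  -- convolution.
  triangleSum : (ℕ → ℚ) → (ℕ → ℚ) → ℕ → ℚ
  triangleSum f g N = Σ< N λ i → f i * Σ< (N ℕ.∸ i) g

  triangleSum-suc : ∀ f g N → triangleSum f g (suc N) ≡ triangleSum f g N + convolution f g N
  triangleSum-suc f g N = begin
    triangleSum f g (suc N)
      ≡⟨ Σ<-cong (suc N) split ⟩
    Σ< (suc N) (λ i → f i * Σ< (N ℕ.∸ i) g + f i * g (N ℕ.∸ i))
      ≡⟨ Σ<-+ (suc N) (λ i → f i * Σ< (N ℕ.∸ i) g) (λ i → f i * g (N ℕ.∸ i)) ⟩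
    triangleSum f g N + f N * Σ< (N ℕ.∸ N) g + convolution f g N
      ≡⟨ cong (λ z → triangleSum f g N + z + convolution f g N)
           (trans (cong (λ i → f N * Σ< i g) (ℕ.n∸n≡0 N)) (ℚ.*-zeroʳ (f N))) ⟩
    triangleSum f g N + 0ℚ + convolution f g N
      ≡⟨ cong (_+ convolution f g N) (ℚ.+-identityʳ (triangleSum f g N)) ⟩
    triangleSum f g N + convolution f g N ∎
    where
    open ≡-Reasoning
    split : ∀ i → i ℕ.< suc N → f i * Σ< (suc N ℕ.∸ i) g ≡ f i * Σ< (N ℕ.∸ i) g + f i * g (N ℕ.∸ i)
    split i (s≤s i≤N) = trans (cong (λ j → f i * Σ< j g) (ℕ.+-∸-assoc 1 i≤N)) (ℚ.*-distribˡ-+ (f i) _ _)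

  triangleSum-expTerm : ∀ a b N → triangleSum (expTerm a) (expTerm b) N ≡ expSum N (a + b)
  triangleSum-expTerm a b zero    = refl
  triangleSum-expTerm a b (suc N) = trans (triangleSum-suc (expTerm a) (expTerm b) N)
    (cong₂ _+_ (triangleSum-expTerm a b N) (convolution-expTerm a b N))

  square-triangle : ∀ f g N → Σ< N f * Σ< N g - triangleSum f g N ≡ Σ< N (λ i → f i * (Σ< N g - Σ< (N ℕ.∸ i) g))
  square-triangle f g N = begin
    Σ< N f * Σ< N g - triangleSum f g N
      ≡⟨ cong (_- triangleSum f g N) (Σ<-*ʳ N f (Σ< N g)) ⟨
    Σ< N (λ i → f i * Σ< N g) - triangleSum f g N
      ≡⟨ E.Σ<-minus (λ i → f i * Σ< N g) (λ i → f i * Σ< (N ℕ.∸ i) g) N ⟩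
    Σ< N (λ i → f i * Σ< N g - f i * Σ< (N ℕ.∸ i) g)
      ≡⟨ Σ<-cong N (λ i _ → E.*-distribˡ-minus (f i) (Σ< N g) (Σ< (N ℕ.∸ i) g)) ⟩
    Σ< N (λ i → f i * (Σ< N g - Σ< (N ℕ.∸ i) g)) ∎
    where open ≡-Reasoning

  module _ {a b : ℚ} (B : ℕ) (∣a∣≤B : ∣ a ∣ ≤ fromℕ B) (∣b∣≤B : ∣ b ∣ ≤ fromℕ B) where

    open ℚ.≤-Reasoning

    private
      t : ℕ → ℚ
      t = expTerm (fromℕ B)
      0≤t : ∀ k → 0ℚ ≤ t k
      0≤t = E.0≤expTerm (E.0≤fromℕ B)

    -- The square i, j < N lies inside the triangle i + j < 2N, and all terms are nonnegative.
    square≤triangle : ∀ N → expSum N (fromℕ B) * expSum N (fromℕ B) ≤ expSum (N ℕ.+ N) (fromℕ (B ℕ.+ B))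
    square≤triangle N = begin
      Σ< N t * Σ< N t                               ≡⟨ Σ<-*ʳ N t (Σ< N t) ⟨
      Σ< N (λ i → t i * Σ< N t)                     ≤⟨ Σ<-mono N (λ i i<N → E.*-monoˡ (0≤t i)
                                                         (E.Σ<-mono-N t 0≤t (N≤ i<N))) ⟩
      Σ< N (λ i → t i * Σ< (N ℕ.+ N ℕ.∸ i) t)       ≤⟨ E.Σ<-mono-N _ (λ i → E.0≤* (0≤t i) (Σ<-nonneg (N ℕ.+ N ℕ.∸ i) 0≤t)) (ℕ.m≤m+n N N) ⟩
      triangleSum t t (N ℕ.+ N)                     ≡⟨ triangleSum-expTerm (fromℕ B) (fromℕ B) (N ℕ.+ N) ⟩
      expSum (N ℕ.+ N) (fromℕ B + fromℕ B)          ≡⟨ cong (expSum (N ℕ.+ N)) (fromℕ-+ B B) ⟨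
      expSum (N ℕ.+ N) (fromℕ (B ℕ.+ B))            ∎
      where
      N≤ : ∀ {i} → i ℕ.< N → N ℕ.≤ N ℕ.+ N ℕ.∸ i
      N≤ {i} i<N = ℕ.≤-trans (ℕ.m≤m+n N (N ℕ.∸ i)) (ℕ.≤-reflexive (sym (ℕ.+-∸-assoc N (ℕ.<⇒≤ i<N))))

    -- A product of partial sums runs over a square, the partial sum at a + b over a triangle. The
    -- difference is estimated term by term with B in place of a and b, and `square≤triangle` then
    -- turns it into a piece of the tail of the series at 2B, which vanishes uniformly in a and b.
    expSum-+ : ∀ N → ∣ expSum N a * expSum N b - expSum N (a + b) ∣ ≤
                     expSum (N ℕ.+ N) (fromℕ (B ℕ.+ B)) - expSum N (fromℕ (B ℕ.+ B))
    expSum-+ N = begin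
      ∣ expSum N a * expSum N b - expSum N (a + b) ∣
        ≡⟨ cong (λ z → ∣ expSum N a * expSum N b - z ∣) (triangleSum-expTerm a b N) ⟨
      ∣ expSum N a * expSum N b - triangleSum (expTerm a) (expTerm b) N ∣
        ≡⟨ cong ∣_∣ (square-triangle (expTerm a) (expTerm b) N) ⟩
      ∣ Σ< N (λ i → expTerm a i * (expSum N b - expSum (N ℕ.∸ i) b)) ∣
        ≤⟨ E.Σ<-abs _ _ (λ i → E.∣∣-* {expTerm a i} (E.∣expTerm∣≤ {a} ∣a∣≤B i)
             (E.Σ<-increment (expTerm b) t (E.∣expTerm∣≤ {b} ∣b∣≤B) (ℕ.m∸n≤m N i))) N ⟩
      Σ< N (λ i → t i * (Σ< N t - Σ< (N ℕ.∸ i) t))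
        ≡⟨ square-triangle t t N ⟨
      Σ< N t * Σ< N t - triangleSum t t N
        ≡⟨ cong (λ z → Σ< N t * Σ< N t - z) (triangleSum-expTerm (fromℕ B) (fromℕ B) N) ⟩
      Σ< N t * Σ< N t - expSum N (fromℕ B + fromℕ B)
        ≡⟨ cong (λ z → Σ< N t * Σ< N t - expSum N z) (fromℕ-+ B B) ⟨
      Σ< N t * Σ< N t - expSum N (fromℕ (B ℕ.+ B))
        ≤⟨ ℚ.+-monoˡ-≤ (- expSum N (fromℕ (B ℕ.+ B))) (square≤triangle N) ⟩
      expSum (N ℕ.+ N) (fromℕ (B ℕ.+ B)) - expSum N (fromℕ (B ℕ.+ B)) ∎

-- Order on Cauchy reals, and addition formula, positivity and monotonicity of the exponential.

module RealExp where

  open import Data.Nat.Base as ℕ using (ℕ; suc)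
  import Data.Nat.Properties as ℕ
  open import Data.Product.Base using (_×_; _,_; ∃; proj₁; proj₂)
  open import Data.Rational.Base as ℚ using (ℚ; 0ℚ; 1ℚ; ½)
  import Data.Rational.Properties as ℚ
  open import Data.Sum.Base using (inj₁; inj₂)
  open import Function.Base using (_∘_)
  open import Relation.Binary.PropositionalEquality
  open import Relation.Nullary using (contradiction)
  open import Tactic.RingSolver using (solve-∀)
  open import Defs
  open E using (_~_)
  open RationalExp

  Eventually : (ℕ → Set) → Set
  Eventually P = ∃ λ N → ∀ j → N ℕ.≤ j → P j

  always : ∀ {P} → (∀ j → P j) → Eventually P
  always p = 0 , λ j _ → p j

  ev-map : ∀ {P Q} → (∀ j → P j → Q j) → Eventually P → Eventually Q
  ev-map f (N , p) = N , λ j N≤j → f j (p j N≤j)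

  ev-zip : ∀ {P Q R} → (∀ j → P j → Q j → R j) → Eventually P → Eventually Q → Eventually R
  ev-zip f (N , p) (M , q) = N ℕ.⊔ M , λ j ≤j → f j (p j (ℕ.m⊔n≤o⇒m≤o N M ≤j)) (q j (ℕ.m⊔n≤o⇒n≤o N M ≤j))

  -- Equality and order are wrapped in records, since Agda cannot infer x and y from x ≈ y or x ≤ y.

  infix 4 _≋_ _⊑_

  record _≋_ (x y : ℝ) : Set where
    constructor mk≋
    field close : ∀ ε → 0ℚ ℚ.< ε → Eventually λ j → ℚ.∣ seq x j ℚ.- seq y j ∣ ℚ.≤ ε
  open _≋_

  record _⊑_ (x y : ℝ) : Set where
    constructor mk⊑
    field bounded : ∀ ε → 0ℚ ℚ.< ε → Eventually λ j → seq x j ℚ.≤ seq y j ℚ.+ ε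
  open _⊑_

  -- Properties of the representing sequence, stronger than the sign of the real: -1/(j + 1)
  -- represents 0 but is not `NonNeg`. They allow rational inequalities at one index to be
  -- multiplied without error terms, and 0 < x supplies `NonNeg x`.
  NonNeg NonPos : ℝ → Set
  NonNeg x = Eventually λ j → 0ℚ ℚ.≤ seq x j
  NonPos x = Eventually λ j → seq x j ℚ.≤ 0ℚ

  p≤q+∣p-q∣ : ∀ p q → p ℚ.≤ q ℚ.+ ℚ.∣ p ℚ.- q ∣
  p≤q+∣p-q∣ p q = subst (ℚ._≤ q ℚ.+ ℚ.∣ p ℚ.- q ∣) (eq p q) (ℚ.+-monoʳ-≤ q (E.p≤∣p∣ (p ℚ.- q)))
    where
    eq : ∀ p q → q ℚ.+ (p ℚ.- q) ≡ p
    eq = solve-∀ E.ring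

  0≤q-p : ∀ {p q} → p ℚ.≤ q → 0ℚ ℚ.≤ q ℚ.- p
  0≤q-p {p} {q} p≤q = subst (ℚ._≤ q ℚ.- p) (ℚ.+-inverseʳ p) (ℚ.+-monoˡ-≤ (ℚ.- p) p≤q)

  p≤p+ε : ∀ p {ε} → 0ℚ ℚ.≤ ε → p ℚ.≤ p ℚ.+ ε
  p≤p+ε p 0≤ε = subst (ℚ._≤ p ℚ.+ _) (ℚ.+-identityʳ p) (ℚ.+-monoʳ-≤ p 0≤ε)

  ≈⇒≋ : ∀ {x y} → x ≈ y → x ≋ y
  ≈⇒≋ x≈y = mk≋ λ ε 0<ε → proj₁ (x≈y ε 0<ε) , λ j N≤j → proj₂ (x≈y ε 0<ε) j j N≤j N≤j

  -- Closeness at equal indices is upgraded to independent ones: u ~ v already leads from index m to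
  -- index n, and the hypothesis then leads from v n to w n.
  diagonal-~ : ∀ {u v w} → u ~ v → (∀ ε → 0ℚ ℚ.< ε → Eventually λ j → ℚ.∣ v j ℚ.- w j ∣ ℚ.≤ ε) → u ~ w
  diagonal-~ {u} {v} {w} u~v v-w ε 0<ε =
    proj₁ u~v′ ℕ.⊔ proj₁ v-w′ , λ m n ≤m ≤n → begin
      ℚ.∣ u m ℚ.- w n ∣                            ≤⟨ E.triangle (u m) (v n) (w n) ⟩
      ℚ.∣ u m ℚ.- v n ∣ ℚ.+ ℚ.∣ v n ℚ.- w n ∣      ≤⟨ ℚ.+-mono-≤
        (proj₂ u~v′ m n (ℕ.m⊔n≤o⇒m≤o _ (proj₁ v-w′) ≤m) (ℕ.m⊔n≤o⇒m≤o _ (proj₁ v-w′) ≤n))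
        (proj₂ v-w′ n (ℕ.m⊔n≤o⇒n≤o (proj₁ u~v′) _ ≤n)) ⟩
      ε ℚ.* ½ ℚ.+ ε ℚ.* ½                          ≡⟨ E.halves ε ⟩
      ε                                            ∎
    where
    open ℚ.≤-Reasoning
    u~v′ = u~v (ε ℚ.* ½) (E.0<½* 0<ε)
    v-w′ = v-w (ε ℚ.* ½) (E.0<½* 0<ε)

  ≋⇒≈ : ∀ {x y} → x ≋ y → x ≈ y
  ≋⇒≈ {x} {y} x≋y = diagonal-~ {seq x} {seq x} {seq y} (cauchy x) (close x≋y)

  ≋-pointwise : ∀ {x y} → (∀ j → seq x j ≡ seq y j) → x ≋ y
  ≋-pointwise {x} {y} x≡y = mk≋ λ ε 0<ε → always λ j → subst (λ z → ℚ.∣ seq x j ℚ.- z ∣ ℚ.≤ ε) (x≡y j)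
    (subst (ℚ._≤ ε) (sym (cong ℚ.∣_∣ (ℚ.+-inverseʳ (seq x j)))) (ℚ.<⇒≤ 0<ε))

  ≋-refl : ∀ {x} → x ≋ x
  ≋-refl = ≋-pointwise λ _ → refl

  ≋-sym : ∀ {x y} → x ≋ y → y ≋ x
  ≋-sym {x} {y} x≋y = mk≋ λ ε 0<ε →
    ev-map (λ j → subst (ℚ._≤ ε) (E.∣p-q∣≡∣q-p∣ (seq x j) (seq y j))) (close x≋y ε 0<ε)

  ≋-trans : ∀ {x y z} → x ≋ y → y ≋ z → x ≋ z
  ≋-trans {x} {y} {z} x≋y y≋z = ≈⇒≋ {x} {z} (diagonal-~ {seq x} {seq y} {seq z} (≋⇒≈ x≋y) (close y≋z))

  *-cong : ∀ {x x′ y y′} → x ≋ x′ → y ≋ y′ → x * y ≋ x′ * y′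
  *-cong {x} {x′} {y} {y′} x≋ y≋ = ≈⇒≋ {x * y} {x′ * y′}
    (E.~-* {seq x} {seq x′} {seq y} {seq y′} (≋⇒≈ x≋) (≋⇒≈ y≋))

  ⊑-pointwise : ∀ {x y} → Eventually (λ j → seq x j ℚ.≤ seq y j) → x ⊑ y
  ⊑-pointwise {y = y} x≤y = mk⊑ λ ε 0<ε → ev-map (λ j x≤ → ℚ.≤-trans x≤ (p≤p+ε (seq y j) (ℚ.<⇒≤ 0<ε))) x≤y

  ≋⇒⊑ : ∀ {x y} → x ≋ y → x ⊑ y
  ≋⇒⊑ {x} {y} x≋y = mk⊑ λ ε 0<ε → ev-map (λ j ≤ε →
    ℚ.≤-trans (p≤q+∣p-q∣ (seq x j) (seq y j)) (ℚ.+-monoʳ-≤ (seq y j) ≤ε)) (close x≋y ε 0<ε)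

  ⊑-trans : ∀ {x y z} → x ⊑ y → y ⊑ z → x ⊑ z
  ⊑-trans {x} {y} {z} x⊑y y⊑z = mk⊑ λ ε 0<ε → ev-zip (λ j x≤ y≤ → begin
      seq x j                                  ≤⟨ x≤ ⟩
      seq y j ℚ.+ ε ℚ.* ½                      ≤⟨ ℚ.+-monoˡ-≤ (ε ℚ.* ½) y≤ ⟩
      seq z j ℚ.+ ε ℚ.* ½ ℚ.+ ε ℚ.* ½          ≡⟨ ℚ.+-assoc (seq z j) _ _ ⟩
      seq z j ℚ.+ (ε ℚ.* ½ ℚ.+ ε ℚ.* ½)        ≡⟨ cong (seq z j ℚ.+_) (E.halves ε) ⟩
      seq z j ℚ.+ ε                            ∎)
    (bounded x⊑y (ε ℚ.* ½) (E.0<½* 0<ε)) (bounded y⊑z (ε ℚ.* ½) (E.0<½* 0<ε))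
    where open ℚ.≤-Reasoning

  seq-bounded : ∀ x → ∃ λ b → Eventually λ j → ℚ.∣ seq x j ∣ ℚ.≤ E.fromℕ b
  seq-bounded x = E.~-bounded {seq x} {seq x} (cauchy x)

  *-monoˡ-⊑ : ∀ {x y z} → NonNeg z → x ⊑ y → z * x ⊑ z * y
  *-monoˡ-⊑ {x} {y} {z} 0≤z x⊑y = mk⊑ λ ε 0<ε →
    let (b , ∣z∣≤b) = seq-bounded z
        -- The slack δ in x ⊑ y gets multiplied by z, hence must be small compared with a bound of
        -- z.
        (δ , 0<δ , bδ≤ε) = E.shrink (E.fromℕ b) 0<ε in
    ev-zip (λ j (0≤zj , ∣zj∣≤b) xj≤ → begin
      seq z j ℚ.* seq x j                  ≤⟨ E.*-monoˡ 0≤zj xj≤ ⟩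
      seq z j ℚ.* (seq y j ℚ.+ δ)          ≡⟨ ℚ.*-distribˡ-+ (seq z j) (seq y j) δ ⟩
      seq z j ℚ.* seq y j ℚ.+ seq z j ℚ.* δ ≤⟨ ℚ.+-monoʳ-≤ (seq z j ℚ.* seq y j)
                                                (ℚ.≤-trans (E.*-monoʳ (ℚ.<⇒≤ 0<δ) (ℚ.≤-trans (E.p≤∣p∣ (seq z j)) ∣zj∣≤b)) bδ≤ε) ⟩
      seq z j ℚ.* seq y j ℚ.+ ε            ∎)
    (ev-zip (λ _ p q → p , q) 0≤z ∣z∣≤b) (bounded x⊑y δ 0<δ)
    where open ℚ.≤-Reasoning

  *-comm : ∀ x y → x * y ≋ y * x
  *-comm x y = ≋-pointwise λ j → ℚ.*-comm (seq x j) (seq y j)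

  *-monoʳ-⊑ : ∀ {x y z} → NonNeg z → x ⊑ y → x * z ⊑ y * z
  *-monoʳ-⊑ {x} {y} {z} 0≤z x⊑y = ⊑-trans (≋⇒⊑ (*-comm x z)) (⊑-trans (*-monoˡ-⊑ 0≤z x⊑y) (≋⇒⊑ (*-comm z y)))

  NonNeg-* : ∀ {x y} → NonNeg x → NonNeg y → NonNeg (x * y)
  NonNeg-* = ev-zip λ _ → E.0≤*

  module _ (X : ℕ → ℝ) (c : CauchySequence X) where

    lim-close : ∀ ε → 0ℚ ℚ.< ε → ∃ λ N → ∀ n → N ℕ.≤ n →
                Eventually λ j → ℚ.∣ seq (X n) j ℚ.- seq (lim X c) j ∣ ℚ.≤ ε
    lim-close ε 0<ε =
      let (N , near) = lim-converges X c ε 0<ε in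
      N , λ n N≤n → let (ε₀ , 0<ε₀ , J , below) = near n N≤n in
        J , λ j J≤j → ℚ.≤-trans (p≤p+ε ℚ.∣ seq (X n) j ℚ.- seq (lim X c) j ∣ (ℚ.<⇒≤ 0<ε₀)) (below j j J≤j J≤j)

    lim-⊑ : ∀ {U} → (∀ n → X n ⊑ U) → lim X c ⊑ U
    lim-⊑ {U} X⊑U = mk⊑ λ ε 0<ε →
      let (N , near) = lim-close (ε ℚ.* ½) (E.0<½* 0<ε) in
      ev-zip (λ j d≤ X≤ → begin
          seq (lim X c) j                           ≤⟨ p≤q+∣p-q∣ (seq (lim X c) j) (seq (X N) j) ⟩
          seq (X N) j ℚ.+ ℚ.∣ seq (lim X c) j ℚ.- seq (X N) j ∣
            ≡⟨ cong (seq (X N) j ℚ.+_) (E.∣p-q∣≡∣q-p∣ (seq (lim X c) j) (seq (X N) j)) ⟩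
          seq (X N) j ℚ.+ ℚ.∣ seq (X N) j ℚ.- seq (lim X c) j ∣
            ≤⟨ ℚ.+-mono-≤ X≤ d≤ ⟩
          seq U j ℚ.+ ε ℚ.* ½ ℚ.+ ε ℚ.* ½           ≡⟨ ℚ.+-assoc (seq U j) _ _ ⟩
          seq U j ℚ.+ (ε ℚ.* ½ ℚ.+ ε ℚ.* ½)         ≡⟨ cong (seq U j ℚ.+_) (E.halves ε) ⟩
          seq U j ℚ.+ ε                             ∎)
        (near N ℕ.≤-refl) (bounded (X⊑U N) (ε ℚ.* ½) (E.0<½* 0<ε))
      where open ℚ.≤-Reasoning

    ⊑-lim : ∀ {U} → (∀ n → U ⊑ X n) → U ⊑ lim X c
    ⊑-lim {U} U⊑X = mk⊑ λ ε 0<ε →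
      let (N , near) = lim-close (ε ℚ.* ½) (E.0<½* 0<ε) in
      ev-zip (λ j d≤ U≤ → begin
          seq U j                                   ≤⟨ U≤ ⟩
          seq (X N) j ℚ.+ ε ℚ.* ½                   ≤⟨ ℚ.+-monoˡ-≤ (ε ℚ.* ½) (ℚ.≤-trans (p≤q+∣p-q∣ (seq (X N) j) (seq (lim X c) j))
                                                         (ℚ.+-monoʳ-≤ (seq (lim X c) j) d≤)) ⟩
          seq (lim X c) j ℚ.+ ε ℚ.* ½ ℚ.+ ε ℚ.* ½   ≡⟨ ℚ.+-assoc (seq (lim X c) j) _ _ ⟩
          seq (lim X c) j ℚ.+ (ε ℚ.* ½ ℚ.+ ε ℚ.* ½) ≡⟨ cong (seq (lim X c) j ℚ.+_) (E.halves ε) ⟩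
          seq (lim X c) j ℚ.+ ε                     ∎)
        (near N ℕ.≤-refl) (bounded (U⊑X N) (ε ℚ.* ½) (E.0<½* 0<ε))
      where open ℚ.≤-Reasoning

  seq-expSum : ∀ N x j → seq (Σ< N (expTerm x)) j ≡ expSum N (seq x j)
  seq-expSum N x j = seq-Σ< (expTerm x) (E.expTerm (seq x j)) j (λ k → seq-expTerm x k j) N

  -- The bridge from real to rational estimates. In the definition of `exp` the number of terms and
  -- the precision of x are separate; here both are the index j.
  exp-diagonal : ∀ x → seq (exp x) ~ λ j → expSum j (seq x j)
  exp-diagonal x = diagonal-~ {seq (exp x)} {seq (exp x)} (cauchy (exp x)) λ ε 0<ε →
    let (b , J , ∣x∣≤b) = seq-bounded x
        (N₁ , tail) = E.expTail-increment b (E.0<½* 0<ε)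
        (N₂ , near) = lim-close (λ N → Σ< N (expTerm x)) (expTerm-summable x) (ε ℚ.* ½) (E.0<½* 0<ε)
        -- N₁ controls the tail of the series uniformly in j, through the integer bound b on x; N₂
        -- controls the distance of the N-th sum from its limit.
        N = N₁ ℕ.⊔ N₂
        (M , near-N) = near N (ℕ.m≤n⊔m N₁ N₂) in
    (N ℕ.⊔ J) ℕ.⊔ M , λ j ≤j →
      let NJ≤j = ℕ.m⊔n≤o⇒m≤o (N ℕ.⊔ J) M ≤j in begin
      ℚ.∣ seq (exp x) j ℚ.- expSum j (seq x j) ∣
        ≤⟨ E.triangle (seq (exp x) j) (expSum N (seq x j)) (expSum j (seq x j)) ⟩
      ℚ.∣ seq (exp x) j ℚ.- expSum N (seq x j) ∣ ℚ.+ ℚ.∣ expSum N (seq x j) ℚ.- expSum j (seq x j) ∣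
        ≡⟨ cong₂ ℚ._+_ (E.∣p-q∣≡∣q-p∣ (seq (exp x) j) (expSum N (seq x j)))
                       (E.∣p-q∣≡∣q-p∣ (expSum N (seq x j)) (expSum j (seq x j))) ⟩
      ℚ.∣ expSum N (seq x j) ℚ.- seq (exp x) j ∣ ℚ.+ ℚ.∣ expSum j (seq x j) ℚ.- expSum N (seq x j) ∣
        ≤⟨ ℚ.+-mono-≤
             (subst (λ s → ℚ.∣ s ℚ.- seq (exp x) j ∣ ℚ.≤ ε ℚ.* ½) (seq-expSum N x j) (near-N j (ℕ.m⊔n≤o⇒n≤o (N ℕ.⊔ J) M ≤j)))
             (ℚ.≤-trans (E.Σ<-increment (E.expTerm (seq x j)) (E.expTerm (E.fromℕ b))
                           (E.∣expTerm∣≤ {seq x j} (∣x∣≤b j (ℕ.m⊔n≤o⇒n≤o N J NJ≤j))) (ℕ.m⊔n≤o⇒m≤o N J NJ≤j))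
                        (tail {N} {j} (ℕ.m≤m⊔n N₁ N₂))) ⟩
      ε ℚ.* ½ ℚ.+ ε ℚ.* ½
        ≡⟨ E.halves ε ⟩
      ε ∎
    where open ℚ.≤-Reasoning

  -- Pointwise equal representations have equal diagonal sums, so no continuity of `exp` enters; the
  -- arguments in question differ only by rational ring identities.
  exp-cong-pointwise : ∀ {x y} → (∀ j → seq x j ≡ seq y j) → exp x ≋ exp y
  exp-cong-pointwise {x} {y} x≡y = ≈⇒≋ {exp x} {exp y} (E.~-sym {seq (exp y)} {seq (exp x)}
    (diagonal-~ {seq (exp y)} {λ j → expSum j (seq y j)} (exp-diagonal y) λ ε 0<ε →
      let (N , near) = E.~-sym {seq (exp x)} {λ j → expSum j (seq x j)} (exp-diagonal x) ε 0<ε in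
      N , λ j N≤j → subst (λ q → ℚ.∣ expSum j q ℚ.- seq (exp x) j ∣ ℚ.≤ ε) (x≡y j) (near j j N≤j N≤j)))

  exp-+ : ∀ x y → exp (x + y) ≋ exp x * exp y
  exp-+ x y = ≈⇒≋ {exp (x + y)} {exp x * exp y}
    (E.~-sym {seq (exp x * exp y)} {seq (exp (x + y))}
    (diagonal-~ {seq (exp x * exp y)} {λ j → expSum j (seq x j) ℚ.* expSum j (seq y j)} {seq (exp (x + y))}
      (E.~-* {seq (exp x)} {λ j → expSum j (seq x j)} {seq (exp y)} {λ j → expSum j (seq y j)} (exp-diagonal x) (exp-diagonal y))
      λ ε 0<ε →
        let (b , J , ∣x∣≤b) = seq-bounded x
            (c , J′ , ∣y∣≤c) = seq-bounded y
            B = b ℕ.⊔ c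
            (N₁ , tail) = E.expTail-increment (B ℕ.+ B) (E.0<½* 0<ε)
            (N₂ , near) = E.~-sym {seq (exp (x + y))} {λ j → expSum j (seq (x + y) j)} (exp-diagonal (x + y)) (ε ℚ.* ½) (E.0<½* 0<ε) in
        (J ℕ.⊔ J′) ℕ.⊔ (N₁ ℕ.⊔ N₂) , λ j ≤j →
          let JJ≤j = ℕ.m⊔n≤o⇒m≤o (J ℕ.⊔ J′) (N₁ ℕ.⊔ N₂) ≤j
              NN≤j = ℕ.m⊔n≤o⇒n≤o (J ℕ.⊔ J′) (N₁ ℕ.⊔ N₂) ≤j
              N₂≤j = ℕ.m⊔n≤o⇒n≤o N₁ N₂ NN≤j in begin
          ℚ.∣ expSum j (seq x j) ℚ.* expSum j (seq y j) ℚ.- seq (exp (x + y)) j ∣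
            ≤⟨ E.triangle (expSum j (seq x j) ℚ.* expSum j (seq y j)) (expSum j (seq x j ℚ.+ seq y j)) (seq (exp (x + y)) j) ⟩
          ℚ.∣ expSum j (seq x j) ℚ.* expSum j (seq y j) ℚ.- expSum j (seq x j ℚ.+ seq y j) ∣
            ℚ.+ ℚ.∣ expSum j (seq x j ℚ.+ seq y j) ℚ.- seq (exp (x + y)) j ∣
            ≤⟨ ℚ.+-mono-≤
                 (ℚ.≤-trans (expSum-+ {seq x j} {seq y j} B
                     (ℚ.≤-trans (∣x∣≤b j (ℕ.m⊔n≤o⇒m≤o J J′ JJ≤j)) (E.fromℕ-mono (ℕ.m≤m⊔n b c)))
                     (ℚ.≤-trans (∣y∣≤c j (ℕ.m⊔n≤o⇒n≤o J J′ JJ≤j)) (E.fromℕ-mono (ℕ.m≤n⊔m b c))) j)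
                   (tail {j} {j ℕ.+ j} (ℕ.m⊔n≤o⇒m≤o N₁ N₂ NN≤j)))
                 (near j j N₂≤j N₂≤j) ⟩
          ε ℚ.* ½ ℚ.+ ε ℚ.* ½
            ≡⟨ E.halves ε ⟩
          ε ∎))
    where open ℚ.≤-Reasoning

  exp-pointwise-+ : ∀ {x y z} → (∀ j → seq z j ≡ seq x j ℚ.+ seq y j) → exp z ≋ exp x * exp y
  exp-pointwise-+ {x} {y} z≡x+y = ≋-trans (exp-cong-pointwise z≡x+y) (exp-+ x y)

  expSum-0 : ∀ N → expSum (suc N) 0ℚ ≡ 1ℚ
  expSum-0 N = begin
    expSum (suc N) 0ℚ                                   ≡⟨ Σ<-front N (E.expTerm 0ℚ) ⟩
    E.expTerm 0ℚ 0 ℚ.+ E.Σ< N (E.expTerm 0ℚ ∘ suc)      ≡⟨ cong₂ ℚ._+_ (expTerm-0 0ℚ) (Σ<-cong N (λ k _ → vanish k)) ⟩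
    1ℚ ℚ.+ E.Σ< N (λ _ → 0ℚ)                            ≡⟨ cong (1ℚ ℚ.+_) (Σ<-0 N) ⟩
    1ℚ ℚ.+ 0ℚ                                           ≡⟨ ℚ.+-identityʳ 1ℚ ⟩
    1ℚ                                                  ∎
    where
    open ≡-Reasoning
    vanish : ∀ k → E.expTerm 0ℚ (suc k) ≡ 0ℚ
    vanish k = trans (E.expTerm-suc 0ℚ k) (trans (cong (E.expTerm 0ℚ k ℚ.*_) (ℚ.*-zeroˡ (E.1/ℕ (suc k)))) (ℚ.*-zeroʳ (E.expTerm 0ℚ k)))

  exp-0 : exp 0ℝ ≋ 1ℝ
  exp-0 = ≈⇒≋ {exp 0ℝ} {1ℝ} (diagonal-~ {seq (exp 0ℝ)} {λ j → expSum j 0ℚ} {λ _ → 1ℚ} (exp-diagonal 0ℝ) λ ε 0<ε →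
    -- The threshold 1 excludes the empty sum, which is 0 instead of 1.
    1 , λ { (suc j) _ → subst (ℚ._≤ ε) (sym (trans (cong (λ q → ℚ.∣ q ℚ.- 1ℚ ∣) (expSum-0 j)) (cong ℚ.∣_∣ (ℚ.+-inverseʳ 1ℚ)))) (ℚ.<⇒≤ 0<ε) })

  -- From index N on, the diagonal sum contains the first N terms, and the further ones are
  -- nonnegative.
  expSum-⊑-exp : ∀ {x} → NonNeg x → ∀ N → Σ< N (expTerm x) ⊑ exp x
  expSum-⊑-exp {x} 0≤x N = mk⊑ λ ε 0<ε →
    let (M , near) = exp-diagonal x ε 0<ε in
    ev-zip (λ j 0≤xj (N≤j , M≤j) → begin
        seq (Σ< N (expTerm x)) j            ≡⟨ seq-expSum N x j ⟩
        expSum N (seq x j)                  ≤⟨ E.Σ<-mono-N _ (E.0≤expTerm 0≤xj) N≤j ⟩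
        expSum j (seq x j)                  ≤⟨ p≤q+∣p-q∣ (expSum j (seq x j)) (seq (exp x) j) ⟩
        seq (exp x) j ℚ.+ ℚ.∣ expSum j (seq x j) ℚ.- seq (exp x) j ∣
          ≡⟨ cong (seq (exp x) j ℚ.+_) (E.∣p-q∣≡∣q-p∣ (expSum j (seq x j)) (seq (exp x) j)) ⟩
        seq (exp x) j ℚ.+ ℚ.∣ seq (exp x) j ℚ.- expSum j (seq x j) ∣
          ≤⟨ ℚ.+-monoʳ-≤ (seq (exp x) j) (near j j M≤j M≤j) ⟩
        seq (exp x) j ℚ.+ ε                 ∎)
      0≤x (N ℕ.⊔ M , λ j ≤j → ℕ.m⊔n≤o⇒m≤o N M ≤j , ℕ.m⊔n≤o⇒n≤o N M ≤j)
    where open ℚ.≤-Reasoning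

  1⊑exp : ∀ {x} → NonNeg x → 1ℝ ⊑ exp x
  1⊑exp {x} 0≤x = ⊑-trans (≋⇒⊑ (≋-pointwise {1ℝ} λ j → sym (trans (seq-expSum 1 x j)
    (trans (ℚ.+-identityˡ _) (expTerm-0 (seq x j)))))) (expSum-⊑-exp 0≤x 1)

  exp-inverse : ∀ x → exp x * exp (- x) ≋ 1ℝ
  exp-inverse x = ≋-trans (≋-sym (exp-pointwise-+ {x} {(- x)} {0ℝ} λ j → sym (ℚ.+-inverseʳ (seq x j)))) exp-0

  ½-elim : ∀ {p} → 1ℚ ℚ.≤ p ℚ.+ ½ → ½ ℚ.≤ p
  ½-elim {p} 1≤p+½ = subst (½ ℚ.≤_) (trans (ℚ.+-assoc p ½ (ℚ.- ½)) (ℚ.+-identityʳ p)) (ℚ.+-monoˡ-≤ (ℚ.- ½) 1≤p+½)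

  exp≥½ : ∀ {x} → NonNeg x → Eventually λ j → ½ ℚ.≤ seq (exp x) j
  exp≥½ 0≤x = ev-map (λ _ → ½-elim) (bounded (1⊑exp 0≤x) ½ E.0<½)

  NonNeg-exp : ∀ {x} → NonNeg x → NonNeg (exp x)
  NonNeg-exp 0≤x = ev-map (λ _ → ℚ.≤-trans (ℚ.<⇒≤ E.0<½)) (exp≥½ 0≤x)

  PosBelow : ℝ → Set
  PosBelow x = ∃ λ q → 0ℚ ℚ.< q × Eventually λ j → q ℚ.≤ seq x j

  -- exp x * exp (- x) = 1, and exp (- x) is bounded by b + 1 and, since - x is nonnegative, at
  -- least ½. A product that is eventually at least ½ thus forces exp x to be at least ½ / (b + 1).
  exp-pos : ∀ {x} → NonPos x → PosBelow (exp x)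
  exp-pos {x} x≤0 = r , E.0<* E.0<½ (E.0<1/ℕ (suc b)) , ev-zip (λ j ½≤pq (½≤q , ∣q∣≤b) →
      let p = seq (exp x) j ; q = seq (exp (- x)) j
          0≤q = ℚ.≤-trans (ℚ.<⇒≤ E.0<½) ½≤q in
      lower p q ½≤pq (positive p q ½≤pq 0≤q) (ℚ.≤-trans (ℚ.≤-trans (E.p≤∣p∣ q) ∣q∣≤b) (E.fromℕ-mono (ℕ.n≤1+n b))))
    (ev-map (λ _ → ½-elim) (bounded (≋⇒⊑ (≋-sym (exp-inverse x))) ½ E.0<½))
    (ev-zip (λ _ → _,_) (exp≥½ (ev-map (λ j → ℚ.neg-antimono-≤ {seq x j}) x≤0)) (proj₂ (seq-bounded (exp (- x)))))
    where
    b : ℕ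
    b = proj₁ (seq-bounded (exp (- x)))
    r : ℚ
    r = ½ ℚ.* E.1/ℕ (suc b)
    positive : ∀ p q → ½ ℚ.≤ p ℚ.* q → 0ℚ ℚ.≤ q → 0ℚ ℚ.≤ p
    positive p q ½≤pq 0≤q with ℚ.≤-total 0ℚ p
    ... | inj₁ 0≤p = 0≤p
    ... | inj₂ p≤0 = contradiction
      (ℚ.<-≤-trans E.0<½ (ℚ.≤-trans ½≤pq (ℚ.≤-trans (E.*-monoʳ 0≤q p≤0) (ℚ.≤-reflexive (ℚ.*-zeroˡ q)))))
      (ℚ.<-irrefl refl)
    lower : ∀ p q → ½ ℚ.≤ p ℚ.* q → 0ℚ ℚ.≤ p → q ℚ.≤ E.fromℕ (suc b) → r ℚ.≤ p
    lower p q ½≤pq 0≤p q≤b = begin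
      ½ ℚ.* E.1/ℕ (suc b)                              ≤⟨ E.*-monoʳ (E.0≤1/ℕ (suc b)) (ℚ.≤-trans ½≤pq (E.*-monoˡ 0≤p q≤b)) ⟩
      p ℚ.* E.fromℕ (suc b) ℚ.* E.1/ℕ (suc b)          ≡⟨ ℚ.*-assoc p _ _ ⟩
      p ℚ.* (E.fromℕ (suc b) ℚ.* E.1/ℕ (suc b))        ≡⟨ cong (p ℚ.*_) (E.fromℕ*1/ℕ b) ⟩
      p ℚ.* 1ℚ                                         ≡⟨ ℚ.*-identityʳ p ⟩
      p                                                ∎
      where open ℚ.≤-Reasoning

  PosBelow⇒NonNeg : ∀ {x} → PosBelow x → NonNeg x
  PosBelow⇒NonNeg (q , 0<q , q≤x) = ev-map (λ _ → ℚ.≤-trans (ℚ.<⇒≤ 0<q)) q≤x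

  -- exp y = exp x * exp (y - x), and the second factor is at least 1. `NonPos x` gives the sign of
  -- the first through `exp-pos`.
  exp-mono : ∀ {x y} → NonPos x → Eventually (λ j → seq x j ℚ.≤ seq y j) → exp x ⊑ exp y
  exp-mono {x} {y} x≤0 x≤y =
    ⊑-trans (≋⇒⊑ (≋-pointwise {exp x} {exp x * 1ℝ} λ j → sym (ℚ.*-identityʳ (seq (exp x) j))))
    (⊑-trans (*-monoˡ-⊑ {1ℝ} {exp (y - x)} {exp x} (PosBelow⇒NonNeg {exp x} (exp-pos {x} x≤0)) (1⊑exp {y - x} (ev-map (λ j → 0≤q-p {seq x j} {seq y j}) x≤y)))
    (≋⇒⊑ (≋-sym (exp-pointwise-+ {x} {y - x} {y} λ j → eq (seq x j) (seq y j)))))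
    where
    eq : ∀ p q → q ≡ p ℚ.+ (q ℚ.- p)
    eq = solve-∀ E.ring

-- Exponential Markov inequality and union bound for independent Poisson variables.

module Chernoff where

  open import Data.Bool.Base using (Bool; true; false; not; if_then_else_)
  open import Data.List.Base using (List; []; _∷_; length)
  open import Data.List.Relation.Unary.All using (All; []; _∷_)
  open import Data.List.Relation.Unary.Any using (Any; here; there)
  open import Data.Nat.Base as ℕ using (ℕ; zero; suc)
  import Data.Nat.Properties as ℕ
  open import Data.Rational.Base as ℚ using (ℚ; 0ℚ; 1ℚ; ½)
  import Data.Rational.Properties as ℚ
  open import Data.Vec.Base as Vec using (Vec; []; _∷_)
  open import Level using (0ℓ)
  open import Relation.Binary.PropositionalEquality
  open import Relation.Nullary using (yes; no)
  open import Relation.Unary using (Pred; Decidable)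
  open import Tactic.RingSolver using (solve-∀)
  open import Defs
  open RationalExp
  open RealExp

  Σlist : {A : Set} → (A → ℚ) → List A → ℚ
  Σlist f []       = 0ℚ
  Σlist f (x ∷ xs) = f x ℚ.+ Σlist f xs

  Σbox-cong : ∀ m N {f g : Vec ℕ m → ℚ} → (∀ w → f w ≡ g w) → E.Σbox m N f ≡ E.Σbox m N g
  Σbox-cong zero    N f≡g = f≡g []
  Σbox-cong (suc m) N f≡g = Σ<-cong N λ i _ → Σbox-cong m N λ w → f≡g (i ∷ w)

  Σbox-mono : ∀ m N {f g : Vec ℕ m → ℚ} → (∀ w → f w ℚ.≤ g w) → E.Σbox m N f ℚ.≤ E.Σbox m N g
  Σbox-mono zero    N f≤g = f≤g []
  Σbox-mono (suc m) N f≤g = Σ<-mono N λ i _ → Σbox-mono m N λ w → f≤g (i ∷ w)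

  Σbox-0 : ∀ m N → E.Σbox m N (λ _ → 0ℚ) ≡ 0ℚ
  Σbox-0 zero    N = refl
  Σbox-0 (suc m) N = trans (Σ<-cong N λ i _ → Σbox-0 m N) (Σ<-0 N)

  Σbox-+ : ∀ m N (f g : Vec ℕ m → ℚ) → E.Σbox m N (λ w → f w ℚ.+ g w) ≡ E.Σbox m N f ℚ.+ E.Σbox m N g
  Σbox-+ zero    N f g = refl
  Σbox-+ (suc m) N f g = trans (Σ<-cong N λ i _ → Σbox-+ m N (λ w → f (i ∷ w)) (λ w → g (i ∷ w)))
    (Σ<-+ N (λ i → E.Σbox m N λ w → f (i ∷ w)) (λ i → E.Σbox m N λ w → g (i ∷ w)))

  Σbox-*ˡ : ∀ m N c (f : Vec ℕ m → ℚ) → E.Σbox m N (λ w → c ℚ.* f w) ≡ c ℚ.* E.Σbox m N f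
  Σbox-*ˡ zero    N c f = refl
  Σbox-*ˡ (suc m) N c f = trans (Σ<-cong N λ i _ → Σbox-*ˡ m N c (λ w → f (i ∷ w)))
    (E.Σ<-*ˡ c (λ i → E.Σbox m N λ w → f (i ∷ w)) N)

  Σbox-Σlist : ∀ m N {A : Set} (f : A → Vec ℕ m → ℚ) (g : Vec ℕ m → ℚ) xs →
    E.Σbox m N (λ w → Σlist (λ a → f a w) xs ℚ.* g w) ≡ Σlist (λ a → E.Σbox m N λ w → f a w ℚ.* g w) xs
  Σbox-Σlist m N f g []       = trans (Σbox-cong m N λ w → ℚ.*-zeroˡ (g w)) (Σbox-0 m N)
  Σbox-Σlist m N f g (x ∷ xs) = trans
    (Σbox-cong m N λ w → ℚ.*-distribʳ-+ (g w) (f x w) (Σlist (λ a → f a w) xs))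
    (trans (Σbox-+ m N (λ w → f x w ℚ.* g w) (λ w → Σlist (λ a → f a w) xs ℚ.* g w))
      (cong (E.Σbox m N (λ w → f x w ℚ.* g w) ℚ.+_) (Σbox-Σlist m N f g xs)))

  ^-*-distrib : ∀ p q k → (p ℚ.* q) E.^ k ≡ p E.^ k ℚ.* q E.^ k
  ^-*-distrib p q zero    = sym (ℚ.*-identityʳ 1ℚ)
  ^-*-distrib p q (suc k) = trans (cong (p ℚ.* q ℚ.*_) (^-*-distrib p q k)) (eq p q (p E.^ k) (q E.^ k))
    where
    eq : ∀ a b c d → a ℚ.* b ℚ.* (c ℚ.* d) ≡ a ℚ.* c ℚ.* (b ℚ.* d)
    eq = solve-∀ E.ring

  expTerm-*-^ : ∀ p q k → E.expTerm (p ℚ.* q) k ≡ q E.^ k ℚ.* E.expTerm p k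
  expTerm-*-^ p q k = trans (cong (ℚ._* c) (^-*-distrib p q k)) (eq (p E.^ k) (q E.^ k) c)
    where
    c : ℚ
    c = E.1/ℕ (k ℕ.!) {{k ℕ.!≢0}}
    eq : ∀ a b c → a ℚ.* b ℚ.* c ≡ b ℚ.* (a ℚ.* c)
    eq = solve-∀ E.ring

  +-mono-⊑ : ∀ {x x′ y y′} → x ⊑ x′ → y ⊑ y′ → x + y ⊑ x′ + y′
  +-mono-⊑ {x} {x′} {y} {y′} x⊑ y⊑ = mk⊑ λ ε 0<ε → ev-zip (λ j x≤ y≤ → begin
      seq x j ℚ.+ seq y j                                            ≤⟨ ℚ.+-mono-≤ x≤ y≤ ⟩
      seq x′ j ℚ.+ ε ℚ.* ½ ℚ.+ (seq y′ j ℚ.+ ε ℚ.* ½)                ≡⟨ eq (seq x′ j) (seq y′ j) (ε ℚ.* ½) ⟩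
      seq x′ j ℚ.+ seq y′ j ℚ.+ (ε ℚ.* ½ ℚ.+ ε ℚ.* ½)                ≡⟨ cong (seq x′ j ℚ.+ seq y′ j ℚ.+_) (E.halves ε) ⟩
      seq x′ j ℚ.+ seq y′ j ℚ.+ ε                                    ∎)
    (_⊑_.bounded x⊑ (ε ℚ.* ½) (E.0<½* 0<ε)) (_⊑_.bounded y⊑ (ε ℚ.* ½) (E.0<½* 0<ε))
    where
    open ℚ.≤-Reasoning
    eq : ∀ a b e → a ℚ.+ e ℚ.+ (b ℚ.+ e) ≡ a ℚ.+ b ℚ.+ (e ℚ.+ e)
    eq = solve-∀ E.ring

  module _ {μ : ℝ} (0≤μ : NonNeg μ) where

    0≤exp-μ : NonNeg (exp (- μ))
    0≤exp-μ = PosBelow⇒NonNeg {exp (- μ)} (exp-pos {(- μ)} (ev-map (λ j → ℚ.neg-antimono-≤ {0ℚ} {seq μ j}) 0≤μ))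

    -- The quantifier over w stands inside `Eventually`: one threshold, depending only on μ and exp
    -- (- μ), serves all terms of every box sum.
    0≤jointMass : Eventually λ j → ∀ m (w : Vec ℕ m) → 0ℚ ℚ.≤ seq (jointMass μ w) j
    0≤jointMass = ev-zip (λ j 0≤e 0≤m _ → go j 0≤e 0≤m) 0≤exp-μ 0≤μ
      where
      go : ∀ j → 0ℚ ℚ.≤ seq (exp (- μ)) j → 0ℚ ℚ.≤ seq μ j → ∀ {m} (w : Vec ℕ m) → 0ℚ ℚ.≤ seq (jointMass μ w) j
      go j 0≤e 0≤m []      = ℚ.nonNegative⁻¹ 1ℚ
      go j 0≤e 0≤m (k ∷ w) = E.0≤* (E.0≤* 0≤e (subst (0ℚ ℚ.≤_) (sym (seq-expTerm μ k j)) (E.0≤expTerm 0≤m k))) (go j 0≤e 0≤m w)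

    0⊑ℙ : ∀ {m} {Ev : Pred (Vec ℕ m) 0ℓ} (Ev? : Decidable Ev) → 0ℝ ⊑ ℙ μ Ev?
    0⊑ℙ {m} Ev? = ⊑-lim (partialProbability μ Ev?) (partialProbability-cauchy μ Ev?) λ N →
      ⊑-pointwise {0ℝ} {partialProbability μ Ev? N} (ev-map (λ j 0≤mass →
        subst₂ ℚ._≤_ (Σbox-0 m N) (sym (seq-Σbox m N (λ w → indicator (Ev? w) * jointMass μ w) j))
          (Σbox-mono m N λ w → E.0≤* (0≤indicator w j) (0≤mass m w))) 0≤jointMass)
      where
      0≤indicator : ∀ w j → 0ℚ ℚ.≤ seq (indicator (Ev? w)) j
      0≤indicator w j with Ev? w
      ... | yes _ = ℚ.nonNegative⁻¹ 1ℚ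
      ... | no  _ = ℚ.≤-refl

  -- t a is the factor by which each voter selecting a row of type a tilts the joint mass.
  module _ {A : Set} (t : A → ℚ) where

    tilt : ∀ {m} → Vec A m → Vec ℕ m → ℚ
    tilt []       []      = 1ℚ
    tilt (a ∷ as) (k ∷ w) = t a E.^ k ℚ.* tilt as w

    -- Since E[t^W] = exp (μ(t - 1)) for a Poisson(μ) variable W, the expected tilt is exp of μ
    -- times this number.
    excess : ∀ {m} → Vec A m → ℚ
    excess []       = 0ℚ
    excess (a ∷ as) = t a ℚ.- 1ℚ ℚ.+ excess as

    -- For a Poisson(μ) variable W, the N-th partial sum of E[t a ^ W].
    factor : ℝ → ℕ → A → ℝ
    factor μ N a = exp (- μ) * Σ< N (expTerm (μ * fromℚ (t a)))

    factors : ∀ {m} → ℝ → ℕ → Vec A m → ℝ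
    factors μ N []       = 1ℝ
    factors μ N (a ∷ as) = factor μ N a * factors μ N as

    seq-factor : ∀ μ N a j → seq (factor μ N a) j ≡ E.Σ< N λ k → t a E.^ k ℚ.* seq (poissonMass μ k) j
    seq-factor μ N a j = begin
      c ℚ.* seq (Σ< N (expTerm (μ * fromℚ (t a)))) j     ≡⟨ cong (c ℚ.*_) (seq-expSum N (μ * fromℚ (t a)) j) ⟩
      c ℚ.* expSum N (p ℚ.* t a)                         ≡⟨ E.Σ<-*ˡ c (E.expTerm (p ℚ.* t a)) N ⟨
      E.Σ< N (λ k → c ℚ.* E.expTerm (p ℚ.* t a) k)       ≡⟨ Σ<-cong N (λ k _ → trans (cong (c ℚ.*_)
           (trans (expTerm-*-^ p (t a) k) (cong (t a E.^ k ℚ.*_) (sym (seq-expTerm μ k j))))) (eq c (t a E.^ k) _)) ⟩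
      E.Σ< N (λ k → t a E.^ k ℚ.* (c ℚ.* seq (expTerm μ k) j)) ∎
      where
      open ≡-Reasoning
      c p : ℚ
      c = seq (exp (- μ)) j
      p = seq μ j
      eq : ∀ a b c → a ℚ.* (b ℚ.* c) ≡ b ℚ.* (a ℚ.* c)
      eq = solve-∀ E.ring

    -- Independence: tilt and mass are products over the coordinates, so the sum over a box factors
    -- into one-dimensional sums, exactly and at each index j.
    seq-factors : ∀ {m} μ N (as : Vec A m) j →
      E.Σbox m N (λ w → tilt as w ℚ.* seq (jointMass μ w) j) ≡ seq (factors μ N as) j
    seq-factors             μ N []       j = ℚ.*-identityʳ 1ℚ
    seq-factors {m = suc m} μ N (a ∷ as) j = begin
      E.Σ< N (λ k → E.Σbox m N λ w → t a E.^ k ℚ.* tilt as w ℚ.* (mass k ℚ.* seq (jointMass μ w) j))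
        ≡⟨ Σ<-cong N (λ k _ → trans (Σbox-cong m N λ w → eq (t a E.^ k) (tilt as w) (mass k) (seq (jointMass μ w) j))
                                    (Σbox-*ˡ m N (t a E.^ k ℚ.* mass k) λ w → tilt as w ℚ.* seq (jointMass μ w) j)) ⟩
      E.Σ< N (λ k → t a E.^ k ℚ.* mass k ℚ.* rest)
        ≡⟨ Σ<-*ʳ N (λ k → t a E.^ k ℚ.* mass k) rest ⟩
      E.Σ< N (λ k → t a E.^ k ℚ.* mass k) ℚ.* rest
        ≡⟨ cong₂ ℚ._*_ (sym (seq-factor μ N a j)) (seq-factors μ N as j) ⟩
      seq (factor μ N a) j ℚ.* seq (factors μ N as) j ∎
      where
      open ≡-Reasoning
      mass : ℕ → ℚ
      mass k = seq (poissonMass μ k) j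
      rest : ℚ
      rest = E.Σbox m N λ w → tilt as w ℚ.* seq (jointMass μ w) j
      eq : ∀ a b c d → a ℚ.* b ℚ.* (c ℚ.* d) ≡ a ℚ.* c ℚ.* (b ℚ.* d)
      eq = solve-∀ E.ring

    module _ (0≤t : ∀ a → 0ℚ ℚ.≤ t a) where

      0≤tilt : ∀ {m} (as : Vec A m) w → 0ℚ ℚ.≤ tilt as w
      0≤tilt []       []      = ℚ.nonNegative⁻¹ 1ℚ
      0≤tilt (a ∷ as) (k ∷ w) = E.0≤* (E.0≤^ (0≤t a) k) (0≤tilt as w)

      0≤Σlist-tilt : ∀ {m} (S : List (Vec A m)) w → 0ℚ ℚ.≤ Σlist (λ as → tilt as w) S
      0≤Σlist-tilt []       w = ℚ.≤-refl
      0≤Σlist-tilt (as ∷ S) w = E.0≤+ (0≤tilt as w) (0≤Σlist-tilt S w)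

      1≤Σlist-tilt : ∀ {m} (S : List (Vec A m)) w → Any (λ as → 1ℚ ℚ.≤ tilt as w) S → 1ℚ ℚ.≤ Σlist (λ as → tilt as w) S
      1≤Σlist-tilt (as ∷ S) w (here 1≤)  = ℚ.≤-trans 1≤ (p≤p+ε (tilt as w) (0≤Σlist-tilt S w))
      1≤Σlist-tilt (as ∷ S) w (there ∈S) = ℚ.≤-trans (1≤Σlist-tilt S w ∈S)
        (subst (Σlist (λ bs → tilt bs w) S ℚ.≤_) (ℚ.+-comm _ (tilt as w)) (p≤p+ε _ (0≤tilt as w)))

      module _ {μ : ℝ} (0≤μ : NonNeg μ) where

        0≤μ* : ∀ a → NonNeg (μ * fromℚ (t a))
        0≤μ* a = ev-map (λ j 0≤ → E.0≤* 0≤ (0≤t a)) 0≤μ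

        0≤factor : ∀ N a → NonNeg (factor μ N a)
        0≤factor N a = ev-zip (λ j 0≤e 0≤m → E.0≤* 0≤e (subst (0ℚ ℚ.≤_) (sym (seq-expSum N (μ * fromℚ (t a)) j))
          (Σ<-nonneg N (E.0≤expTerm 0≤m)))) (0≤exp-μ 0≤μ) (0≤μ* a)

        0≤factors : ∀ {m} N (as : Vec A m) → NonNeg (factors μ N as)
        0≤factors N []       = always λ _ → ℚ.nonNegative⁻¹ 1ℚ
        0≤factors N (a ∷ as) = NonNeg-* {factor μ N a} {factors μ N as} (0≤factor N a) (0≤factors N as)

        -- Each truncated generating function is exp (- μ) times a partial sum of exp (μ t), which
        -- lies below its limit because μ t is nonnegative. The exponents - μ + μ t add up to μ
        -- times the excess.
        factors-⊑ : ∀ {m} N (as : Vec A m) → factors μ N as ⊑ exp (μ * fromℚ (excess as))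
        factors-⊑ N [] = ≋⇒⊑ (≋-sym (≋-trans (exp-cong-pointwise {y = 0ℝ} λ j → ℚ.*-zeroʳ (seq μ j)) exp-0))
        factors-⊑ N (a ∷ as) =
          ⊑-trans (*-monoʳ-⊑ {z = factors μ N as} (0≤factors N as)
            (*-monoˡ-⊑ {z = exp (- μ)} (0≤exp-μ 0≤μ) (expSum-⊑-exp {μ * fromℚ (t a)} (0≤μ* a) N)))
          (⊑-trans (*-monoˡ-⊑ {z = exp (- μ) * exp (μ * fromℚ (t a))}
            (NonNeg-* {exp (- μ)} {exp (μ * fromℚ (t a))} (0≤exp-μ 0≤μ) (NonNeg-exp {μ * fromℚ (t a)} (0≤μ* a))) (factors-⊑ N as))
          (≋⇒⊑ (≋-trans (*-cong (≋-sym (exp-+ (- μ) (μ * fromℚ (t a)))) ≋-refl)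
            (≋-sym (exp-pointwise-+ {(- μ) + μ * fromℚ (t a)} {μ * fromℚ (excess as)} λ j → eq (seq μ j) (t a) (excess as))))))
          where
          eq : ∀ p q e → p ℚ.* (q ℚ.- 1ℚ ℚ.+ e) ≡ ℚ.- p ℚ.+ p ℚ.* q ℚ.+ p ℚ.* e
          eq = solve-∀ E.ring

        Σfactors : ∀ {m} → ℕ → List (Vec A m) → ℝ
        Σfactors N []       = 0ℝ
        Σfactors N (as ∷ S) = factors μ N as + Σfactors N S

        seq-Σfactors : ∀ {m} N (S : List (Vec A m)) j →
          E.Σbox m N (λ w → Σlist (λ as → tilt as w) S ℚ.* seq (jointMass μ w) j) ≡ seq (Σfactors N S) j
        seq-Σfactors {m} N S j = trans (Σbox-Σlist m N tilt (λ w → seq (jointMass μ w) j) S) (go S)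
          where
          go : ∀ S → Σlist (λ as → E.Σbox m N λ w → tilt as w ℚ.* seq (jointMass μ w) j) S ≡ seq (Σfactors N S) j
          go []       = refl
          go (as ∷ S) = cong₂ ℚ._+_ (seq-factors μ N as j) (go S)

        Σfactors-⊑ : ∀ {m} {d} N (S : List (Vec A m)) → All (λ as → excess as ≡ d) S →
          Σfactors N S ⊑ fromℕ (length S) * exp (μ * fromℚ d)
        Σfactors-⊑ {d = d} N []       []         = ≋⇒⊑ (≋-pointwise {0ℝ} λ j →
          sym (trans (cong (ℚ._* seq (exp (μ * fromℚ d)) j) E.fromℕ-0) (ℚ.*-zeroˡ (seq (exp (μ * fromℚ d)) j))))
        Σfactors-⊑ {d = d} N (as ∷ S) (refl ∷ d≡) = ⊑-trans (+-mono-⊑ (factors-⊑ N as) (Σfactors-⊑ N S d≡))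
          (≋⇒⊑ (≋-pointwise {y = fromℕ (suc (length S)) * exp (μ * fromℚ d)} λ j → sym (trans
            (cong (ℚ._* seq (exp (μ * fromℚ d)) j) (E.fromℕ-suc (length S))) (eq (E.fromℕ (length S)) (seq (exp (μ * fromℚ d)) j)))))
          where
          eq : ∀ p q → (p ℚ.+ 1ℚ) ℚ.* q ≡ q ℚ.+ p ℚ.* q
          eq p q = trans (ℚ.*-distribʳ-+ q p 1ℚ) (trans (cong (p ℚ.* q ℚ.+_) (ℚ.*-identityˡ q)) (ℚ.+-comm (p ℚ.* q) q))

        -- Markov's inequality and the union bound in one step: on the event some tilt is at least
        -- 1, and all are nonnegative, so the indicator is at most the sum of the tilts. The
        -- resulting bound is the same for all boxes and passes to the limit.
        chernoff : ∀ {m} {Ev : Pred (Vec ℕ m) 0ℓ} (Ev? : Decidable Ev) (S : List (Vec A m)) {d} →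
          All (λ as → excess as ≡ d) S → (∀ w → Ev w → Any (λ as → 1ℚ ℚ.≤ tilt as w) S) →
          ℙ μ Ev? ⊑ fromℕ (length S) * exp (μ * fromℚ d)
        chernoff {m} Ev? S {d} d≡ Ev⇒ = lim-⊑ (partialProbability μ Ev?) (partialProbability-cauchy μ Ev?) λ N →
          ⊑-trans (⊑-pointwise {partialProbability μ Ev? N} {Σfactors N S} (ev-map (λ j 0≤mass →
            subst₂ ℚ._≤_ (sym (seq-Σbox m N (λ w → indicator (Ev? w) * jointMass μ w) j)) (seq-Σfactors N S j)
              (Σbox-mono m N λ w → E.*-monoʳ (0≤mass m w) (indicator≤ w j))) (0≤jointMass 0≤μ)))
          (Σfactors-⊑ N S d≡)
          where
          indicator≤ : ∀ w j → seq (indicator (Ev? w)) j ℚ.≤ Σlist (λ as → tilt as w) S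
          indicator≤ w j with Ev? w
          ... | yes ev = 1≤Σlist-tilt S w (Ev⇒ w ev)
          ... | no  _  = 0≤Σlist-tilt S w

  tally : ∀ {m} → Vec Bool m → Vec ℕ m → ℕ
  tally []           []      = 0
  tally (true  ∷ bs) (k ∷ w) = k ℕ.+ tally bs w
  tally (false ∷ bs) (k ∷ w) = tally bs w

  ^-+ : ∀ q m n → q E.^ (m ℕ.+ n) ≡ q E.^ m ℚ.* q E.^ n
  ^-+ q zero    n = sym (ℚ.*-identityˡ (q E.^ n))
  ^-+ q (suc m) n = trans (cong (q ℚ.*_) (^-+ q m n)) (sym (ℚ.*-assoc q _ _))

  1≤^ : ∀ {q} → 1ℚ ℚ.≤ q → ∀ k → 1ℚ ℚ.≤ q E.^ k
  1≤^ 1≤q zero    = ℚ.≤-refl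
  1≤^ {q} 1≤q (suc k) = ℚ.≤-trans 1≤q (subst (ℚ._≤ q ℚ.* q E.^ k) (ℚ.*-identityʳ q)
    (E.*-monoˡ (ℚ.≤-trans (ℚ.nonNegative⁻¹ 1ℚ) 1≤q) (1≤^ 1≤q k)))

  module _ (y x : ℚ) where

    weight : Bool → ℚ
    weight b = if b then y else x

    tilt-tally : ∀ {m} (bs : Vec Bool m) w →
      tilt weight bs w ≡ y E.^ tally bs w ℚ.* x E.^ tally (Vec.map not bs) w
    tilt-tally []           []      = sym (ℚ.*-identityʳ 1ℚ)
    tilt-tally (true  ∷ bs) (k ∷ w) = trans (cong (y E.^ k ℚ.*_) (tilt-tally bs w))
      (trans (sym (ℚ.*-assoc (y E.^ k) _ _)) (cong (ℚ._* x E.^ tally (Vec.map not bs) w) (sym (^-+ y k (tally bs w)))))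
    tilt-tally (false ∷ bs) (k ∷ w) = trans (cong (x E.^ k ℚ.*_) (tilt-tally bs w))
      (trans (eq (x E.^ k) (y E.^ tally bs w) (x E.^ tally (Vec.map not bs) w))
        (cong (y E.^ tally bs w ℚ.*_) (sym (^-+ x k (tally (Vec.map not bs) w)))))
      where
      eq : ∀ a b c → a ℚ.* (b ℚ.* c) ≡ b ℚ.* (a ℚ.* c)
      eq = solve-∀ E.ring

    -- With C votes for rows marked `true` and I for the others, the tilt is y^C x^I, and y x = 1
    -- leaves x^(I - C).
    1≤tilt : 1ℚ ℚ.≤ x → y ℚ.* x ≡ 1ℚ → ∀ {m} (bs : Vec Bool m) w →
             tally bs w ℕ.≤ tally (Vec.map not bs) w → 1ℚ ℚ.≤ tilt weight bs w
    1≤tilt 1≤x yx≡1 bs w C≤I = subst (1ℚ ℚ.≤_) (sym eq) (1≤^ 1≤x (I ℕ.∸ C))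
      where
      open ≡-Reasoning
      C I : ℕ
      C = tally bs w
      I = tally (Vec.map not bs) w
      1^ : ∀ k → 1ℚ E.^ k ≡ 1ℚ
      1^ zero    = refl
      1^ (suc k) = trans (ℚ.*-identityˡ _) (1^ k)
      eq : tilt weight bs w ≡ x E.^ (I ℕ.∸ C)
      eq = begin
        tilt weight bs w                   ≡⟨ tilt-tally bs w ⟩
        y E.^ C ℚ.* x E.^ I                         ≡⟨ cong (λ i → y E.^ C ℚ.* x E.^ i) (ℕ.m+[n∸m]≡n C≤I) ⟨
        y E.^ C ℚ.* x E.^ (C ℕ.+ (I ℕ.∸ C))         ≡⟨ cong (y E.^ C ℚ.*_) (^-+ x C (I ℕ.∸ C)) ⟩
        y E.^ C ℚ.* (x E.^ C ℚ.* x E.^ (I ℕ.∸ C))   ≡⟨ ℚ.*-assoc (y E.^ C) _ _ ⟨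
        y E.^ C ℚ.* x E.^ C ℚ.* x E.^ (I ℕ.∸ C)     ≡⟨ cong (ℚ._* x E.^ (I ℕ.∸ C)) (^-*-distrib y x C) ⟨
        (y ℚ.* x) E.^ C ℚ.* x E.^ (I ℕ.∸ C)         ≡⟨ cong (λ z → z E.^ C ℚ.* x E.^ (I ℕ.∸ C)) yx≡1 ⟩
        1ℚ E.^ C ℚ.* x E.^ (I ℕ.∸ C)                ≡⟨ cong (ℚ._* x E.^ (I ℕ.∸ C)) (1^ C) ⟩
        1ℚ ℚ.* x E.^ (I ℕ.∸ C)                      ≡⟨ ℚ.*-identityˡ _ ⟩
        x E.^ (I ℕ.∸ C)                             ∎

open import Data.Bool.Base using (Bool; true; false; not; if_then_else_; T; _∧_)
import Data.Bool.Properties as Bool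
open import Data.List.Base as List using (List; []; _∷_; length; filterᵇ; filter; replicate; _++_; cartesianProduct)
import Data.List.Properties as List
open import Data.List.Membership.Propositional using (find; lose)
open import Data.List.Membership.Propositional.Properties using (∈-filter⁺; ∈-filter⁻; ∈-cartesianProduct⁺; ∈-cartesianProduct⁻)
open import Data.List.Relation.Unary.All as All using (All; []; _∷_; all?)
import Data.List.Relation.Unary.All.Properties as All
open import Data.List.Relation.Unary.Any as Any using (Any)
import Data.List.Relation.Unary.Any.Properties as Any
open import Data.Nat.Base as ℕ using (ℕ; zero; suc; z≤n; s≤s; _<ᵇ_)
import Data.Nat.Properties as ℕ
import Data.Nat.Tactic.RingSolver as ℕ
open import Data.Product.Base using (_×_; _,_; ∃; proj₁; proj₂)
open import Data.Rational.Base as ℚ using (ℚ; 0ℚ; 1ℚ; ½)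
import Data.Rational.Properties as ℚ
open import Data.Sum.Base using (inj₁; inj₂)
open import Data.Vec.Base as Vec using (Vec; []; _∷_)
import Data.Vec.Properties as Vec
open import Function.Base using (_∘_; case_of_)
open import Relation.Binary.PropositionalEquality
open import Relation.Unary using (Decidable)
open import Relation.Nullary using (yes; no; contradiction; ¬?)
open import Tactic.RingSolver using (solve-∀)
open import Defs
open Voting using (Row; rows; graph; randomProfile; majorityGraph; candidates; _precedes_)
open RationalExp
open RealExp
open Chernoff
open Precedence using (T⇒true; ≡ᵇ-refl; ≢⇒≡ᵇ)
open Agreement using (top; agree; agreement; count; count-agreement; ∈-candidate; graph-irrefl)

-- From a wrong majority graph to a pair with too few agreeing votes.

length-filter-replicate : ∀ (p : Row → Bool) r k P →
  length (filterᵇ p (replicate k r ++ P)) ≡ (if p r then k else 0) ℕ.+ length (filterᵇ p P)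
length-filter-replicate p r zero    P with p r
... | true  = refl
... | false = refl
length-filter-replicate p r (suc k) P with p r | length-filter-replicate p r k P
... | true  | ih = cong suc ih
... | false | ih = ih

tally-filter : ∀ (p : Row → Bool) {m} (R : Vec Row m) w → length (filterᵇ p (randomProfile R w)) ≡ tally (Vec.map p R) w
tally-filter p []      []      = refl
tally-filter p (r ∷ R) (k ∷ w) = trans (length-filter-replicate p r k (randomProfile R w)) (add (p r))
  where
  add : ∀ b → (if b then k else 0) ℕ.+ length (filterᵇ p (randomProfile R w)) ≡ tally (b ∷ Vec.map p R) (k ∷ w)
  add true  = cong (k ℕ.+_) (tally-filter p R w)
  add false = tally-filter p R w

tally-total : ∀ (p : Row → Bool) {m} (R : Vec Row m) w →
  length (randomProfile R w) ≡ tally (Vec.map p R) w ℕ.+ tally (Vec.map (not ∘ p) R) w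
tally-total p []      []      = refl
tally-total p (r ∷ R) (k ∷ w) = trans (List.length-++ (replicate k r))
  (trans (cong₂ ℕ._+_ (List.length-replicate k) (tally-total p R w)) (add (p r)))
  where
  t f : ℕ
  t = tally (Vec.map p R) w
  f = tally (Vec.map (not ∘ p) R) w
  swap : ∀ a b c → a ℕ.+ (b ℕ.+ c) ≡ b ℕ.+ (a ℕ.+ c)
  swap = ℕ.solve-∀
  add : ∀ b → k ℕ.+ (t ℕ.+ f) ≡ tally (b ∷ Vec.map p R) (k ∷ w) ℕ.+ tally (not b ∷ Vec.map (not ∘ p) R) (k ∷ w)
  add true  = sym (ℕ.+-assoc k t f)
  add false = swap k t f

module _ (p : Row → Bool) {m} (R : Vec Row m) (w : Vec ℕ m) where

  private
    t f : ℕ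
    t = tally (Vec.map p R) w
    f = tally (Vec.map (not ∘ p) R) w

  disagreement : ∀ g → (length (randomProfile R w) <ᵇ 2 ℕ.* length (filterᵇ p (randomProfile R w))) ≢ g →
    tally (Vec.map (agree g ∘ p) R) w ℕ.≤ tally (Vec.map not (Vec.map (agree g ∘ p) R)) w
  disagreement g ≢g rewrite tally-filter p R w | tally-total p R w | ℕ.+-identityʳ t with g
  ... | true  = subst (t ℕ.≤_) (cong (λ bs → tally bs w) (Vec.map-∘ not p R))
    (ℕ.+-cancelˡ-≤ t t f (ℕ.≮⇒≥ λ lt → ≢g (T⇒true (ℕ.<⇒<ᵇ lt))))
  ... | false = subst (f ℕ.≤_) (cong (λ bs → tally bs w) (trans (Vec.map-cong (λ r → sym (Bool.not-involutive (p r))) R) (Vec.map-∘ not (not ∘ p) R)))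
    (ℕ.+-cancelˡ-≤ t f t (ℕ.<⇒≤ (ℕ.<ᵇ⇒< (t ℕ.+ f) (t ℕ.+ t) (subst T (sym (Bool.¬-not ≢g)) _))))

pairs : ℕ → List (ℕ × ℕ)
pairs k = filter (λ (a , b) → ¬? (a ℕ.≟ b)) (cartesianProduct (candidates (top k)) (candidates (top k)))

length-cartesianProduct : ∀ {A B : Set} (xs : List A) (ys : List B) → length (cartesianProduct xs ys) ≡ length xs ℕ.* length ys
length-cartesianProduct []       ys = refl
length-cartesianProduct (x ∷ xs) ys = trans (List.length-++ (List.map (x ,_) ys))
  (cong₂ ℕ._+_ (List.length-map (x ,_) ys) (length-cartesianProduct xs ys))

length-candidates : ∀ M → length (candidates M) ≡ M
length-candidates M = trans (List.length-map suc (List.upTo M)) (List.length-upTo M)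

length-pairs : ∀ k → length (pairs k) ℕ.≤ top k ℕ.* top k
length-pairs k = ℕ.≤-trans (List.length-filter (λ (a , b) → ¬? (a ℕ.≟ b)) (cartesianProduct (candidates (top k)) (candidates (top k))))
  (ℕ.≤-reflexive (trans (length-cartesianProduct (candidates (top k)) (candidates (top k))) (cong₂ ℕ._*_ (length-candidates (top k)) (length-candidates (top k)))))

agreements : ∀ k → List (Vec Bool (size k))
agreements k = List.map (λ (a , b) → agreement k a b) (pairs k)

count-agreements : ∀ k → All (λ bs → count bs ≡ 2 ℕ.* (3 ℕ.+ k)) (agreements k)
count-agreements k = All.map⁺ (All.tabulate λ { {a , b} ab∈ →
  let (ab∈V² , a≢b) = ∈-filter⁻ (λ (a , b) → ¬? (a ℕ.≟ b)) ab∈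
      (a∈ , b∈) = ∈-cartesianProduct⁻ (candidates (top k)) (candidates (top k)) ab∈V² in
  count-agreement k (∈-candidate a∈) (∈-candidate b∈) a≢b })

F-disagreement : ∀ k w → F k w → Any (λ bs → tally bs w ℕ.≤ tally (Vec.map not bs) w) (agreements k)
F-disagreement k w ≢G = disagree
  where
  V : List ℕ
  V = candidates (top k)
  H : ℕ → ℕ → Bool
  H = majorityGraph (randomProfile (rows k) w)
  majority : ℕ → ℕ → Bool
  majority a b = length (randomProfile (rows k) w) <ᵇ 2 ℕ.* length (filterᵇ (a precedes b) (randomProfile (rows k) w))
  disagree : Any (λ bs → tally bs w ℕ.≤ tally (Vec.map not bs) w) (agreements k)
  disagree with find (All.¬All⇒Any¬ (λ a → all? (λ b → H a b Bool.≟ graph k a b) V) V ≢G)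
  ... | a , a∈ , ¬all with find (All.¬All⇒Any¬ (λ b → H a b Bool.≟ graph k a b) V ¬all)
  ... | b , b∈ , H≢ with a ℕ.≟ b
  -- No error can occur on the diagonal, where both graphs are false, so only distinct candidates
  -- enter the union bound.
  ...   | yes refl = contradiction (trans (cong (λ e → not e ∧ majority a a) (≡ᵇ-refl a)) (sym (graph-irrefl k a))) H≢
  ...   | no a≢b   = Any.map⁺ (lose (∈-filter⁺ (λ (a , b) → ¬? (a ℕ.≟ b)) (∈-cartesianProduct⁺ a∈ b∈) a≢b)
    (disagreement (a precedes b) (rows k) w (graph k a b) λ eq →
      H≢ (trans (cong (λ e → not e ∧ majority a b) (≢⇒≡ᵇ a≢b)) eq)))

count-not : ∀ {m} (bs : Vec Bool m) → count bs ℕ.+ count (Vec.map not bs) ≡ m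
count-not []           = refl
count-not (true  ∷ bs) = cong suc (count-not bs)
count-not (false ∷ bs) = trans (ℕ.+-suc (count bs) _) (cong suc (count-not bs))

-- With p = 2n - 1, the tilts (p + 1) / p and p / (p + 1) make the excess of p + 1 agreeing and p - 1
-- disagreeing rows exactly - 1 / p.
module _ (q : ℕ) where

  private
    r r′ : ℚ
    r = E.1/ℕ (suc q)
    r′ = E.1/ℕ (suc (suc q))

  up down : ℚ
  up   = E.fromℕ (suc (suc q)) ℚ.* r
  down = E.fromℕ (suc q) ℚ.* r′

  up≡ : up ≡ 1ℚ ℚ.+ r
  up≡ = trans (cong (ℚ._* r) (E.fromℕ-suc (suc q))) (trans (ℚ.*-distribʳ-+ r (E.fromℕ (suc q)) 1ℚ)
    (cong₂ ℚ._+_ (E.fromℕ*1/ℕ q) (ℚ.*-identityˡ r)))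

  0≤down : 0ℚ ℚ.≤ down
  0≤down = E.0≤* (E.0≤fromℕ (suc q)) (E.0≤1/ℕ (suc (suc q)))

  1≤up : 1ℚ ℚ.≤ up
  1≤up = subst (1ℚ ℚ.≤_) (sym up≡) (p≤p+ε 1ℚ (E.0≤1/ℕ (suc q)))

  down*up : down ℚ.* up ≡ 1ℚ
  down*up = trans (swap (E.fromℕ (suc q)) r′ (E.fromℕ (suc (suc q))) r)
    (trans (cong₂ ℚ._*_ (E.fromℕ*1/ℕ q) (E.fromℕ*1/ℕ (suc q))) (ℚ.*-identityˡ 1ℚ))
    where
    swap : ∀ a b c d → a ℚ.* b ℚ.* (c ℚ.* d) ≡ a ℚ.* d ℚ.* (c ℚ.* b)
    swap = solve-∀ E.ring

  t : Bool → ℚ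
  t = weight down up

  0≤t : ∀ b → 0ℚ ℚ.≤ t b
  0≤t true  = 0≤down
  0≤t false = ℚ.≤-trans (ℚ.nonNegative⁻¹ 1ℚ) 1≤up

  excess-count : ∀ {m} (bs : Vec Bool m) → excess t bs ≡
    E.fromℕ (count bs) ℚ.* (down ℚ.- 1ℚ) ℚ.+ E.fromℕ (count (Vec.map not bs)) ℚ.* (up ℚ.- 1ℚ)
  excess-count []           = sym (trans (cong (λ z → z ℚ.* (down ℚ.- 1ℚ) ℚ.+ z ℚ.* (up ℚ.- 1ℚ)) E.fromℕ-0)
    (cong₂ ℚ._+_ (ℚ.*-zeroˡ (down ℚ.- 1ℚ)) (ℚ.*-zeroˡ (up ℚ.- 1ℚ))))
  excess-count (true  ∷ bs) = trans (cong (down ℚ.- 1ℚ ℚ.+_) (excess-count bs))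
    (trans (add (down ℚ.- 1ℚ) (up ℚ.- 1ℚ) (E.fromℕ (count bs)) (E.fromℕ (count (Vec.map not bs))))
      (cong (λ z → z ℚ.* (down ℚ.- 1ℚ) ℚ.+ E.fromℕ (count (Vec.map not bs)) ℚ.* (up ℚ.- 1ℚ)) (sym (E.fromℕ-suc (count bs)))))
    where
    add : ∀ d u a b → d ℚ.+ (a ℚ.* d ℚ.+ b ℚ.* u) ≡ (a ℚ.+ 1ℚ) ℚ.* d ℚ.+ b ℚ.* u
    add = solve-∀ E.ring
  excess-count (false ∷ bs) = trans (cong (up ℚ.- 1ℚ ℚ.+_) (excess-count bs))
    (trans (add (down ℚ.- 1ℚ) (up ℚ.- 1ℚ) (E.fromℕ (count bs)) (E.fromℕ (count (Vec.map not bs))))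
      (cong (λ z → E.fromℕ (count bs) ℚ.* (down ℚ.- 1ℚ) ℚ.+ z ℚ.* (up ℚ.- 1ℚ)) (sym (E.fromℕ-suc (count (Vec.map not bs))))))
    where
    add : ∀ d u a b → u ℚ.+ (a ℚ.* d ℚ.+ b ℚ.* u) ≡ a ℚ.* d ℚ.+ (b ℚ.+ 1ℚ) ℚ.* u
    add = solve-∀ E.ring

  excess-value : E.fromℕ (suc (suc q)) ℚ.* (down ℚ.- 1ℚ) ℚ.+ E.fromℕ q ℚ.* (up ℚ.- 1ℚ) ≡ ℚ.- r
  excess-value = begin
    c ℚ.* (b ℚ.* r′ ℚ.- 1ℚ) ℚ.+ a ℚ.* (up ℚ.- 1ℚ)
      ≡⟨ cong (λ z → c ℚ.* (b ℚ.* r′ ℚ.- 1ℚ) ℚ.+ a ℚ.* (z ℚ.- 1ℚ)) up≡ ⟩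
    c ℚ.* (b ℚ.* r′ ℚ.- 1ℚ) ℚ.+ a ℚ.* (1ℚ ℚ.+ r ℚ.- 1ℚ)
      ≡⟨ expand a b c r r′ ⟩
    b ℚ.* (c ℚ.* r′) ℚ.- c ℚ.+ ((a ℚ.+ 1ℚ) ℚ.* r ℚ.- r)
      ≡⟨ cong₂ (λ y z → b ℚ.* y ℚ.- c ℚ.+ (z ℚ.- r)) (E.fromℕ*1/ℕ (suc q))
           (trans (cong (ℚ._* r) (sym (E.fromℕ-suc q))) (E.fromℕ*1/ℕ q)) ⟩
    b ℚ.* 1ℚ ℚ.- c ℚ.+ (1ℚ ℚ.- r)
      ≡⟨ cong (λ z → b ℚ.* 1ℚ ℚ.- z ℚ.+ (1ℚ ℚ.- r)) (E.fromℕ-suc (suc q)) ⟩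
    b ℚ.* 1ℚ ℚ.- (b ℚ.+ 1ℚ) ℚ.+ (1ℚ ℚ.- r)
      ≡⟨ cancel b r ⟩
    ℚ.- r ∎
    where
    open ≡-Reasoning
    a b c : ℚ
    a = E.fromℕ q
    b = E.fromℕ (suc q)
    c = E.fromℕ (suc (suc q))
    expand : ∀ a b c r r′ → c ℚ.* (b ℚ.* r′ ℚ.- 1ℚ) ℚ.+ a ℚ.* (1ℚ ℚ.+ r ℚ.- 1ℚ) ≡ b ℚ.* (c ℚ.* r′) ℚ.- c ℚ.+ ((a ℚ.+ 1ℚ) ℚ.* r ℚ.- r)
    expand = solve-∀ E.ring
    cancel : ∀ b r → b ℚ.* 1ℚ ℚ.- (b ℚ.+ 1ℚ) ℚ.+ (1ℚ ℚ.- r) ≡ ℚ.- r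
    cancel = solve-∀ E.ring

  excess≡ : ∀ {m} (bs : Vec Bool m) → count bs ≡ suc (suc q) → m ≡ suc (suc q) ℕ.+ q → excess t bs ≡ ℚ.- r
  excess≡ {m} bs C m≡ = trans (excess-count bs) (trans (cong₂ (λ i j → E.fromℕ i ℚ.* (down ℚ.- 1ℚ) ℚ.+ E.fromℕ j ℚ.* (up ℚ.- 1ℚ)) C
    (ℕ.+-cancelˡ-≡ (suc (suc q)) _ q (trans (cong (ℕ._+ count (Vec.map not bs)) (sym C)) (trans (count-not bs) m≡)))) excess-value)

  tilted-bound : ∀ {m μ} {Ev : Vec ℕ m → Set} (Ev? : Decidable Ev) → NonNeg μ → (S : List (Vec Bool m)) →
    All (λ bs → count bs ≡ suc (suc q)) S → m ≡ suc (suc q) ℕ.+ q →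
    (∀ w → Ev w → Any (λ bs → tally bs w ℕ.≤ tally (Vec.map not bs) w) S) →
    ℙ μ Ev? ⊑ fromℕ (length S) * exp (μ * fromℚ (ℚ.- r))
  tilted-bound Ev? 0≤μ S C m≡ Ev⇒ = chernoff t 0≤t 0≤μ Ev? S (All.map (λ {bs} c → excess≡ bs c m≡) C)
    λ w ev → Any.map (λ {bs} → 1≤tilt down up 1≤up down*up bs w) (Ev⇒ w ev)

-- The explicit exponent and the constant 16 ln 2.

exp-multiple : ∀ {ln2} → exp ln2 ≋ fromℕ 2 → ∀ n → exp (fromℕ n * ln2) ≋ fromℕ (2 ℕ.^ n)
exp-multiple {ln2} e zero = ≋-trans (exp-cong-pointwise {fromℕ 0 * ln2} {0ℝ} λ j → trans (cong (ℚ._* seq ln2 j) E.fromℕ-0) (ℚ.*-zeroˡ (seq ln2 j)))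
  (≋-trans exp-0 (≋-pointwise λ j → sym E.fromℕ-1))
exp-multiple {ln2} e (suc n) = ≋-trans (exp-pointwise-+ {ln2} {fromℕ n * ln2} {fromℕ (suc n) * ln2} λ j →
    trans (cong (ℚ._* seq ln2 j) (E.fromℕ-suc n)) (eq (E.fromℕ n) (seq ln2 j)))
  (≋-trans (*-cong e (exp-multiple e n)) (≋-pointwise λ j → sym (fromℕ-* 2 (2 ℕ.^ n))))
  where
  eq : ∀ n l → (n ℚ.+ 1ℚ) ℚ.* l ≡ l ℚ.+ n ℚ.* l
  eq = solve-∀ E.ring

2n-1 : ℕ → ℕ
2n-1 k = 5 ℕ.+ 2 ℕ.* k

-- The two equal summands come from the 2ⁿ * 2ⁿ pairs, the last one from the excess - 1 / (2n - 1)
-- at the rate ν / (4n - 2) of each row.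
exponent : ℝ → ℕ → ℝ → ℝ
exponent ln2 k ν = (fromℕ (3 ℕ.+ k) * ln2 + fromℕ (3 ℕ.+ k) * ln2) + (ν ÷ size k) * fromℚ (ℚ.- E.1/ℕ (2n-1 k))

ℙF-⊑ : ∀ {ln2} → exp ln2 ≋ fromℕ 2 → ∀ k {ν} → NonNeg ν → ℙF k ν ⊑ exp (exponent ln2 k ν)
ℙF-⊑ {ln2} e k {ν} 0≤ν =
  -- The parameter q is 2n - 2, so that q + 2 = 2n rows agree and q disagree.
  ⊑-trans (tilted-bound (4 ℕ.+ 2 ℕ.* k) {μ = μ} (F? k) 0≤μ (agreements k)
    (All.map (λ c → trans c (ℕ.*-distribˡ-+ 2 3 k)) (count-agreements k)) (size≡ k) (F-disagreement k))
  (⊑-trans (*-monoʳ-⊑ {fromℕ (length (agreements k))} {fromℕ (top k ℕ.* top k)} {exp X} 0≤expX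
    (⊑-pointwise (always λ j → E.fromℕ-mono (ℕ.≤-trans (ℕ.≤-reflexive (List.length-map _ (pairs k))) (length-pairs k)))))
  (≋⇒⊑ (≋-trans (*-cong tops ≋-refl) (≋-sym (exp-+ (Y + Y) X)))))
  where
  μ X Y : ℝ
  μ = ν ÷ size k
  X = μ * fromℚ (ℚ.- E.1/ℕ (2n-1 k))
  Y = fromℕ (3 ℕ.+ k) * ln2
  0≤μ : NonNeg μ
  0≤μ = ev-map (λ j 0≤ → E.0≤* 0≤ (E.0≤1/ℕ (size k))) 0≤ν
  0≤expX : NonNeg (exp X)
  0≤expX = PosBelow⇒NonNeg {exp X} (exp-pos {X} (ev-map (λ j 0≤ → subst (ℚ._≤ 0ℚ) (ℚ.neg-distribʳ-* (seq μ j) (E.1/ℕ (2n-1 k)))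
    (ℚ.neg-antimono-≤ (E.0≤* 0≤ (E.0≤1/ℕ (2n-1 k))))) 0≤μ))
  tops : fromℕ (top k ℕ.* top k) ≋ exp (Y + Y)
  tops = ≋-trans (≋-pointwise λ j → fromℕ-* (top k) (top k)) (≋-sym (≋-trans (exp-+ Y Y) (*-cong (exp-multiple e (3 ℕ.+ k)) (exp-multiple e (3 ℕ.+ k)))))
  size≡ : ∀ k → 10 ℕ.+ k ℕ.* 4 ≡ suc (suc (4 ℕ.+ 2 ℕ.* k)) ℕ.+ (4 ℕ.+ 2 ℕ.* k)
  size≡ = ℕ.solve-∀

1/ℕ-antitone : ∀ {m n} .{{_ : ℕ.NonZero m}} .{{_ : ℕ.NonZero n}} → m ℕ.≤ n → E.1/ℕ n ℚ.≤ E.1/ℕ m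
1/ℕ-antitone {suc m} {suc n} (s≤s m≤n) = E.1/ℕ-anti m n m≤n

-- 8n² exceeds (4n - 2)(2n - 1) by 8n - 2, which is 22 + 8k. The form n / n³ instead of 1 / n² fits
-- the quotient λ_n / n³ of the hypothesis.
rate : ∀ k .{{_ : ℕ.NonZero ((3 ℕ.+ k) ℕ.^ 3)}} →
  E.1/ℕ 8 ℚ.* (E.fromℕ (3 ℕ.+ k) ℚ.* E.1/ℕ ((3 ℕ.+ k) ℕ.^ 3)) ℚ.≤ E.1/ℕ (size k) ℚ.* E.1/ℕ (2n-1 k)
rate k = begin
  E.1/ℕ 8 ℚ.* (E.fromℕ n ℚ.* E.1/ℕ (n ℕ.^ 3))                ≡⟨ cong (λ z → E.1/ℕ 8 ℚ.* (E.fromℕ n ℚ.* z)) (E.1/ℕ-* n (n ℕ.^ 2)) ⟩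
  E.1/ℕ 8 ℚ.* (E.fromℕ n ℚ.* (E.1/ℕ n ℚ.* E.1/ℕ (n ℕ.^ 2)))   ≡⟨ cong (E.1/ℕ 8 ℚ.*_) (sym (ℚ.*-assoc (E.fromℕ n) (E.1/ℕ n) (E.1/ℕ (n ℕ.^ 2)))) ⟩
  E.1/ℕ 8 ℚ.* (E.fromℕ n ℚ.* E.1/ℕ n ℚ.* E.1/ℕ (n ℕ.^ 2))     ≡⟨ cong (λ z → E.1/ℕ 8 ℚ.* (z ℚ.* E.1/ℕ (n ℕ.^ 2))) (E.fromℕ*1/ℕ (2 ℕ.+ k)) ⟩
  E.1/ℕ 8 ℚ.* (1ℚ ℚ.* E.1/ℕ (n ℕ.^ 2))                       ≡⟨ cong (E.1/ℕ 8 ℚ.*_) (ℚ.*-identityˡ (E.1/ℕ (n ℕ.^ 2))) ⟩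
  E.1/ℕ 8 ℚ.* E.1/ℕ (n ℕ.^ 2)                                ≡⟨ E.1/ℕ-* 8 (n ℕ.^ 2) ⟨
  E.1/ℕ (8 ℕ.* n ℕ.^ 2)                                      ≤⟨ 1/ℕ-antitone {size k ℕ.* 2n-1 k} (subst (size k ℕ.* 2n-1 k ℕ.≤_) (sym (expand k)) (ℕ.m≤m+n _ _)) ⟩
  E.1/ℕ (size k ℕ.* 2n-1 k)                                     ≡⟨ E.1/ℕ-* (size k) (2n-1 k) ⟩
  E.1/ℕ (size k) ℚ.* E.1/ℕ (2n-1 k)                             ∎
  where
  open ℚ.≤-Reasoning
  n : ℕ
  n = 3 ℕ.+ k
  instance
    n²≢0 : ℕ.NonZero (n ℕ.^ 2)
    n²≢0 = ℕ.m^n≢0 n 2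
    8n²≢0 : ℕ.NonZero (8 ℕ.* n ℕ.^ 2)
    8n²≢0 = ℕ.m*n≢0 8 (n ℕ.^ 2)
  expand : ∀ k → 8 ℕ.* ((3 ℕ.+ k) ℕ.* ((3 ℕ.+ k) ℕ.* 1)) ≡ (10 ℕ.+ k ℕ.* 4) ℕ.* (5 ℕ.+ 2 ℕ.* k) ℕ.+ (22 ℕ.+ 8 ℕ.* k)
  expand = ℕ.solve-∀

1/8*16 : E.1/ℕ 8 ℚ.* E.fromℕ 16 ≡ 1ℚ ℚ.+ 1ℚ
1/8*16 = begin
  E.1/ℕ 8 ℚ.* E.fromℕ 16                    ≡⟨ cong (E.1/ℕ 8 ℚ.*_) (fromℕ-* 8 2) ⟩
  E.1/ℕ 8 ℚ.* (E.fromℕ 8 ℚ.* E.fromℕ 2)     ≡⟨ swap (E.1/ℕ 8) (E.fromℕ 8) (E.fromℕ 2) ⟩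
  E.fromℕ 8 ℚ.* E.1/ℕ 8 ℚ.* E.fromℕ 2       ≡⟨ cong (ℚ._* E.fromℕ 2) (E.fromℕ*1/ℕ 7) ⟩
  1ℚ ℚ.* E.fromℕ 2                          ≡⟨ ℚ.*-identityˡ (E.fromℕ 2) ⟩
  E.fromℕ 2                                 ≡⟨ E.fromℕ-suc 1 ⟩
  E.fromℕ 1 ℚ.+ 1ℚ                          ≡⟨ cong (ℚ._+ 1ℚ) E.fromℕ-1 ⟩
  1ℚ ℚ.+ 1ℚ                                 ∎
  where
  open ≡-Reasoning
  swap : ∀ a b c → a ℚ.* (b ℚ.* c) ≡ b ℚ.* a ℚ.* c
  swap = solve-∀ E.ring

-- The hypothesis is multiplied by n/8: 16 ln 2 becomes 2n ln 2 and cancels the cost of the union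
-- bound, and δ becomes the surplus n δ/8.
exponent-≤ : ∀ ln2 k ν δ .{{_ : ℕ.NonZero ((3 ℕ.+ k) ℕ.^ 3)}} j → 0ℚ ℚ.≤ seq ν j →
  E.fromℕ 16 ℚ.* seq ln2 j ℚ.+ δ ℚ.≤ seq ν j ℚ.* E.1/ℕ ((3 ℕ.+ k) ℕ.^ 3) →
  seq (exponent ln2 k ν) j ℚ.≤ ℚ.- (E.1/ℕ 8 ℚ.* δ ℚ.* E.fromℕ (3 ℕ.+ k))
exponent-≤ ln2 k ν δ j 0≤v hyp = begin
  n ℚ.* l ℚ.+ n ℚ.* l ℚ.+ v ℚ.* s ℚ.* (ℚ.- r)                 ≡⟨ eq₁ (n ℚ.* l) v s r ⟩
  n ℚ.* l ℚ.+ n ℚ.* l ℚ.- v ℚ.* (s ℚ.* r)                     ≤⟨ ℚ.+-monoʳ-≤ (n ℚ.* l ℚ.+ n ℚ.* l) (ℚ.neg-antimono-≤ gain) ⟩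
  n ℚ.* l ℚ.+ n ℚ.* l ℚ.- e ℚ.* n ℚ.* (E.fromℕ 16 ℚ.* l ℚ.+ δ) ≡⟨ eq₂ n l e (E.fromℕ 16) δ ⟩
  n ℚ.* l ℚ.+ n ℚ.* l ℚ.- (e ℚ.* E.fromℕ 16 ℚ.* (n ℚ.* l) ℚ.+ e ℚ.* δ ℚ.* n)
    ≡⟨ cong (λ z → n ℚ.* l ℚ.+ n ℚ.* l ℚ.- (z ℚ.* (n ℚ.* l) ℚ.+ e ℚ.* δ ℚ.* n)) 1/8*16 ⟩
  n ℚ.* l ℚ.+ n ℚ.* l ℚ.- ((1ℚ ℚ.+ 1ℚ) ℚ.* (n ℚ.* l) ℚ.+ e ℚ.* δ ℚ.* n)
    ≡⟨ eq₃ (n ℚ.* l) (e ℚ.* δ ℚ.* n) ⟩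
  ℚ.- (e ℚ.* δ ℚ.* n) ∎
  where
  open ℚ.≤-Reasoning
  n l v s r e c : ℚ
  n = E.fromℕ (3 ℕ.+ k)
  l = seq ln2 j
  v = seq ν j
  s = E.1/ℕ (size k)
  r = E.1/ℕ (2n-1 k)
  e = E.1/ℕ 8
  c = E.1/ℕ ((3 ℕ.+ k) ℕ.^ 3)
  swap : ∀ e n v c → e ℚ.* n ℚ.* (v ℚ.* c) ≡ v ℚ.* (e ℚ.* (n ℚ.* c))
  swap = solve-∀ E.ring
  gain : e ℚ.* n ℚ.* (E.fromℕ 16 ℚ.* l ℚ.+ δ) ℚ.≤ v ℚ.* (s ℚ.* r)
  gain = begin
    e ℚ.* n ℚ.* (E.fromℕ 16 ℚ.* l ℚ.+ δ)  ≤⟨ E.*-monoˡ (E.0≤* (E.0≤1/ℕ 8) (E.0≤fromℕ (3 ℕ.+ k))) hyp ⟩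
    e ℚ.* n ℚ.* (v ℚ.* c)                 ≡⟨ swap e n v c ⟩
    v ℚ.* (e ℚ.* (n ℚ.* c))               ≤⟨ E.*-monoˡ 0≤v (rate k) ⟩
    v ℚ.* (s ℚ.* r)                       ∎
  eq₁ : ∀ y v s r → y ℚ.+ y ℚ.+ v ℚ.* s ℚ.* (ℚ.- r) ≡ y ℚ.+ y ℚ.- v ℚ.* (s ℚ.* r)
  eq₁ = solve-∀ E.ring
  eq₂ : ∀ n l e x δ → n ℚ.* l ℚ.+ n ℚ.* l ℚ.- e ℚ.* n ℚ.* (x ℚ.* l ℚ.+ δ) ≡ n ℚ.* l ℚ.+ n ℚ.* l ℚ.- (e ℚ.* x ℚ.* (n ℚ.* l) ℚ.+ e ℚ.* δ ℚ.* n)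
  eq₂ = solve-∀ E.ring
  eq₃ : ∀ y z → y ℚ.+ y ℚ.- ((1ℚ ℚ.+ 1ℚ) ℚ.* y ℚ.+ z) ≡ ℚ.- z
  eq₃ = solve-∀ E.ring

-- Strict bounds, finitely many exceptions, and decay of the geometric bound.

-- `_<_` compares independent indices, so x m must first be moved to x n. Of the gap ε, a quarter
-- pays for this, a quarter for x ⊑ y, and half remains as the witness of strictness.
⊑-< : ∀ {x y z ε} → 0ℚ ℚ.< ε → x ⊑ y → Eventually (λ j → seq y j ℚ.+ ε ℚ.≤ seq z j) → x < z
⊑-< {x} {y} {z} {ε} 0<ε x⊑y (N₂ , y+ε≤z) =
  let (N₁ , x≤y) = _⊑_.bounded x⊑y (η ℚ.* ½) (E.0<½* 0<η)
      (N₀ , x~x) = cauchy x (η ℚ.* ½) (E.0<½* 0<η) in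
  η , 0<η , (N₀ ℕ.⊔ N₁) ℕ.⊔ N₂ , λ m n ≤m ≤n →
    let N₀≤ : ∀ {i} → (N₀ ℕ.⊔ N₁) ℕ.⊔ N₂ ℕ.≤ i → N₀ ℕ.≤ i
        N₀≤ ≤i = ℕ.m⊔n≤o⇒m≤o N₀ N₁ (ℕ.m⊔n≤o⇒m≤o (N₀ ℕ.⊔ N₁) N₂ ≤i) in begin
    seq x m ℚ.+ η
      ≤⟨ ℚ.+-monoˡ-≤ η (ℚ.≤-trans (p≤q+∣p-q∣ (seq x m) (seq x n)) (ℚ.+-mono-≤
           (x≤y n (ℕ.m⊔n≤o⇒n≤o N₀ N₁ (ℕ.m⊔n≤o⇒m≤o (N₀ ℕ.⊔ N₁) N₂ ≤n))) (x~x m n (N₀≤ ≤m) (N₀≤ ≤n)))) ⟩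
    seq y n ℚ.+ η ℚ.* ½ ℚ.+ η ℚ.* ½ ℚ.+ η   ≡⟨ cong (ℚ._+ η) (trans (ℚ.+-assoc (seq y n) _ _) (cong (seq y n ℚ.+_) (E.halves η))) ⟩
    seq y n ℚ.+ η ℚ.+ η                     ≡⟨ trans (ℚ.+-assoc (seq y n) η η) (cong (seq y n ℚ.+_) (E.halves ε)) ⟩
    seq y n ℚ.+ ε                           ≤⟨ y+ε≤z n (ℕ.m⊔n≤o⇒n≤o (N₀ ℕ.⊔ N₁) N₂ ≤n) ⟩
    seq z n                                 ∎
  where
  open ℚ.≤-Reasoning
  η : ℚ
  η = ε ℚ.* ½
  0<η : 0ℚ ℚ.< η
  0<η = E.0<½* 0<ε

-- Strictness costs one further copy of y, which is bounded below by a positive rational.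
<-multiple : ∀ {x y} c → PosBelow y → x ⊑ fromℕ c * y → x < fromℕ (suc c) * y
<-multiple {x} {y} c (q , 0<q , q≤y) x⊑ = ⊑-< {x} {fromℕ c * y} {fromℕ (suc c) * y} 0<q x⊑
  (ev-map (λ j q≤ → ℚ.≤-trans (ℚ.+-monoʳ-≤ (E.fromℕ c ℚ.* seq y j) q≤) (ℚ.≤-reflexive
    (trans (eq (E.fromℕ c) (seq y j)) (cong (ℚ._* seq y j) (sym (E.fromℕ-suc c)))))) q≤y)
  where
  eq : ∀ c y → c ℚ.* y ℚ.+ y ≡ (c ℚ.+ 1ℚ) ℚ.* y
  eq = solve-∀ E.ring

1≤fromℕ* : ∀ {q} → 0ℚ ℚ.< q → ∃ λ n → 1ℚ ℚ.≤ E.fromℕ (suc n) ℚ.* q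
1≤fromℕ* {q} 0<q with E.below 0<q
... | n , 1/n≤q = n , subst (ℚ._≤ E.fromℕ (suc n) ℚ.* q) (E.fromℕ*1/ℕ n) (E.*-monoˡ (E.0≤fromℕ (suc n)) 1/n≤q)

-- Archimedean property: x is at most some b, y is at least q, and some multiple (n + 1) q reaches
-- 1.
dominated : ∀ x {y} → PosBelow y → ∃ λ c → x ⊑ fromℕ c * y
dominated x {y} (q , 0<q , q≤y) =
  let (b , ∣x∣≤b) = seq-bounded x
      (n , 1≤nq) = 1≤fromℕ* 0<q in
  b ℕ.* suc n , ⊑-pointwise {x} {fromℕ (b ℕ.* suc n) * y} (ev-zip (λ j x≤ q≤ → begin
    seq x j                                          ≤⟨ E.p≤∣p∣ (seq x j) ⟩
    ℚ.∣ seq x j ∣                                    ≤⟨ x≤ ⟩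
    E.fromℕ b                                        ≡⟨ ℚ.*-identityʳ (E.fromℕ b) ⟨
    E.fromℕ b ℚ.* 1ℚ                                 ≤⟨ E.*-monoˡ (E.0≤fromℕ b) (ℚ.≤-trans 1≤nq (E.*-monoˡ (E.0≤fromℕ (suc n)) q≤)) ⟩
    E.fromℕ b ℚ.* (E.fromℕ (suc n) ℚ.* seq y j)      ≡⟨ ℚ.*-assoc (E.fromℕ b) _ _ ⟨
    E.fromℕ b ℚ.* E.fromℕ (suc n) ℚ.* seq y j        ≡⟨ cong (ℚ._* seq y j) (fromℕ-* b (suc n)) ⟨
    E.fromℕ (b ℕ.* suc n) ℚ.* seq y j                ∎) ∣x∣≤b q≤y)
  where open ℚ.≤-Reasoning

multiple-mono : ∀ {x y c d} → NonNeg y → c ℕ.≤ d → x ⊑ fromℕ c * y → x ⊑ fromℕ d * y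
multiple-mono {x} {y} {c} {d} 0≤y c≤d x⊑ = ⊑-trans x⊑ (*-monoʳ-⊑ {fromℕ c} {fromℕ d} {y} 0≤y (⊑-pointwise (always λ _ → E.fromℕ-mono c≤d)))

uniformly-dominated : ∀ (P Q : ℕ → ℝ) → (∀ k → PosBelow (Q k)) → ∀ N → (∀ k → N ℕ.≤ k → P k ⊑ Q k) →
  -- The finitely many k below N are dominated one by one and share the largest constant. The
  -- successor makes the constant at least 1, as the range N ≤ k requires.
  ∃ λ c → ∀ k → P k ⊑ fromℕ c * Q k
uniformly-dominated P Q 0<Q N P⊑Q = suc (proj₁ (below N)) , bound
  where
  raise : ∀ k {c d} → c ℕ.≤ d → P k ⊑ fromℕ c * Q k → P k ⊑ fromℕ d * Q k
  raise k = multiple-mono {y = Q k} (PosBelow⇒NonNeg {Q k} (0<Q k))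
  below : ∀ N → ∃ λ c → ∀ k → k ℕ.< N → P k ⊑ fromℕ c * Q k
  below zero    = 0 , λ _ ()
  below (suc N) = let (c , P⊑) = below N ; (d , PN⊑) = dominated (P N) {Q N} (0<Q N) in
    c ℕ.⊔ d , λ k k<1+N → case ℕ.m≤n⇒m<n∨m≡n (ℕ.≤-pred k<1+N) of λ where
      (inj₁ k<N)  → raise k (ℕ.m≤m⊔n c d) (P⊑ k k<N)
      (inj₂ refl) → raise k (ℕ.m≤n⊔m c d) PN⊑
  bound : ∀ k → P k ⊑ fromℕ (suc (proj₁ (below N))) * Q k
  bound k with ℕ.<-≤-connex k N
  ... | inj₁ k<N = raise k (ℕ.n≤1+n _) (proj₂ (below N) k k<N)
  ... | inj₂ N≤k = raise k (s≤s z≤n) (⊑-trans (P⊑Q k N≤k) (≋⇒⊑ (≋-pointwise {Q k} {fromℕ 1 * Q k} λ j →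
    sym (trans (cong (ℚ._* seq (Q k) j) E.fromℕ-1) (ℚ.*-identityˡ (seq (Q k) j))))))

x⊑exp : ∀ {x} → NonNeg x → x ⊑ exp x
x⊑exp {x} 0≤x = ⊑-trans (⊑-pointwise {x} {Σ< 2 (expTerm x)} (always λ j → subst (seq x j ℚ.≤_)
    (sym (trans (seq-expSum 2 x j) (cong₂ (λ s t → 0ℚ ℚ.+ s ℚ.+ t) (expTerm-0 (seq x j)) (first (seq x j)))))
    (subst (seq x j ℚ.≤_) (eq (seq x j)) (p≤p+ε (seq x j) (ℚ.nonNegative⁻¹ 1ℚ)))))
  (expSum-⊑-exp {x} 0≤x 2)
  where
  eq : ∀ p → p ℚ.+ 1ℚ ≡ 0ℚ ℚ.+ 1ℚ ℚ.+ p
  eq = solve-∀ E.ring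
  first : ∀ q → E.expTerm q 1 ≡ q
  first q = begin
    E.expTerm q 1                    ≡⟨ ℚ.*-identityˡ (E.expTerm q 1) ⟨
    1ℚ ℚ.* E.expTerm q 1             ≡⟨ cong (ℚ._* E.expTerm q 1) E.fromℕ-1 ⟨
    E.fromℕ 1 ℚ.* E.expTerm q 1      ≡⟨ expTerm-rec q 0 ⟩
    q ℚ.* E.expTerm q 0              ≡⟨ cong (q ℚ.*_) (expTerm-0 q) ⟩
    q ℚ.* 1ℚ                         ≡⟨ ℚ.*-identityʳ q ⟩
    q                                ∎
    where open ≡-Reasoning

module _ {b : ℚ} (0<b : 0ℚ ℚ.< b) where

  private
    Y Q : ℕ → ℝ
    Y k = fromℚ b * fromℕ (3 ℕ.+ k)
    Q k = exp (- Y k)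
    0<n : ∀ k → 0ℚ ℚ.< E.fromℕ (3 ℕ.+ k)
    0<n k = ℚ.<-≤-trans (ℚ.positive⁻¹ 1ℚ) (subst (ℚ._≤ E.fromℕ (3 ℕ.+ k)) E.fromℕ-1 (E.fromℕ-mono (s≤s z≤n)))
    0<Y : ∀ k → 0ℚ ℚ.< b ℚ.* E.fromℕ (3 ℕ.+ k)
    0<Y k = E.0<* 0<b (0<n k)

  geometric-pos : ∀ k → PosBelow (Q k)
  geometric-pos k = exp-pos {(- Y k)} (always λ _ → ℚ.neg-antimono-≤ (ℚ.<⇒≤ (0<Y k)))

  -- From Y ≤ exp Y follows Y * exp (- Y) ≤ 1, hence eventually at most 2 with slack 1. N is chosen
  -- so that b n ε is at least 2 for every k from N on; dividing by Y = b n leaves ε.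
  geometric-small : ∀ ε → 0ℚ ℚ.< ε → ∃ λ N → ∀ k → N ℕ.≤ k → Eventually λ j → seq (Q k) j ℚ.≤ ε
  geometric-small ε 0<ε = let (N , 1≤) = 1≤fromℕ* (E.0<½* (E.0<* 0<b 0<ε)) in
    N , λ k N≤k → ev-map (λ j YQ≤ →
      ℚ.*-cancelˡ-≤-pos (b ℚ.* E.fromℕ (3 ℕ.+ k)) {{ℚ.positive (0<Y k)}} (begin
        b ℚ.* E.fromℕ (3 ℕ.+ k) ℚ.* seq (Q k) j           ≤⟨ YQ≤ ⟩
        1ℚ ℚ.+ 1ℚ                                        ≤⟨ ℚ.+-mono-≤ 1≤ 1≤ ⟩
        E.fromℕ (suc N) ℚ.* (b ℚ.* ε ℚ.* ½) ℚ.+ E.fromℕ (suc N) ℚ.* (b ℚ.* ε ℚ.* ½)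
          ≡⟨ trans (sym (ℚ.*-distribˡ-+ (E.fromℕ (suc N)) _ _)) (cong (E.fromℕ (suc N) ℚ.*_) (E.halves (b ℚ.* ε))) ⟩
        E.fromℕ (suc N) ℚ.* (b ℚ.* ε)                    ≤⟨ E.*-monoʳ (ℚ.<⇒≤ (E.0<* 0<b 0<ε))
                                                             (E.fromℕ-mono (s≤s (ℕ.≤-trans N≤k (ℕ.m≤n+m k 2)))) ⟩
        E.fromℕ (3 ℕ.+ k) ℚ.* (b ℚ.* ε)                  ≡⟨ swap (E.fromℕ (3 ℕ.+ k)) b ε ⟩
        b ℚ.* E.fromℕ (3 ℕ.+ k) ℚ.* ε                    ∎))
      (_⊑_.bounded (⊑-trans (*-monoʳ-⊑ {Y k} {exp (Y k)} {Q k} (PosBelow⇒NonNeg {Q k} (geometric-pos k))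
        (x⊑exp {Y k} (always λ _ → ℚ.<⇒≤ (0<Y k)))) (≋⇒⊑ (exp-inverse (Y k)))) 1ℚ (ℚ.positive⁻¹ 1ℚ))
    where
    open ℚ.≤-Reasoning
    swap : ∀ n b ε → n ℚ.* (b ℚ.* ε) ≡ b ℚ.* n ℚ.* ε
    swap = solve-∀ E.ring

  -- A quarter of ε goes to P ⊑ Q and a quarter to the size of Q; the remaining half is the strict
  -- gap demanded by `⟶`. Nonnegativity of P bounds the absolute value from the other side.
  geometric-⟶0 : ∀ (P : ℕ → ℝ) → (∀ k → 0ℝ ⊑ P k) → ∀ N → (∀ k → N ℕ.≤ k → P k ⊑ Q k) → P ⟶ 0ℝ
  geometric-⟶0 P 0⊑P N P⊑Q ε 0<ε =
    let (M , small) = geometric-small θ 0<θ in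
    N ℕ.⊔ M , λ k ≤k →
      let (J , bound) = ev-zip (λ j (P≤ , 0≤) Q≤ → E.∣∣-lub (upper j P≤ Q≤) (lower (seq (P k) j) 0≤))
                          (ev-zip (λ _ → _,_) (_⊑_.bounded (P⊑Q k (ℕ.m⊔n≤o⇒m≤o N M ≤k)) θ 0<θ) (_⊑_.bounded (0⊑P k) η 0<η))
                          (small k (ℕ.m⊔n≤o⇒n≤o N M ≤k)) in
      η , 0<η , J , λ i _ J≤i _ → subst (ℚ.∣ seq (P k) i ℚ.- 0ℚ ∣ ℚ.+ η ℚ.≤_) (E.halves ε) (ℚ.+-monoˡ-≤ η (bound i J≤i))
    where
    η θ : ℚ
    η = ε ℚ.* ½
    θ = η ℚ.* ½
    0<η : 0ℚ ℚ.< η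
    0<η = E.0<½* 0<ε
    0<θ : 0ℚ ℚ.< θ
    0<θ = E.0<½* 0<η
    upper : ∀ {k} j → seq (P k) j ℚ.≤ seq (Q k) j ℚ.+ θ → seq (Q k) j ℚ.≤ θ → seq (P k) j ℚ.- 0ℚ ℚ.≤ η
    upper {k} j P≤ Q≤ = subst₂ ℚ._≤_ (sym (ℚ.+-identityʳ (seq (P k) j))) (E.halves η) (ℚ.≤-trans P≤ (ℚ.+-monoˡ-≤ θ Q≤))
    lower : ∀ p → 0ℚ ℚ.≤ p ℚ.+ η → ℚ.- (p ℚ.- 0ℚ) ℚ.≤ η
    lower p 0≤p+η = subst₂ ℚ._≤_ (eq₁ p) (eq₂ p η) (ℚ.+-monoʳ-≤ (ℚ.- p) 0≤p+η)
      where
      eq₁ : ∀ p → ℚ.- p ℚ.+ 0ℚ ≡ ℚ.- (p ℚ.- 0ℚ)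
      eq₁ = solve-∀ E.ring
      eq₂ : ∀ p η → ℚ.- p ℚ.+ (p ℚ.+ η) ≡ η
      eq₂ = solve-∀ E.ring

-- The tail bound r exceeds c by ε. Half of this is spent because r ≤ X n holds only up to an
-- arbitrarily small error; the other half remains, the same for all n.
liminf-margin : ∀ {c X} → c <liminf X → ∃ λ δ → 0ℚ ℚ.< δ × ∃ λ N → ∀ n → N ℕ.≤ n → Eventually λ j → seq c j ℚ.+ δ ℚ.≤ seq (X n) j
liminf-margin {c} {X} (N , r , (ε , 0<ε , M , c<r) , r≤X) = ε ℚ.* ½ , E.0<½* 0<ε , N , λ n N≤n →
  let (M′ , r≤) = r≤X n N≤n (ε ℚ.* ½) (E.0<½* 0<ε) in
  M ℕ.⊔ M′ , λ j ≤j →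
    let M≤j = ℕ.m⊔n≤o⇒m≤o M M′ ≤j ; M′≤j = ℕ.m⊔n≤o⇒n≤o M M′ ≤j in
    drop (seq c j) (seq (X n) j) (ℚ.≤-trans (c<r j j M≤j M≤j) (r≤ j j M′≤j M′≤j))
  where
  drop : ∀ p q → p ℚ.+ ε ℚ.≤ q ℚ.+ ε ℚ.* ½ → p ℚ.+ ε ℚ.* ½ ℚ.≤ q
  drop p q ≤q = subst₂ ℚ._≤_
    (trans (cong (λ z → p ℚ.+ z ℚ.- ε ℚ.* ½) (sym (E.halves ε))) (eq₁ p (ε ℚ.* ½))) (eq₂ q (ε ℚ.* ½))
    (ℚ.+-monoˡ-≤ (ℚ.- (ε ℚ.* ½)) ≤q)
    where
    eq₁ : ∀ p h → p ℚ.+ (h ℚ.+ h) ℚ.- h ≡ p ℚ.+ h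
    eq₁ = solve-∀ E.ring
    eq₂ : ∀ q h → q ℚ.+ h ℚ.- h ≡ q
    eq₂ = solve-∀ E.ring

<⇒NonNeg : ∀ {x} → 0ℝ < x → NonNeg x
<⇒NonNeg (ε , 0<ε , N , ≤x) = N , λ j N≤j → ℚ.≤-trans (ℚ.<⇒≤ (subst (0ℚ ℚ.<_) (sym (ℚ.+-identityˡ ε)) 0<ε)) (≤x j j N≤j N≤j)

fromℚ-pos : ∀ {q} → 0ℚ ℚ.< q → 0ℝ < fromℚ q
fromℚ-pos {q} 0<q = q , 0<q , 0 , λ _ _ _ _ → ℚ.≤-reflexive (ℚ.+-identityˡ q)

theorem4 : (Λ : ℕ → ℝ) → (∀ n → 3 ℕ.≤ n → 0ℝ < Λ n) →
    (ln2 : ℝ) → exp ln2 ≈ fromℕ 2 →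
    fromℕ 16 * ln2 <liminf (λ k → Λ (3 ℕ.+ k) ÷ ((3 ℕ.+ k) ℕ.^ 3)) →
    (∃ λ K → ∃ λ β → 0ℝ < K × 0ℝ < β ×
    (∀ k → ℙF k (Λ (3 ℕ.+ k)) < K * exp (- (β * fromℕ (3 ℕ.+ k)))))
    × ((λ k → ℙF k (Λ (3 ℕ.+ k))) ⟶ 0ℝ)
theorem4 Λ 0<Λ ln2 exp-ln2 16ln2<Λ/n³ =
  (fromℕ (suc c) , fromℚ b , fromℚ-pos 0<K , fromℚ-pos 0<b , λ k → <-multiple {P k} {Q k} c (geometric-pos 0<b k) (P⊑cQ k)) ,
  geometric-⟶0 0<b P 0⊑P N P⊑Q
  where
  margin : ∃ λ δ → 0ℚ ℚ.< δ × ∃ λ N → ∀ k → N ℕ.≤ k → Eventually λ j →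
    E.fromℕ 16 ℚ.* seq ln2 j ℚ.+ δ ℚ.≤ seq (Λ (3 ℕ.+ k)) j ℚ.* E.1/ℕ ((3 ℕ.+ k) ℕ.^ 3)
  margin = liminf-margin {fromℕ 16 * ln2} {λ k → Λ (3 ℕ.+ k) ÷ ((3 ℕ.+ k) ℕ.^ 3)} 16ln2<Λ/n³
  δ b : ℚ
  δ = proj₁ margin
  -- The decay rate β: the margin δ above 16 ln 2, divided by the 8 of 8n².
  b = E.1/ℕ 8 ℚ.* δ
  N : ℕ
  N = proj₁ (proj₂ (proj₂ margin))
  0<b : 0ℚ ℚ.< b
  0<b = E.0<* (E.0<1/ℕ 8) (proj₁ (proj₂ margin))
  P Q : ℕ → ℝ
  P k = ℙF k (Λ (3 ℕ.+ k))
  Q k = exp (- (fromℚ b * fromℕ (3 ℕ.+ k)))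
  0≤Λ : ∀ k → NonNeg (Λ (3 ℕ.+ k))
  0≤Λ k = <⇒NonNeg {Λ (3 ℕ.+ k)} (0<Λ (3 ℕ.+ k) (s≤s (s≤s (s≤s z≤n))))
  0⊑P : ∀ k → 0ℝ ⊑ P k
  0⊑P k = 0⊑ℙ {Λ (3 ℕ.+ k) ÷ size k} (ev-map (λ j 0≤ → E.0≤* 0≤ (E.0≤1/ℕ (size k))) (0≤Λ k)) (F? k)
  P⊑Q : ∀ k → N ℕ.≤ k → P k ⊑ Q k
  P⊑Q k N≤k = ⊑-trans (ℙF-⊑ {ln2} (≈⇒≋ {exp ln2} {fromℕ 2} exp-ln2) k {Λ (3 ℕ.+ k)} (0≤Λ k))
    (exp-mono {exponent ln2 k (Λ (3 ℕ.+ k))} {(- (fromℚ b * fromℕ (3 ℕ.+ k)))}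
      -- `exp-mono` asks for a nonpositive left argument; the exponent is nonpositive because it is
      -- at most - b n.
      (ev-map (λ _ ≤-bn → ℚ.≤-trans ≤-bn (ℚ.neg-antimono-≤ (E.0≤* (ℚ.<⇒≤ 0<b) (E.0≤fromℕ (3 ℕ.+ k))))) exponent≤)
      exponent≤)
    where
    exponent≤ : Eventually λ j → seq (exponent ln2 k (Λ (3 ℕ.+ k))) j ℚ.≤ ℚ.- (b ℚ.* E.fromℕ (3 ℕ.+ k))
    exponent≤ = ev-zip (λ j → exponent-≤ ln2 k (Λ (3 ℕ.+ k)) δ j) (0≤Λ k) (proj₂ (proj₂ (proj₂ margin)) k N≤k)
  domination : ∃ λ c → ∀ k → P k ⊑ fromℕ c * Q k
  domination = uniformly-dominated P Q (geometric-pos 0<b) N P⊑Q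
  c : ℕ
  c = proj₁ domination
  P⊑cQ : ∀ k → P k ⊑ fromℕ c * Q k
  P⊑cQ = proj₂ domination
  0<K : 0ℚ ℚ.< E.fromℕ (suc c)
  0<K = ℚ.<-≤-trans (ℚ.positive⁻¹ 1ℚ) (subst (ℚ._≤ E.fromℕ (suc c)) E.fromℕ-1 (E.fromℕ-mono (s≤s z≤n)))
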